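{- For $n\ge1$ and a partition $\alpha\vdash n$, let $H_\alpha$ be the number of tuples $(\tau_1,\dots,\tau_r)$ of transpositions in $S_n$, with $r=n+l(\alpha)-2$, such that $\tau_1\cdots\tau_r=\pi$ for a fixed permutation $\pi$ of cycle type $\alpha$ and the group $\langle\tau_1,\dots,\tau_r\rangle$ acts transitively on $\{1,\dots,n\}$. Define the formal power series $$\widehat{H}=\sum_{n\ge1}\sum_{\alpha\vdash n}H_\alpha\,\frac{z^n}{n!}\,\frac{|\mathcal{C}_\alpha|}{(n+l(\alpha)-2)!}\,p_\alpha\,u^{l(\alpha)}.$$ Then $$z\frac{\partial}{\partial z}\widehat{H}=z\frac{\partial}{\partial z}\,u\frac{\partial}{\partial u}\widehat{H}-\frac12\left(\left(z\frac{\partial}{\partial z}\right)^2\widehat{H}\right)^2.$$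
   Context: A partition $\alpha=(\alpha_1,\dots,\alpha_k)$ of $n$ (written $\alpha\vdash n$) has $l(\alpha)=k$ parts; $p_\alpha=p_{\alpha_1}\cdots p_{\alpha_k}$ where $p_1,p_2,\dots$ are indeterminates; $\mathcal{C}_\alpha\subseteq S_n$ is the conjugacy class of permutations of cycle type $\alpha$, so $|\mathcal{C}_\alpha|=n!/\prod_{i\ge1}i^{d_i}d_i!$ if $\alpha$ has $d_i$ parts equal to $i$. $z,u,p_1,p_2,\dots$ are independent indeterminates. It is known (Goulden–Jackson) that $H_\alpha=n^{l(\alpha)-3}(n+l(\alpha)-2)!\prod_{i\ge1}\left(\frac{i^i}{(i-1)!}\right)^{d_i}$. -}

module Defs where

open import Data.Nat as ℕ using (ℕ; zero; suc; _∸_; _≡ᵇ_; _≤ᵇ_; _<_; _!; _^_)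
open import Data.Bool using (Bool; true; false; if_then_else_; _∧_)
open import Data.Product using (_×_; _,_; Σ; ∃)
open import Data.List using (List; []; _∷_; length; map; concatMap; upTo; replicate; _++_; foldr; filter)
open import Data.Nat.ListAction using (sum)
open import Data.List.Relation.Unary.All using (All)
open import Data.List.Relation.Unary.Unique.Propositional using (Unique)
open import Data.List.Membership.Propositional using (_∈_)
open import Data.Integer using (+_)
open import Data.Rational using (ℚ; _/_; 0ℚ; _+_; _*_)
open import Relation.Binary.PropositionalEquality using (_≡_)
open import Function.Bundles using (_⇔_)

nonincr : List ℕ → Bool
nonincr []            = true
nonincr (x ∷ [])      = true
nonincr (x ∷ y ∷ xs)  = (y ≤ᵇ x) ∧ nonincr (y ∷ xs)

allPos : List ℕ → Bool
allPos []       = true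
allPos (x ∷ xs) = (1 ≤ᵇ x) ∧ allPos xs

isPartition : List ℕ → Bool
isPartition α = nonincr α ∧ allPos α

_⊢_ : List ℕ → ℕ → Set
α ⊢ n = (isPartition α ≡ true) × (sum α ≡ n)

-- Permutations of {0,…,n-1} are modelled as functions ℕ → ℕ (only their
-- values on {0,…,n-1} matter).  A transposition is a pair (i , j), i < j < n.

swap : ℕ × ℕ → ℕ → ℕ
swap (i , j) x = if x ≡ᵇ i then j else (if x ≡ᵇ j then i else x)

prodT : List (ℕ × ℕ) → ℕ → ℕ
prodT []       x = x
prodT (τ ∷ ts) x = swap τ (prodT ts x)

-- A fixed permutation of cycle type α: the cycles are the consecutive blocks
-- {s, …, s+a-1}, each mapped cyclically s ↦ s+1 ↦ … ↦ s+a-1 ↦ s.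
canonFrom : List ℕ → ℕ → ℕ → ℕ
canonFrom []       s x = x
canonFrom (a ∷ as) s x =
  if suc x ≤ᵇ ℕ._+_ s a
    then (if suc (suc x) ≤ᵇ ℕ._+_ s a then suc x else s)
    else canonFrom as (ℕ._+_ s a) x

canonPerm : List ℕ → ℕ → ℕ
canonPerm α = canonFrom α 0

IsTransposition : ℕ → ℕ × ℕ → Set
IsTransposition n (i , j) = (i < j) × (j < n)

-- The subgroup generated by transpositions τ₁,…,τᵣ consists of the products
-- of words in the generators (each generator is an involution).
-- It acts transitively on {0,…,n-1}.
GenTransitive : ℕ → List (ℕ × ℕ) → Set
GenTransitive n ts =
  ∀ x y → x < n → y < n →
  ∃ λ (w : List (ℕ × ℕ)) → All (λ τ → τ ∈ ts) w × (prodT w x ≡ y)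

Counted : ℕ → List ℕ → List (ℕ × ℕ) → Set
Counted n α ts =
  (length ts ≡ (ℕ._+_ n (length α)) ∸ 2) ×
  All (IsTransposition n) ts ×
  (∀ x → x < n → prodT ts x ≡ canonPerm α x) ×
  GenTransitive n ts

IsHurwitzNumber : ℕ → List ℕ → ℕ → Set
IsHurwitzNumber n α h =
  Σ (List (List (ℕ × ℕ))) λ L →
    Unique L × (∀ ts → (ts ∈ L) ⇔ Counted n α ts) × (length L ≡ h)

-- Formal power series in z, u, p₁, p₂, … with rational coefficients.
-- A series is its coefficient function: (n , k , λ) ↦ [z^n u^k p_λ],
-- where the p-monomial p_λ is indexed by a partition λ (junk otherwise).

Series : Set
Series = ℕ → ℕ → List ℕ → ℚ

-- total division of naturals into ℚ (only used with nonzero denominators)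
frac : ℕ → ℕ → ℚ
frac a zero    = 0ℚ
frac a (suc b) = (+ a) / suc b

sumℚ : List ℚ → ℚ
sumℚ = foldr _+_ 0ℚ

mult : ℕ → List ℕ → ℕ
mult i α = length (filter (λ x → x ℕ.≟ i) α)

-- ∏_{i ≥ 1} i^{d_i} d_i!   (all parts of α ⊢ n are ≤ n)
zee : ℕ → List ℕ → ℕ
zee n α = foldr ℕ._*_ 1 (map (λ i → ℕ._*_ (i ^ mult i α) (mult i α !)) (map suc (upTo n)))

classSize : ℕ → List ℕ → ℚ
classSize n α = frac (n !) (zee n α)

Hhat : (List ℕ → ℕ) → Series
Hhat H n k ν =
  if isPartition ν ∧ (sum ν ≡ᵇ n) ∧ (k ≡ᵇ length ν) ∧ (1 ≤ᵇ n)
    then frac (H ν) 1 * frac 1 (n !) * classSize n ν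
           * frac 1 ((ℕ._+_ n (length ν) ∸ 2) !)
    else 0ℚ

zD : Series → Series
zD f n k ν = frac n 1 * f n k ν

uD : Series → Series
uD f n k ν = frac k 1 * f n k ν

runs : List ℕ → List (ℕ × ℕ)
runs [] = []
runs (x ∷ xs) with runs xs
... | [] = (x , 1) ∷ []
... | (v , d) ∷ rs = if x ≡ᵇ v then (v , suc d) ∷ rs else (x , 1) ∷ (v , d) ∷ rs

-- all ordered pairs (μ₁ , μ₂) of partitions with p_μ₁ p_μ₂ = p_λ
splitsR : List (ℕ × ℕ) → List (List ℕ × List ℕ)
splitsR [] = ([] , []) ∷ []
splitsR ((v , d) ∷ rs) =
  concatMap (λ j → map (λ { (a , b) → (replicate j v ++ a , replicate (d ∸ j) v ++ b) })
                       (splitsR rs))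
            (upTo (suc d))

splits : List ℕ → List (List ℕ × List ℕ)
splits ν = splitsR (runs ν)

_·_ : Series → Series → Series
(f · g) n k ν =
  sumℚ (map (λ n₁ →
    sumℚ (map (λ k₁ →
      sumℚ (map (λ { (μ₁ , μ₂) → f n₁ k₁ μ₁ * g (n ∸ n₁) (k ∸ k₁) μ₂ })
                (splits ν)))
      (upTo (suc k))))
    (upTo (suc n)))

{-# OPTIONS --safe #-}

-- Peel off the first transposition (x y) of a minimal transitive factorization
-- of a permutation with cycle lengths a₁, …, aₗ.  Either x and y lie in different
-- cycles, which get joined and the remaining factors are still transitive, or they
-- lie in the same cycle, which is cut; then the Riemann–Hurwitz inequality forces
-- the remaining factors to be a shuffle of minimal transitive factorizations on
-- two components.  This recursion determines the numbers, and they are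
-- (n + l - 2)! n^{l-3} ∏ aᵢ^aᵢ / (aᵢ - 1)!: by the Abel–Hurwitz identities the sum
-- over the distributions of the uncut cycles reduces to sums over one and two
-- cycles, and the latter to an identity for c_m = m^m / m! that
-- follows from the binomial expansion of (a + b)^{a+b}.
-- After inserting this formula, the differential equation becomes the identity
-- ∑ s^{#S-1} t^{#T-1} = 2 (l - 1) n^{l-2} over the decompositions of the set of
-- parts into two nonempty sets S and T with sums s and t.
module Submission where

open import Data.Bool using (Bool; true; false; not; T; if_then_else_; _∧_)
open import Data.Empty using (⊥; ⊥-elim)
open import Data.List
  using (List; []; _∷_; _++_; length; map; concat; concatMap; replicate; upTo; applyUpTo; filterᵇ)
open import Data.List.Membership.Propositional using (_∈_; _∉_; find)
open import Data.List.Membership.Propositional.Properties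
  using (∈-++⁺ˡ; ∈-++⁺ʳ; ∈-++⁻; ∈-map⁺; ∈-map⁻; ∈-∃++; ∈-length; ∈-concatMap⁻; ∈-upTo⁻)
open import Data.List.Properties
  using (length-++; length-map; length-replicate; ++-assoc; ++-identityʳ; map-++; map-∘; map-id; concat-++
        ; filter-accept; filter-reject; filter-none; upTo-∷ʳ)
open import Data.List.Relation.Binary.Permutation.Propositional as Perm
  using (_↭_; ↭-refl; ↭-sym; ↭-trans; ↭-reflexive; prep)
open import Data.List.Relation.Binary.Permutation.Propositional.Properties
  using (All-resp-↭; ∈-resp-↭; ↭-length; ++⁺ˡ; ++⁺ʳ; ++-comm; shift; shifts)
open import Data.List.Relation.Unary.All as All using (All; []; _∷_)
import Data.List.Relation.Unary.All.Properties as Allₚ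
open import Data.List.Relation.Unary.AllPairs using ([]; _∷_)
open import Data.List.Relation.Unary.Any using (here; there)
open import Data.List.Relation.Unary.Unique.Propositional using (Unique)
import Data.List.Relation.Unary.Unique.Propositional.Properties as Uniqueₚ
open import Data.Nat as ℕ using (ℕ; zero; suc; _≤_; _<_; z≤n; s≤s; _!; _∸_; _≡ᵇ_; _≤ᵇ_; _<ᵇ_)
open import Data.Nat.Induction using (<-rec)
open import Data.Nat.ListAction using (sum; product)
open import Data.Nat.ListAction.Properties using (product-++; sum-++)
import Data.Nat.Properties as ℕₚ
import Data.Nat.Tactic.RingSolver as ℕ-Solver
open import Data.Product using (_×_; _,_; proj₁; proj₂; ∃)
open import Data.Rational using (ℚ; 0ℚ; 1ℚ; ½; _+_; _*_; _-_; -_)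
open import Data.Rational.Properties
  using (+-assoc; +-comm; +-identityˡ; +-identityʳ; +-inverseʳ; *-assoc; *-comm; *-identityˡ; *-identityʳ
        ; *-zeroˡ; *-zeroʳ; *-distribˡ-+; *-distribʳ-+)
open import Data.Sum using (_⊎_; inj₁; inj₂; [_,_]′)
open import Function using (_∘_; id)
open import Relation.Binary.PropositionalEquality
open import Relation.Nullary using (¬_; yes; no; does; contradiction)
open import Tactic.RingSolver using (solve-∀)

-- The Goulden-Jackson formula is derived rather than assumed, since the hypothesis fixes `H` only
-- by counting. Two normalisations simplify the recursion. Transpositions are oriented pairs, so the
-- first factor is just a point x followed by a different point y; every factorization is then
-- counted 2^r times, and this power is cancelled at the end. Counts are divided by r!, so that the
-- binomial coefficient for interleaving two components disappears and a cut becomes a plain sum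
-- over the distributions of the uncut cycles. The obstacle is that the cut terms leave convolutions
-- with denominators b + j, which cancel against the join terms only after each pair of cycles is
-- taken in both orders. Two notions of decomposition have to be reconciled: the counting
-- distributes cycles as distinct objects, whereas the product of series splits a multiset of parts.
-- The weight |C_α| / n! = 1 / z_α converts one into the other, and the factor ½ matches the 2 that
-- ordered pairs (S, T) produce.

-- Rational arithmetic with natural numbers and their inverses

module Rationals where
  open import Data.Integer as ℤ using (+_)
  import Data.Integer.Properties as ℤₚ
  open import Data.Integer.Tactic.RingSolver using () renaming (solve-∀ to ℤ-solve)
  open import Data.Rational using (toℚᵘ)
  open import Data.Rational.Properties
    using (toℚᵘ-injective; toℚᵘ-fromℚᵘ; toℚᵘ-homo-+; toℚᵘ-homo-*; +-*-commutativeRing; _≟_)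
  open import Data.Rational.Unnormalised as ℚᵘ using (mkℚᵘ; *≡*)
  import Data.Rational.Unnormalised.Properties as ℚᵘₚ
  open import Data.Maybe using (Maybe; just; nothing)
  open import Level using (0ℓ)
  open import Tactic.RingSolver.Core.AlmostCommutativeRing using (AlmostCommutativeRing; fromCommutativeRing)
  open import Defs using (frac)

  ℚ-ring : AlmostCommutativeRing 0ℓ 0ℓ
  ℚ-ring = fromCommutativeRing +-*-commutativeRing isZero
    where
    isZero : ∀ x → Maybe (0ℚ ≡ x)
    isZero x with 0ℚ ≟ x
    ... | yes p = just p
    ... | no _  = nothing

  -- Opaque, so that the gcd computations in ℚ are never unfolded; inv 0 = 0.
  opaque
    ι inv : ℕ → ℚ
    ι n   = frac n 1
    inv n = frac 1 n

    ι-def : ∀ n → frac n 1 ≡ ι n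
    ι-def n = refl

    inv-def : ∀ n → frac 1 n ≡ inv n
    inv-def n = refl

    ι-0 : ι 0 ≡ 0ℚ
    ι-0 = refl

    ι-1 : ι 1 ≡ 1ℚ
    ι-1 = refl

    inv-1 : inv 1 ≡ 1ℚ
    inv-1 = refl

    inv-0 : inv 0 ≡ 0ℚ
    inv-0 = refl

  2ℚ : ℚ
  2ℚ = 1ℚ + 1ℚ

  -- Values of `frac` are reduced by a gcd. In the unnormalised rationals the reduction disappears
  -- up to equivalence, and the arithmetic laws become integer identities.
  toℚᵘ-frac : ∀ a b → toℚᵘ (frac a (suc b)) ℚᵘ.≃ mkℚᵘ (+ a) b
  toℚᵘ-frac a b = toℚᵘ-fromℚᵘ (mkℚᵘ (+ a) b)

  opaque
    unfolding ι inv

    ι-+ : ∀ m n → ι (m ℕ.+ n) ≡ ι m + ι n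
    ι-+ m n = toℚᵘ-injective (ℚᵘₚ.≃-trans (toℚᵘ-frac (m ℕ.+ n) 0) (ℚᵘₚ.≃-sym
      (ℚᵘₚ.≃-trans (toℚᵘ-homo-+ (ι m) (ι n)) (ℚᵘₚ.≃-trans (ℚᵘₚ.+-cong (toℚᵘ-frac m 0) (toℚᵘ-frac n 0)) (*≡* (lem (+ m) (+ n)))))))
      where
      lem : ∀ x y → (x ℤ.* ℤ.1ℤ ℤ.+ y ℤ.* ℤ.1ℤ) ℤ.* ℤ.1ℤ ≡ (x ℤ.+ y) ℤ.* ℤ.1ℤ
      lem = ℤ-solve

    ι-* : ∀ m n → ι (m ℕ.* n) ≡ ι m * ι n
    ι-* m n = toℚᵘ-injective (ℚᵘₚ.≃-trans (toℚᵘ-frac (m ℕ.* n) 0) (ℚᵘₚ.≃-sym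
      (ℚᵘₚ.≃-trans (toℚᵘ-homo-* (ι m) (ι n)) (ℚᵘₚ.≃-trans (ℚᵘₚ.*-cong (toℚᵘ-frac m 0) (toℚᵘ-frac n 0))
        (*≡* (cong (ℤ._* ℤ.1ℤ) (sym (ℤₚ.pos-* m n))))))))

    frac≡ : ∀ a b → frac a (suc b) ≡ ι a * inv (suc b)
    frac≡ a b = toℚᵘ-injective (ℚᵘₚ.≃-trans (toℚᵘ-frac a b) (ℚᵘₚ.≃-sym
      (ℚᵘₚ.≃-trans (toℚᵘ-homo-* (ι a) (inv (suc b))) (ℚᵘₚ.≃-trans (ℚᵘₚ.*-cong (toℚᵘ-frac a 0) (toℚᵘ-frac 1 b))
        (*≡* (trans (lem (+ a) (+ suc b)) (cong (+ a ℤ.*_) (sym (ℤₚ.pos-* 1 (suc b))))))))))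
      where
      lem : ∀ x y → x ℤ.* ℤ.1ℤ ℤ.* y ≡ x ℤ.* (ℤ.1ℤ ℤ.* y)
      lem = ℤ-solve

    ι-inv : ∀ n → ι (suc n) * inv (suc n) ≡ 1ℚ
    ι-inv n = trans (sym (frac≡ (suc n) n)) (toℚᵘ-injective (ℚᵘₚ.≃-trans (toℚᵘ-frac (suc n) n)
      (*≡* (trans (ℤₚ.*-identityʳ (+ suc n)) (sym (ℤₚ.*-identityˡ (+ suc n)))))))

  ι-inv⁺ : ∀ {n} → 1 ≤ n → ι n * inv n ≡ 1ℚ
  ι-inv⁺ (s≤s {n = n} _) = ι-inv n

  frac-ι-inv : ∀ a {b} → 1 ≤ b → frac a b ≡ ι a * inv b
  frac-ι-inv a (s≤s {n = b} _) = frac≡ a b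

  ι-suc : ∀ n → ι (suc n) ≡ 1ℚ + ι n
  ι-suc n = trans (ι-+ 1 n) (cong (_+ ι n) ι-1)

  -- The inverse is an explicit argument, so that one lemma serves for naturals, factorials, 2 and
  -- powers of 2 without any division on ℚ.
  cancelˡ-inv : ∀ x {y z} x⁻¹ → x * x⁻¹ ≡ 1ℚ → x * y ≡ x * z → y ≡ z
  cancelˡ-inv x {y} {z} x⁻¹ e p = begin
    y               ≡⟨ sym (lem x x⁻¹ y e) ⟩
    x⁻¹ * (x * y)   ≡⟨ cong (x⁻¹ *_) p ⟩
    x⁻¹ * (x * z)   ≡⟨ lem x x⁻¹ z e ⟩
    z ∎
    where
    open ≡-Reasoning
    assoc′ : ∀ x i y → i * (x * y) ≡ (x * i) * y
    assoc′ = solve-∀ ℚ-ring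
    lem : ∀ x i y → x * i ≡ 1ℚ → i * (x * y) ≡ y
    lem x i y e = trans (assoc′ x i y) (trans (cong (_* y) e) (*-identityˡ y))

  ι-cancelˡ : ∀ {n y z} → 1 ≤ n → ι n * y ≡ ι n * z → y ≡ z
  ι-cancelˡ {n} n≥1 = cancelˡ-inv (ι n) (inv n) (ι-inv⁺ n≥1)

  inv-* : ∀ {m n} → 1 ≤ m → 1 ≤ n → inv (m ℕ.* n) ≡ inv m * inv n
  inv-* {m} {n} m≥1 n≥1 = ι-cancelˡ (ℕₚ.*-mono-≤ m≥1 n≥1) (begin
    ι (m ℕ.* n) * inv (m ℕ.* n)   ≡⟨ ι-inv⁺ (ℕₚ.*-mono-≤ m≥1 n≥1) ⟩
    1ℚ                            ≡⟨ cong₂ _*_ (ι-inv⁺ m≥1) (ι-inv⁺ n≥1) ⟨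
    (ι m * inv m) * (ι n * inv n) ≡⟨ lem (ι m) (inv m) (ι n) (inv n) ⟩
    (ι m * ι n) * (inv m * inv n) ≡⟨ cong (_* (inv m * inv n)) (ι-* m n) ⟨
    ι (m ℕ.* n) * (inv m * inv n) ∎)
    where
    open ≡-Reasoning
    lem : ∀ a b c d → (a * b) * (c * d) ≡ (a * c) * (b * d)
    lem = solve-∀ ℚ-ring

  infixr 8 _^_
  _^_ : ℚ → ℕ → ℚ
  x ^ zero  = 1ℚ
  x ^ suc n = x * x ^ n

  ^-+ : ∀ x m n → x ^ (m ℕ.+ n) ≡ x ^ m * x ^ n
  ^-+ x zero    n = sym (*-identityˡ _)
  ^-+ x (suc m) n = trans (cong (x *_) (^-+ x m n)) (sym (*-assoc x _ _))

-- Finite sums: over lists, two-block decompositions, marked entries and i + j = n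

module Sums where
  open import Defs using (sumℚ)
  open Rationals
  open ≡-Reasoning

  private variable
    A B : Set

  +-interchange : ∀ a b c d → (a + b) + (c + d) ≡ (a + c) + (b + d)
  +-interchange = solve-∀ ℚ-ring

  ∑ : List A → (A → ℚ) → ℚ
  ∑ xs f = sumℚ (map f xs)

  ∑-cong-∈ : ∀ (xs : List A) {f g : A → ℚ} → (∀ {x} → x ∈ xs → f x ≡ g x) → ∑ xs f ≡ ∑ xs g
  ∑-cong-∈ []       h = refl
  ∑-cong-∈ (x ∷ xs) h = cong₂ _+_ (h (here refl)) (∑-cong-∈ xs (h ∘ there))

  ∑-cong : ∀ (xs : List A) {f g : A → ℚ} → (∀ x → f x ≡ g x) → ∑ xs f ≡ ∑ xs g
  ∑-cong xs h = ∑-cong-∈ xs (λ {x} _ → h x)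

  ∑-0 : ∀ (xs : List A) → ∑ xs (λ _ → 0ℚ) ≡ 0ℚ
  ∑-0 []       = refl
  ∑-0 (x ∷ xs) = trans (+-identityˡ _) (∑-0 xs)

  ∑-const : ∀ (xs : List A) c → ∑ xs (λ _ → c) ≡ ι (length xs) * c
  ∑-const []       c = sym (trans (cong (_* c) ι-0) (*-zeroˡ c))
  ∑-const (x ∷ xs) c = begin
    c + ∑ xs (λ _ → c)      ≡⟨ cong (c +_) (∑-const xs c) ⟩
    c + ι (length xs) * c   ≡⟨ lem c (ι (length xs)) ⟩
    (1ℚ + ι (length xs)) * c ≡⟨ cong (_* c) (ι-suc (length xs)) ⟨
    ι (suc (length xs)) * c ∎
    where
    lem : ∀ c k → c + k * c ≡ (1ℚ + k) * c
    lem = solve-∀ ℚ-ring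

  ∑-++ : ∀ (xs ys : List A) f → ∑ (xs ++ ys) f ≡ ∑ xs f + ∑ ys f
  ∑-++ []       ys f = sym (+-identityˡ _)
  ∑-++ (x ∷ xs) ys f = trans (cong (f x +_) (∑-++ xs ys f)) (sym (+-assoc (f x) _ _))

  ∑-map : ∀ (h : A → B) xs f → ∑ (map h xs) f ≡ ∑ xs (f ∘ h)
  ∑-map h []       f = refl
  ∑-map h (x ∷ xs) f = cong (f (h x) +_) (∑-map h xs f)

  ∑-concatMap : ∀ (h : A → List B) xs f → ∑ (concatMap h xs) f ≡ ∑ xs (λ x → ∑ (h x) f)
  ∑-concatMap h []       f = refl
  ∑-concatMap h (x ∷ xs) f = trans (∑-++ (h x) (concatMap h xs) f) (cong (∑ (h x) f +_) (∑-concatMap h xs f))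

  ∑-+ : ∀ (xs : List A) f g → ∑ xs (λ x → f x + g x) ≡ ∑ xs f + ∑ xs g
  ∑-+ []       f g = refl
  ∑-+ (x ∷ xs) f g = trans (cong ((f x + g x) +_) (∑-+ xs f g)) (+-interchange (f x) (g x) _ _)

  ∑-*ˡ : ∀ (xs : List A) c f → c * ∑ xs f ≡ ∑ xs (λ x → c * f x)
  ∑-*ˡ []       c f = *-zeroʳ c
  ∑-*ˡ (x ∷ xs) c f = trans (*-distribˡ-+ c (f x) _) (cong (c * f x +_) (∑-*ˡ xs c f))

  ∑-swap : ∀ (xs : List A) (ys : List B) (f : A → B → ℚ) → ∑ xs (λ x → ∑ ys (f x)) ≡ ∑ ys (λ y → ∑ xs (λ x → f x y))
  ∑-swap []       ys f = sym (∑-0 ys)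
  ∑-swap (x ∷ xs) ys f = trans (cong (∑ ys (f x) +_) (∑-swap xs ys f)) (sym (∑-+ ys (f x) _))

  -- Entries are distributed by position, so equal entries count as different objects.
  -- `∑⊎-replicate` later passes to multisets.
  data Split {A : Set} : List A → List A → List A → Set where
    []  : Split [] [] []
    inˡ : ∀ {x S T U} → Split S T U → Split (x ∷ S) T (x ∷ U)
    inʳ : ∀ {x S T U} → Split S T U → Split S (x ∷ T) (x ∷ U)

  ∑⊎ : List A → (List A → List A → ℚ) → ℚ
  ∑⊎ []       g = g [] []
  ∑⊎ (x ∷ xs) g = ∑⊎ xs (λ S T → g (x ∷ S) T) + ∑⊎ xs (λ S T → g S (x ∷ T))

  ∑⊎-cong-Split : ∀ (U : List A) {f g} → (∀ {S T} → Split S T U → f S T ≡ g S T) → ∑⊎ U f ≡ ∑⊎ U g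
  ∑⊎-cong-Split []       h = h []
  ∑⊎-cong-Split (x ∷ xs) h = cong₂ _+_ (∑⊎-cong-Split xs (h ∘ inˡ)) (∑⊎-cong-Split xs (h ∘ inʳ))

  ∑⊎-cong : ∀ (U : List A) {f g} → (∀ S T → f S T ≡ g S T) → ∑⊎ U f ≡ ∑⊎ U g
  ∑⊎-cong U h = ∑⊎-cong-Split U (λ {S} {T} _ → h S T)

  ∑⊎-+ : ∀ (U : List A) f g → ∑⊎ U (λ S T → f S T + g S T) ≡ ∑⊎ U f + ∑⊎ U g
  ∑⊎-+ []       f g = refl
  ∑⊎-+ (x ∷ xs) f g = trans (cong₂ _+_ (∑⊎-+ xs _ _) (∑⊎-+ xs _ _)) (+-interchange (∑⊎ xs (λ S T → f (x ∷ S) T)) _ _ _)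

  ∑⊎-*ˡ : ∀ (U : List A) c f → c * ∑⊎ U f ≡ ∑⊎ U (λ S T → c * f S T)
  ∑⊎-*ˡ []       c f = refl
  ∑⊎-*ˡ (x ∷ xs) c f = trans (*-distribˡ-+ c _ _) (cong₂ _+_ (∑⊎-*ˡ xs c _) (∑⊎-*ˡ xs c _))

  ∑⊎-comm : ∀ (U : List A) f → ∑⊎ U f ≡ ∑⊎ U (λ S T → f T S)
  ∑⊎-comm []       f = refl
  ∑⊎-comm (x ∷ xs) f = trans (+-comm (∑⊎ xs (λ S T → f (x ∷ S) T)) _) (cong₂ _+_ (∑⊎-comm xs _) (∑⊎-comm xs _))

  data Pick {A : Set} (x : A) : List A → List A → Set where
    here  : ∀ {U} → Pick x U (x ∷ U)
    there : ∀ {y V U} → Pick x V U → Pick x (y ∷ V) (y ∷ U)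

  ∑∈ : List A → (A → List A → ℚ) → ℚ
  ∑∈ []       g = 0ℚ
  ∑∈ (x ∷ xs) g = g x xs + ∑∈ xs (λ y ys → g y (x ∷ ys))

  ∑∈-cong-Pick : ∀ (U : List A) {f g} → (∀ {x V} → Pick x V U → f x V ≡ g x V) → ∑∈ U f ≡ ∑∈ U g
  ∑∈-cong-Pick []       h = refl
  ∑∈-cong-Pick (x ∷ xs) h = cong₂ _+_ (h here) (∑∈-cong-Pick xs (h ∘ there))

  ∑∈-cong : ∀ (U : List A) {f g} → (∀ x V → f x V ≡ g x V) → ∑∈ U f ≡ ∑∈ U g
  ∑∈-cong U h = ∑∈-cong-Pick U (λ {x} {V} _ → h x V)

  ∑∈-+ : ∀ (U : List A) f g → ∑∈ U (λ x V → f x V + g x V) ≡ ∑∈ U f + ∑∈ U g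
  ∑∈-+ []       f g = refl
  ∑∈-+ (x ∷ xs) f g = trans (cong (f x xs + g x xs +_) (∑∈-+ xs _ _)) (+-interchange (f x xs) (g x xs) _ _)

  ∑∈-*ˡ : ∀ (U : List A) c f → c * ∑∈ U f ≡ ∑∈ U (λ x V → c * f x V)
  ∑∈-*ˡ []       c f = *-zeroʳ c
  ∑∈-*ˡ (x ∷ xs) c f = trans (*-distribˡ-+ c _ _) (cong (c * f x xs +_) (∑∈-*ˡ xs c _))

  ∑∈-const : ∀ (U : List A) c → ∑∈ U (λ _ _ → c) ≡ ι (length U) * c
  ∑∈-const U c = trans (go U) (∑-const U c)
    where
    go : ∀ {A : Set} (U : List A) → ∑∈ U (λ _ _ → c) ≡ ∑ U (λ _ → c)
    go []      = refl
    go (x ∷ U) = cong (c +_) (go U)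

  ∑∈-ι : ∀ U → ∑∈ U (λ x _ → ι x) ≡ ι (sum U)
  ∑∈-ι []      = sym ι-0
  ∑∈-ι (x ∷ U) = trans (cong (ι x +_) (∑∈-ι U)) (sym (ι-+ x (sum U)))

  -- Marking an entry of the first block after the decomposition amounts to marking it in U
  -- beforehand and distributing the others.
  ∑⊎-∑∈ : ∀ (U : List A) (g : A → List A → List A → ℚ) →
          ∑⊎ U (λ S T → ∑∈ S (λ i S′ → g i S′ T)) ≡ ∑∈ U (λ i U′ → ∑⊎ U′ (g i))
  ∑⊎-∑∈ []      g = refl
  ∑⊎-∑∈ (x ∷ U) g = begin
    ∑⊎ U (λ S T → g x S T + ∑∈ S (λ i S′ → g i (x ∷ S′) T)) + ∑⊎ U (λ S T → ∑∈ S (λ i S′ → g i S′ (x ∷ T)))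
      ≡⟨ cong₂ _+_ (trans (∑⊎-+ U _ _) (cong (∑⊎ U (g x) +_) (∑⊎-∑∈ U _))) (∑⊎-∑∈ U _) ⟩
    (∑⊎ U (g x) + ∑∈ U (λ i U′ → ∑⊎ U′ (λ S T → g i (x ∷ S) T))) + ∑∈ U (λ i U′ → ∑⊎ U′ (λ S T → g i S (x ∷ T)))
      ≡⟨ +-assoc (∑⊎ U (g x)) _ _ ⟩
    ∑⊎ U (g x) + (∑∈ U (λ i U′ → ∑⊎ U′ (λ S T → g i (x ∷ S) T)) + ∑∈ U (λ i U′ → ∑⊎ U′ (λ S T → g i S (x ∷ T))))
      ≡⟨ cong (∑⊎ U (g x) +_) (sym (∑∈-+ U _ _)) ⟩
    ∑⊎ U (g x) + ∑∈ U (λ i U′ → ∑⊎ U′ (λ S T → g i (x ∷ S) T) + ∑⊎ U′ (λ S T → g i S (x ∷ T))) ∎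

  -- Both sides range over ordered pairs of distinct positions. The remaining list W keeps its
  -- order, so it is the same whichever entry is removed first.
  ∑∈-∑∈-comm : ∀ (U : List A) (g : A → A → List A → ℚ) →
               ∑∈ U (λ x V → ∑∈ V (λ y W → g x y W)) ≡ ∑∈ U (λ x V → ∑∈ V (λ y W → g y x W))
  ∑∈-∑∈-comm []      g = refl
  ∑∈-∑∈-comm (z ∷ U) g = begin
    ∑∈ U (g z) + ∑∈ U (λ x V → g x z V + ∑∈ V (λ y W → g x y (z ∷ W)))
      ≡⟨ cong (∑∈ U (g z) +_) (∑∈-+ U _ _) ⟩
    ∑∈ U (g z) + (∑∈ U (λ x V → g x z V) + ∑∈ U (λ x V → ∑∈ V (λ y W → g x y (z ∷ W))))
      ≡⟨ cong (λ q → ∑∈ U (g z) + (∑∈ U (λ x V → g x z V) + q)) (∑∈-∑∈-comm U _) ⟩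
    ∑∈ U (g z) + (∑∈ U (λ x V → g x z V) + ∑∈ U (λ x V → ∑∈ V (λ y W → g y x (z ∷ W))))
      ≡⟨ lem (∑∈ U (g z)) (∑∈ U (λ x V → g x z V)) _ ⟩
    ∑∈ U (λ x V → g x z V) + (∑∈ U (g z) + ∑∈ U (λ x V → ∑∈ V (λ y W → g y x (z ∷ W))))
      ≡⟨ cong (∑∈ U (λ x V → g x z V) +_) (sym (∑∈-+ U _ _)) ⟩
    ∑∈ U (λ x V → g x z V) + ∑∈ U (λ x V → g z x V + ∑∈ V (λ y W → g y x (z ∷ W))) ∎
    where
    lem : ∀ a b c → a + (b + c) ≡ b + (a + c)
    lem = solve-∀ ℚ-ring

  Split-sum : ∀ {S T U} → Split S T U → sum U ≡ sum S ℕ.+ sum T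
  Split-sum [] = refl
  Split-sum (inˡ {x} {S} {T} sp) = trans (cong (x ℕ.+_) (Split-sum sp)) (sym (ℕₚ.+-assoc x (sum S) (sum T)))
  Split-sum (inʳ {x} {S} {T} sp) = trans (cong (x ℕ.+_) (Split-sum sp)) (lem x (sum S) (sum T))
    where
    lem : ∀ x s t → x ℕ.+ (s ℕ.+ t) ≡ s ℕ.+ (x ℕ.+ t)
    lem = ℕ-Solver.solve-∀

  Split-All : ∀ {P : A → Set} {S T U} → Split S T U → All P U → All P S × All P T
  Split-All [] [] = [] , []
  Split-All (inˡ sp) (p ∷ ps) = let (a , b) = Split-All sp ps in p ∷ a , b
  Split-All (inʳ sp) (p ∷ ps) = let (a , b) = Split-All sp ps in a , p ∷ b

  Pick-sum : ∀ {x V U} → Pick x V U → sum U ≡ x ℕ.+ sum V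
  Pick-sum here = refl
  Pick-sum {x} (there {y} {V} p) = trans (cong (y ℕ.+_) (Pick-sum p)) (lem x y (sum V))
    where
    lem : ∀ x y s → y ℕ.+ (x ℕ.+ s) ≡ x ℕ.+ (y ℕ.+ s)
    lem = ℕ-Solver.solve-∀

  Pick-length : ∀ {x : A} {V U} → Pick x V U → length U ≡ suc (length V)
  Pick-length here      = refl
  Pick-length (there p) = cong suc (Pick-length p)

  Pick-All : ∀ {P : A → Set} {x V U} → Pick x V U → All P U → P x × All P V
  Pick-All here      (p ∷ ps) = p , ps
  Pick-All (there r) (p ∷ ps) = let (a , b) = Pick-All r ps in a , p ∷ b

  -- Both indices of i + j = n are handed to f, which avoids truncated subtraction.
  ∑⋆ : (ℕ → ℕ → ℚ) → ℕ → ℚ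
  ∑⋆ f zero    = f 0 0
  ∑⋆ f (suc n) = f 0 (suc n) + ∑⋆ (λ i j → f (suc i) j) n

  ∑⋆-cong-+ : ∀ n {f g} → (∀ i j → i ℕ.+ j ≡ n → f i j ≡ g i j) → ∑⋆ f n ≡ ∑⋆ g n
  ∑⋆-cong-+ zero    h = h 0 0 refl
  ∑⋆-cong-+ (suc n) h = cong₂ _+_ (h 0 (suc n) refl) (∑⋆-cong-+ n (λ i j e → h (suc i) j (cong suc e)))

  ∑⋆-cong : ∀ n {f g} → (∀ i j → f i j ≡ g i j) → ∑⋆ f n ≡ ∑⋆ g n
  ∑⋆-cong n h = ∑⋆-cong-+ n (λ i j _ → h i j)

  ∑⋆-+ : ∀ n f g → ∑⋆ (λ i j → f i j + g i j) n ≡ ∑⋆ f n + ∑⋆ g n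
  ∑⋆-+ zero    f g = refl
  ∑⋆-+ (suc n) f g = trans (cong (f 0 (suc n) + g 0 (suc n) +_) (∑⋆-+ n _ _)) (+-interchange (f 0 (suc n)) (g 0 (suc n)) _ _)

  ∑⋆-*ˡ : ∀ n c f → c * ∑⋆ f n ≡ ∑⋆ (λ i j → c * f i j) n
  ∑⋆-*ˡ zero    c f = refl
  ∑⋆-*ˡ (suc n) c f = trans (*-distribˡ-+ c _ _) (cong (c * f 0 (suc n) +_) (∑⋆-*ˡ n c _))

  ∑⋆-0 : ∀ n → ∑⋆ (λ _ _ → 0ℚ) n ≡ 0ℚ
  ∑⋆-0 zero    = refl
  ∑⋆-0 (suc n) = trans (+-identityˡ _) (∑⋆-0 n)

  ∑⋆-last : ∀ n f → ∑⋆ f (suc n) ≡ ∑⋆ (λ i j → f i (suc j)) n + f (suc n) 0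
  ∑⋆-last zero    f = refl
  ∑⋆-last (suc n) f = trans (cong (f 0 (suc (suc n)) +_) (∑⋆-last n (λ i j → f (suc i) j)))
                            (sym (+-assoc (f 0 (suc (suc n))) _ _))

  ∑⋆-comm : ∀ n f → ∑⋆ f n ≡ ∑⋆ (λ i j → f j i) n
  ∑⋆-comm zero    f = refl
  ∑⋆-comm (suc n) f = begin
    f 0 (suc n) + ∑⋆ (λ i j → f (suc i) j) n   ≡⟨ cong (f 0 (suc n) +_) (∑⋆-comm n _) ⟩
    f 0 (suc n) + ∑⋆ (λ i j → f (suc j) i) n   ≡⟨ +-comm (f 0 (suc n)) _ ⟩
    ∑⋆ (λ i j → f (suc j) i) n + f 0 (suc n)   ≡⟨ ∑⋆-last n (λ i j → f j i) ⟨
    ∑⋆ (λ i j → f j i) (suc n) ∎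

  -- The product rule for convolutions: the weights i and j add up to n + 1, and the boundary terms
  -- missing on the left have weight `ι 0`. It drives the inductions in which an identity is first
  -- multiplied by n + 1.
  ∑⋆-Leibniz : ∀ n f → ∑⋆ (λ i j → ι (suc i) * f (suc i) j) n + ∑⋆ (λ i j → ι (suc j) * f i (suc j)) n
                       ≡ ι (suc n) * ∑⋆ f (suc n)
  ∑⋆-Leibniz n f = begin
    ∑⋆ (λ i j → ι (suc i) * f (suc i) j) n + ∑⋆ (λ i j → ι (suc j) * f i (suc j)) n
      ≡⟨ cong₂ _+_ (left n (λ i j → ι i * f i j)) (right n (λ i j → ι j * f i j)) ⟩
    (∑⋆ (λ i j → ι i * f i j) (suc n) - ι 0 * f 0 (suc n)) + (∑⋆ (λ i j → ι j * f i j) (suc n) - ι 0 * f (suc n) 0)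
      ≡⟨ cong (λ q → (∑⋆ (λ i j → ι i * f i j) (suc n) - q * f 0 (suc n)) + (∑⋆ (λ i j → ι j * f i j) (suc n) - q * f (suc n) 0)) ι-0 ⟩
    (∑⋆ (λ i j → ι i * f i j) (suc n) - 0ℚ * f 0 (suc n)) + (∑⋆ (λ i j → ι j * f i j) (suc n) - 0ℚ * f (suc n) 0)
      ≡⟨ lem (∑⋆ (λ i j → ι i * f i j) (suc n)) _ (f 0 (suc n)) (f (suc n) 0) ⟩
    ∑⋆ (λ i j → ι i * f i j) (suc n) + ∑⋆ (λ i j → ι j * f i j) (suc n)
      ≡⟨ ∑⋆-+ (suc n) (λ i j → ι i * f i j) (λ i j → ι j * f i j) ⟨
    ∑⋆ (λ i j → ι i * f i j + ι j * f i j) (suc n)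
      ≡⟨ ∑⋆-cong-+ (suc n) (λ i j e → trans (sym (*-distribʳ-+ (f i j) (ι i) (ι j)))
                                        (cong (_* f i j) (trans (sym (ι-+ i j)) (cong ι e)))) ⟩
    ∑⋆ (λ i j → ι (suc n) * f i j) (suc n)
      ≡⟨ ∑⋆-*ˡ (suc n) (ι (suc n)) f ⟨
    ι (suc n) * ∑⋆ f (suc n) ∎
    where
    sub : ∀ a b → b ≡ (a + b) - a
    sub = solve-∀ ℚ-ring
    sub′ : ∀ a b → b ≡ (b + a) - a
    sub′ = solve-∀ ℚ-ring
    left : ∀ n g → ∑⋆ (λ i j → g (suc i) j) n ≡ ∑⋆ g (suc n) - g 0 (suc n)
    left n g = sub (g 0 (suc n)) _
    right : ∀ n g → ∑⋆ (λ i j → g i (suc j)) n ≡ ∑⋆ g (suc n) - g (suc n) 0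
    right n g = trans (sub′ (g (suc n) 0) _) (cong (_- g (suc n) 0) (sym (∑⋆-last n g)))
    lem : ∀ a b x y → (a - 0ℚ * x) + (b - 0ℚ * y) ≡ a + b
    lem = solve-∀ ℚ-ring

-- Abel-Hurwitz identities for sums over decompositions of a set of parts

module Hurwitz where
  open Rationals
  open Sums
  open ≡-Reasoning

  -- With s = sum S these are (x + s)^{#S}, x (x + s)^{#S-1} and (x + s)^{#S-2}.
  P F E : ℕ → List ℕ → ℚ
  P x S = ι (x ℕ.+ sum S) ^ length S
  F x S = ι x * (P x S * inv (x ℕ.+ sum S))
  E x S = P x S * (inv (x ℕ.+ sum S) * inv (x ℕ.+ sum S))

  ∑∈-ι* : ∀ U c → ∑∈ U (λ x _ → ι x * c) ≡ ι (sum U) * c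
  ∑∈-ι* U c = begin
    ∑∈ U (λ x _ → ι x * c)  ≡⟨ ∑∈-cong U (λ x _ → *-comm (ι x) c) ⟩
    ∑∈ U (λ x _ → c * ι x)  ≡⟨ ∑∈-*ˡ U c (λ x _ → ι x) ⟨
    c * ∑∈ U (λ x _ → ι x)  ≡⟨ cong (c *_) (∑∈-ι U) ⟩
    c * ι (sum U)           ≡⟨ *-comm c _ ⟩
    ι (sum U) * c ∎

  x+s≥1 : ∀ {x} S → 1 ≤ x → 1 ≤ x ℕ.+ sum S
  x+s≥1 {x} S h = ℕₚ.≤-trans h (ℕₚ.m≤m+n x (sum S))

  -- Absorbing the entry i into x keeps the base x + s and lowers the exponent by one.
  P-Pick : ∀ {x i S′ S} → 1 ≤ x ℕ.+ i → Pick i S′ S → P (x ℕ.+ i) S′ ≡ P x S * inv (x ℕ.+ sum S)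
  P-Pick {x} {i} {S′} {S} h p = sym (begin
    ι (x ℕ.+ sum S) ^ length S * inv (x ℕ.+ sum S)
      ≡⟨ cong₂ (λ m k → ι m ^ k * inv m) eq (Pick-length p) ⟩
    ι m ^ suc (length S′) * inv m
      ≡⟨ lem (ι m) (ι m ^ length S′) (inv m) ⟩
    (ι m * inv m) * ι m ^ length S′
      ≡⟨ trans (cong (_* ι m ^ length S′) (ι-inv⁺ (x+s≥1 S′ h))) (*-identityˡ _) ⟩
    ι m ^ length S′ ∎)
    where
    m : ℕ
    m = x ℕ.+ i ℕ.+ sum S′
    eq : x ℕ.+ sum S ≡ m
    eq = trans (cong (x ℕ.+_) (Pick-sum p)) (sym (ℕₚ.+-assoc x i (sum S′)))
    lem : ∀ a b c → a * b * c ≡ (a * c) * b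
    lem = solve-∀ ℚ-ring

  Pick-total : ∀ {x i S′ S} → Pick i S′ S → x ℕ.+ i ℕ.+ sum S′ ≡ x ℕ.+ sum S
  Pick-total {x} {i} {S′} p = trans (ℕₚ.+-assoc x i (sum S′)) (cong (x ℕ.+_) (sym (Pick-sum p)))

  -- One factor x + s of the power is written as x plus the entries of S; by `P-Pick` the share of i
  -- is again a `P`, with i absorbed into x.
  P-expand : ∀ {x} S → 1 ≤ x → P x S ≡ F x S + ∑∈ S (λ i S′ → ι i * P (x ℕ.+ i) S′)
  P-expand {x} S h = sym (begin
    F x S + ∑∈ S (λ i S′ → ι i * P (x ℕ.+ i) S′)
      ≡⟨ cong (F x S +_) (trans (∑∈-cong-Pick S (λ {i} p → cong (ι i *_) (P-Pick (ℕₚ.≤-trans h (ℕₚ.m≤m+n x i)) p)))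
                                (∑∈-ι* S _)) ⟩
    ι x * (P x S * inv m) + ι (sum S) * (P x S * inv m)
      ≡⟨ lem (ι x) (ι (sum S)) (P x S) (inv m) ⟩
    ((ι x + ι (sum S)) * inv m) * P x S
      ≡⟨ cong (λ q → q * inv m * P x S) (ι-+ x (sum S)) ⟨
    ι m * inv m * P x S
      ≡⟨ trans (cong (_* P x S) (ι-inv⁺ (x+s≥1 S h))) (*-identityˡ _) ⟩
    P x S ∎)
    where
    m : ℕ
    m = x ℕ.+ sum S
    lem : ∀ a b p i → a * (p * i) + b * (p * i) ≡ ((a + b) * i) * p
    lem = solve-∀ ℚ-ring

  F-total : ∀ {x} S → 1 ≤ x → F x S * ι (x ℕ.+ sum S) ≡ ι x * P x S
  F-total {x} S h = trans (lem (ι x) (P x S) (inv m) (ι m)) (trans (cong (ι x * P x S *_) (ι-inv⁺ (x+s≥1 S h))) (*-identityʳ _))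
    where
    m : ℕ
    m = x ℕ.+ sum S
    lem : ∀ a p i n → a * (p * i) * n ≡ (a * p) * (n * i)
    lem = solve-∀ ℚ-ring

  private
    total : ∀ {S T U} x y → Split S T U → ι (x ℕ.+ y ℕ.+ sum U) ≡ ι (x ℕ.+ sum S) + ι (y ℕ.+ sum T)
    total {S} {T} {U} x y sp = trans (cong ι (trans (cong (x ℕ.+ y ℕ.+_) (Split-sum sp)) (lem x y (sum S) (sum T)))) (ι-+ _ _)
      where
      lem : ∀ x y s t → x ℕ.+ y ℕ.+ (s ℕ.+ t) ≡ (x ℕ.+ s) ℕ.+ (y ℕ.+ t)
      lem = ℕ-Solver.solve-∀

  ∑FP ∑PP : List ℕ → ℕ → ℕ → ℚ
  ∑FP U x y = ∑⊎ U (λ S T → F x S * P y T)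
  ∑PP U x y = ∑⊎ U (λ S T → P x S * P y T)

  ∑PP-expand : ∀ U {x} y → 1 ≤ x → ∑PP U x y ≡ ∑FP U x y + ∑∈ U (λ i U′ → ι i * ∑PP U′ (x ℕ.+ i) y)
  ∑PP-expand U {x} y h = begin
    ∑⊎ U (λ S T → P x S * P y T)
      ≡⟨ ∑⊎-cong U (λ S T → trans (cong (_* P y T) (P-expand S h)) (*-distribʳ-+ (P y T) (F x S) _)) ⟩
    ∑⊎ U (λ S T → F x S * P y T + ∑∈ S (λ i S′ → ι i * P (x ℕ.+ i) S′) * P y T)
      ≡⟨ ∑⊎-+ U _ _ ⟩
    ∑FP U x y + ∑⊎ U (λ S T → ∑∈ S (λ i S′ → ι i * P (x ℕ.+ i) S′) * P y T)
      ≡⟨ cong (∑FP U x y +_) (∑⊎-cong U (λ S T → trans (*-comm _ (P y T)) (∑∈-*ˡ S (P y T) _))) ⟩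
    ∑FP U x y + ∑⊎ U (λ S T → ∑∈ S (λ i S′ → P y T * (ι i * P (x ℕ.+ i) S′)))
      ≡⟨ cong (∑FP U x y +_) (∑⊎-∑∈ U (λ i S′ T → P y T * (ι i * P (x ℕ.+ i) S′))) ⟩
    ∑FP U x y + ∑∈ U (λ i U′ → ∑⊎ U′ (λ S′ T → P y T * (ι i * P (x ℕ.+ i) S′)))
      ≡⟨ cong (∑FP U x y +_) (∑∈-cong U (λ i U′ → trans (∑⊎-cong U′ (λ S T → lem (P y T) (ι i) (P (x ℕ.+ i) S)))
                                                        (sym (∑⊎-*ˡ U′ (ι i) _)))) ⟩
    ∑FP U x y + ∑∈ U (λ i U′ → ι i * ∑PP U′ (x ℕ.+ i) y) ∎
    where
    lem : ∀ a b c → a * (b * c) ≡ b * (c * a)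
    lem = solve-∀ ℚ-ring

  -- Hurwitz's extension of Abel's binomial theorem, proved simultaneously with
  -- the fact that ∑PP U x y depends only on x + y.
  ∑FP-≡ : ∀ k U → length U ≡ k → ∀ {x} y → 1 ≤ x → ∑FP U x y ≡ P (x ℕ.+ y) U
  ∑PP-≡ : ∀ k U → length U ≡ k → ∀ {x y x′ y′} → 1 ≤ x → 1 ≤ x′ → x ℕ.+ y ≡ x′ ℕ.+ y′ → ∑PP U x y ≡ ∑PP U x′ y′

  ∑FP-≡ zero [] refl {x} y h = begin
    ι x * (1ℚ * inv (x ℕ.+ 0)) * 1ℚ ≡⟨ cong (λ m → ι x * (1ℚ * inv m) * 1ℚ) (ℕₚ.+-identityʳ x) ⟩
    ι x * (1ℚ * inv x) * 1ℚ         ≡⟨ lem (ι x) (inv x) ⟩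
    ι x * inv x                     ≡⟨ ι-inv⁺ h ⟩
    1ℚ ∎
    where
    lem : ∀ a b → a * (1ℚ * b) * 1ℚ ≡ a * b
    lem = solve-∀ ℚ-ring
  ∑FP-≡ (suc k) (i ∷ U) refl {x} y h = begin
    ∑⊎ U (λ S T → F x (i ∷ S) * P y T) + ∑⊎ U (λ S T → F x S * P y (i ∷ T))
      ≡⟨ cong₂ _+_ (trans (∑⊎-cong U first) (sym (∑⊎-*ˡ U (ι x) _))) refl ⟩
    ι x * ∑PP U (x ℕ.+ i) y + ∑⊎ U (λ S T → F x S * P y (i ∷ T))
      -- As `∑PP` depends only on the sum of its two parameters, i moves from x to y. Both sums then
      -- contain `P (y ℕ.+ i) T` and can be merged term by term.
      ≡⟨ cong (λ q → ι x * q + ∑⊎ U (λ S T → F x S * P y (i ∷ T))) (∑PP-≡ k U refl (ℕₚ.≤-trans h (ℕₚ.m≤m+n x i)) h (lem₀ x i y)) ⟩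
    ι x * ∑PP U x (y ℕ.+ i) + ∑⊎ U (λ S T → F x S * P y (i ∷ T))
      ≡⟨ cong (_+ ∑⊎ U (λ S T → F x S * P y (i ∷ T))) (∑⊎-*ˡ U (ι x) (λ S T → P x S * P (y ℕ.+ i) T)) ⟩
    ∑⊎ U (λ S T → ι x * (P x S * P (y ℕ.+ i) T)) + ∑⊎ U (λ S T → F x S * P y (i ∷ T))
      ≡⟨ ∑⊎-+ U _ _ ⟨
    ∑⊎ U (λ S T → ι x * (P x S * P (y ℕ.+ i) T) + F x S * P y (i ∷ T))
      ≡⟨ ∑⊎-cong-Split U second ⟩
    ∑⊎ U (λ S T → ι (x ℕ.+ (y ℕ.+ i) ℕ.+ sum U) * (F x S * P (y ℕ.+ i) T))
      ≡⟨ ∑⊎-*ˡ U (ι (x ℕ.+ (y ℕ.+ i) ℕ.+ sum U)) _ ⟨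
    ι (x ℕ.+ (y ℕ.+ i) ℕ.+ sum U) * ∑FP U x (y ℕ.+ i)
      ≡⟨ cong (ι (x ℕ.+ (y ℕ.+ i) ℕ.+ sum U) *_) (∑FP-≡ k U refl (y ℕ.+ i) h) ⟩
    ι (x ℕ.+ (y ℕ.+ i) ℕ.+ sum U) ^ suc (length U)
      ≡⟨ cong (λ m → ι m ^ suc (length U)) (lem₁ x y i (sum U)) ⟩
    P (x ℕ.+ y) (i ∷ U) ∎
    where
    lem₀ : ∀ x i y → x ℕ.+ i ℕ.+ y ≡ x ℕ.+ (y ℕ.+ i)
    lem₀ = ℕ-Solver.solve-∀
    lem₁ : ∀ x y i s → x ℕ.+ (y ℕ.+ i) ℕ.+ s ≡ x ℕ.+ y ℕ.+ (i ℕ.+ s)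
    lem₁ = ℕ-Solver.solve-∀
    first : ∀ S T → F x (i ∷ S) * P y T ≡ ι x * (P (x ℕ.+ i) S * P y T)
    first S T = trans (cong (λ q → ι x * q * P y T) (sym (P-Pick {x} {i} {S} (ℕₚ.≤-trans h (ℕₚ.m≤m+n x i)) here))) (*-assoc (ι x) _ _)
    ring : ∀ a p q f t → a * (p * q) + f * (t * q) ≡ (a * p + f * t) * q
    ring = solve-∀ ℚ-ring
    ring′ : ∀ m t f q → (f * m + f * t) * q ≡ (m + t) * (f * q)
    ring′ = solve-∀ ℚ-ring
    second : ∀ {S T} → Split S T U → ι x * (P x S * P (y ℕ.+ i) T) + F x S * P y (i ∷ T)
                                     ≡ ι (x ℕ.+ (y ℕ.+ i) ℕ.+ sum U) * (F x S * P (y ℕ.+ i) T)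
    second {S} {T} sp = begin
      ι x * (P x S * P (y ℕ.+ i) T) + F x S * (ι (y ℕ.+ (i ℕ.+ sum T)) * ι (y ℕ.+ (i ℕ.+ sum T)) ^ length T)
        ≡⟨ cong (λ m → ι x * (P x S * P (y ℕ.+ i) T) + F x S * (ι m * ι m ^ length T)) (sym (ℕₚ.+-assoc y i (sum T))) ⟩
      ι x * (P x S * P (y ℕ.+ i) T) + F x S * (t * P (y ℕ.+ i) T)
        ≡⟨ ring (ι x) (P x S) (P (y ℕ.+ i) T) (F x S) t ⟩
      (ι x * P x S + F x S * t) * P (y ℕ.+ i) T
        ≡⟨ cong (λ q → (q + F x S * t) * P (y ℕ.+ i) T) (F-total S h) ⟨
      (F x S * ι (x ℕ.+ sum S) + F x S * t) * P (y ℕ.+ i) T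
        ≡⟨ ring′ (ι (x ℕ.+ sum S)) t (F x S) (P (y ℕ.+ i) T) ⟩
      (ι (x ℕ.+ sum S) + t) * (F x S * P (y ℕ.+ i) T)
        ≡⟨ cong (_* (F x S * P (y ℕ.+ i) T)) (total x (y ℕ.+ i) sp) ⟨
      ι (x ℕ.+ (y ℕ.+ i) ℕ.+ sum U) * (F x S * P (y ℕ.+ i) T) ∎
      where
      t : ℚ
      t = ι (y ℕ.+ i ℕ.+ sum T)

  ∑PP-≡ k U e {x} {y} {x′} {y′} h h′ eq = begin
    ∑PP U x y
      ≡⟨ ∑PP-expand U y h ⟩
    ∑FP U x y + ∑∈ U (λ i U′ → ι i * ∑PP U′ (x ℕ.+ i) y)
      ≡⟨ cong₂ _+_ (trans (∑FP-≡ k U e y h) (trans (cong (λ m → P m U) eq) (sym (∑FP-≡ k U e y′ h′))))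
                   (∑∈-cong-Pick U (λ {i} {U′} p → cong (ι i *_) (smaller k e p))) ⟩
    ∑FP U x′ y′ + ∑∈ U (λ i U′ → ι i * ∑PP U′ (x′ ℕ.+ i) y′)
      ≡⟨ ∑PP-expand U y′ h′ ⟨
    ∑PP U x′ y′ ∎
    where
    lem : ∀ x i y → x ℕ.+ i ℕ.+ y ≡ x ℕ.+ y ℕ.+ i
    lem = ℕ-Solver.solve-∀
    smaller : ∀ k → length U ≡ k → ∀ {i U′} → Pick i U′ U → ∑PP U′ (x ℕ.+ i) y ≡ ∑PP U′ (x′ ℕ.+ i) y′
    smaller zero    e {i} {U′} p with trans (sym (Pick-length p)) e
    ... | ()
    smaller (suc k) e {i} {U′} p = ∑PP-≡ k U′ (ℕₚ.suc-injective (trans (sym (Pick-length p)) e))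
      (ℕₚ.≤-trans h (ℕₚ.m≤m+n x i)) (ℕₚ.≤-trans h′ (ℕₚ.m≤m+n x′ i))
      (trans (lem x i y) (trans (cong (ℕ._+ i) eq) (sym (lem x′ i y′))))

  abel-FP : ∀ U {x} y → 1 ≤ x → ∑⊎ U (λ S T → F x S * P y T) ≡ P (x ℕ.+ y) U
  abel-FP U y h = ∑FP-≡ (length U) U refl y h

  abel-PF : ∀ U x {y} → 1 ≤ y → ∑⊎ U (λ S T → P x S * F y T) ≡ P (x ℕ.+ y) U
  abel-PF U x {y} h = begin
    ∑⊎ U (λ S T → P x S * F y T) ≡⟨ ∑⊎-comm U _ ⟩
    ∑⊎ U (λ S T → P x T * F y S) ≡⟨ ∑⊎-cong U (λ S T → *-comm (P x T) (F y S)) ⟩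
    ∑⊎ U (λ S T → F y S * P x T) ≡⟨ abel-FP U x h ⟩
    P (y ℕ.+ x) U                ≡⟨ cong (λ m → P m U) (ℕₚ.+-comm y x) ⟩
    P (x ℕ.+ y) U ∎

  -- The total x + y + sum U is (x + s) + (y + t) in every term. Multiplying by it turns one of the
  -- two factors `F` into a `P`, which the two mixed identities evaluate.
  abel-FF : ∀ U {x y} → 1 ≤ x → 1 ≤ y → ∑⊎ U (λ S T → F x S * F y T) ≡ F (x ℕ.+ y) U
  abel-FF U {x} {y} hx hy = ι-cancelˡ N≥1 (begin
    ι N * ∑⊎ U (λ S T → F x S * F y T)
      ≡⟨ ∑⊎-*ˡ U (ι N) _ ⟩
    ∑⊎ U (λ S T → ι N * (F x S * F y T))
      ≡⟨ ∑⊎-cong-Split U (λ {S} {T} sp → trans (cong (_* (F x S * F y T)) (total x y sp))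
           (trans (ring (ι (x ℕ.+ sum S)) (ι (y ℕ.+ sum T)) (F x S) (F y T))
             (trans (cong₂ (λ a b → a * F y T + F x S * b) (F-total S hx) (F-total T hy))
               (ring′ (ι x) (ι y) (P x S) (F y T) (F x S) (P y T))))) ⟩
    ∑⊎ U (λ S T → ι x * (P x S * F y T) + ι y * (F x S * P y T))
      ≡⟨ trans (∑⊎-+ U _ _) (cong₂ _+_ (sym (∑⊎-*ˡ U (ι x) _)) (sym (∑⊎-*ˡ U (ι y) _))) ⟩
    ι x * ∑⊎ U (λ S T → P x S * F y T) + ι y * ∑⊎ U (λ S T → F x S * P y T)
      ≡⟨ cong₂ (λ a b → ι x * a + ι y * b) (abel-PF U x hy) (abel-FP U y hx) ⟩
    ι x * P (x ℕ.+ y) U + ι y * P (x ℕ.+ y) U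
      ≡⟨ *-distribʳ-+ (P (x ℕ.+ y) U) (ι x) (ι y) ⟨
    (ι x + ι y) * P (x ℕ.+ y) U
      ≡⟨ cong (_* P (x ℕ.+ y) U) (ι-+ x y) ⟨
    ι (x ℕ.+ y) * P (x ℕ.+ y) U
      ≡⟨ F-total U xy≥1 ⟨
    F (x ℕ.+ y) U * ι N
      ≡⟨ *-comm _ (ι N) ⟩
    ι N * F (x ℕ.+ y) U ∎)
    where
    N : ℕ
    N = x ℕ.+ y ℕ.+ sum U
    xy≥1 : 1 ≤ x ℕ.+ y
    xy≥1 = ℕₚ.≤-trans hx (ℕₚ.m≤m+n x y)
    N≥1 : 1 ≤ N
    N≥1 = x+s≥1 U xy≥1
    ring : ∀ a b f g → (a + b) * (f * g) ≡ (f * a) * g + f * (g * b)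
    ring = solve-∀ ℚ-ring
    ring′ : ∀ a b p g f q → (a * p) * g + f * (b * q) ≡ a * (p * g) + b * (f * q)
    ring′ = solve-∀ ℚ-ring

  E-total : ∀ {x} S → 1 ≤ x → ι (x ℕ.+ sum S) * (ι x * E x S) ≡ F x S
  E-total {x} S h = trans (lem (ι m) (ι x) (P x S) (inv m)) (trans (cong (λ q → ι x * (P x S * (inv m * q))) (ι-inv⁺ (x+s≥1 S h)))
                      (cong (λ q → ι x * (P x S * q)) (*-identityʳ (inv m))))
    where
    m : ℕ
    m = x ℕ.+ sum S
    lem : ∀ n a p i → n * (a * (p * (i * i))) ≡ a * (p * (i * (n * i)))
    lem = solve-∀ ℚ-ring

  -- The exponent #S - 2 is raised to one that `abel-FF` can handle: x = (x + s) - s, and s is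
  -- spread over the entries i. Each share is an `F` at x + i, at the price of a denominator x + i;
  -- these are the denominators that survive in the cut terms.
  E-expand : ∀ {x} S → 1 ≤ x →
             ι x * (ι x * E x S) ≡ F x S - ∑∈ S (λ i S′ → ι i * (ι x * (inv (x ℕ.+ i) * F (x ℕ.+ i) S′)))
  E-expand {x} S h = begin
    ι x * (ι x * E x S)
      ≡⟨ ring (ι x) (ι (sum S)) (ι x * E x S) ⟩
    (ι x + ι (sum S)) * (ι x * E x S) - ι (sum S) * (ι x * E x S)
      ≡⟨ cong₂ _-_ (trans (cong (_* (ι x * E x S)) (sym (ι-+ x (sum S)))) (E-total S h))
                   (sym (trans (∑∈-cong-Pick S (λ {i} p → cong (λ q → ι i * (ι x * q)) (term p))) (∑∈-ι* S _))) ⟩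
    F x S - ∑∈ S (λ i S′ → ι i * (ι x * (inv (x ℕ.+ i) * F (x ℕ.+ i) S′))) ∎
    where
    ring : ∀ a s e → a * e ≡ (a + s) * e - s * e
    ring = solve-∀ ℚ-ring
    ring′ : ∀ j n p i → j * (n * (p * i)) ≡ (n * j) * (p * i)
    ring′ = solve-∀ ℚ-ring
    term : ∀ {i S′} → Pick i S′ S → inv (x ℕ.+ i) * F (x ℕ.+ i) S′ ≡ E x S
    term {i} {S′} p = begin
      inv (x ℕ.+ i) * (ι (x ℕ.+ i) * (P (x ℕ.+ i) S′ * inv (x ℕ.+ i ℕ.+ sum S′)))
        ≡⟨ ring′ (inv (x ℕ.+ i)) (ι (x ℕ.+ i)) (P (x ℕ.+ i) S′) _ ⟩
      ι (x ℕ.+ i) * inv (x ℕ.+ i) * (P (x ℕ.+ i) S′ * inv (x ℕ.+ i ℕ.+ sum S′))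
        ≡⟨ trans (cong (_* (P (x ℕ.+ i) S′ * inv (x ℕ.+ i ℕ.+ sum S′))) (ι-inv⁺ (ℕₚ.≤-trans h (ℕₚ.m≤m+n x i)))) (*-identityˡ _) ⟩
      P (x ℕ.+ i) S′ * inv (x ℕ.+ i ℕ.+ sum S′)
        ≡⟨ cong₂ (λ a b → a * inv b) (P-Pick (ℕₚ.≤-trans h (ℕₚ.m≤m+n x i)) p) (Pick-total {x} p) ⟩
      P x S * inv (x ℕ.+ sum S) * inv (x ℕ.+ sum S)
        ≡⟨ *-assoc (P x S) _ _ ⟩
      E x S ∎

  F-Pick : ∀ {x i S′ S} → 1 ≤ x → Pick i S′ S → F (x ℕ.+ i) S′ ≡ ι (x ℕ.+ i) * E x S
  F-Pick {x} {i} {S′} {S} h p = cong (ι (x ℕ.+ i) *_)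
    (trans (cong₂ (λ a b → a * inv b) (P-Pick (ℕₚ.≤-trans h (ℕₚ.m≤m+n x i)) p) (Pick-total {x} p)) (*-assoc (P x S) _ _))

  F-E : ∀ {x} S → 1 ≤ x → F x S ≡ ι x * (E x S * ι (x ℕ.+ sum S))
  F-E {x} S h = trans (sym (E-total S h)) (lem (ι (x ℕ.+ sum S)) (ι x) (E x S))
    where
    lem : ∀ n a e → n * (a * e) ≡ a * (e * n)
    lem = solve-∀ ℚ-ring

  -- `E-expand` reduces the sum to `abel-FF` for U and, for each j, for U without j. By `F-Pick` all
  -- results are multiples of the same `E (x ℕ.+ y) U`.
  abel-FE : ∀ U {x y} → 1 ≤ x → 1 ≤ y →
    ∑⊎ U (λ S T → F x S * (ι y * E y T))
      ≡ E (x ℕ.+ y) U * (inv y * (ι (x ℕ.+ y) * ι (x ℕ.+ y ℕ.+ sum U)) - ∑∈ U (λ j _ → ι j * (ι (x ℕ.+ y ℕ.+ j) * inv (y ℕ.+ j))))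
  abel-FE U {x} {y} hx hy = ι-cancelˡ hy (begin
    ι y * ∑⊎ U (λ S T → F x S * (ι y * E y T))
      ≡⟨ ∑⊎-*ˡ U (ι y) _ ⟩
    ∑⊎ U (λ S T → ι y * (F x S * (ι y * E y T)))
      ≡⟨ ∑⊎-cong U (λ S T → trans (ring₁ (ι y) (F x S) (ι y * E y T)) (trans (cong (F x S *_) (E-expand T hy))
           (trans (ring₂ (F x S) (F y T) _) (cong (λ q → F x S * F y T + q)
             (trans (neg-∑ (F x S) T _) (∑∈-cong T (λ j T′ → ring₃ (F x S) (ι j) (ι y) (inv (y ℕ.+ j)) (F (y ℕ.+ j) T′)))))))) ⟩
    ∑⊎ U (λ S T → F x S * F y T + ∑∈ T (λ j T′ → - (ι j * (ι y * inv (y ℕ.+ j))) * (F x S * F (y ℕ.+ j) T′)))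
      ≡⟨ ∑⊎-+ U _ _ ⟩
    ∑⊎ U (λ S T → F x S * F y T) + ∑⊎ U (λ S T → ∑∈ T (λ j T′ → - (ι j * (ι y * inv (y ℕ.+ j))) * (F x S * F (y ℕ.+ j) T′)))
      ≡⟨ cong₂ _+_ (trans (abel-FF U hx hy) (F-E U xy≥1))
          (trans (∑⊎-comm U _) (∑⊎-∑∈ U (λ j T′ S → - (ι j * (ι y * inv (y ℕ.+ j))) * (F x S * F (y ℕ.+ j) T′)))) ⟩
    ι (x ℕ.+ y) * (K * ι N) + ∑∈ U (λ j U′ → ∑⊎ U′ (λ T S → - (ι j * (ι y * inv (y ℕ.+ j))) * (F x S * F (y ℕ.+ j) T)))
      ≡⟨ cong (ι (x ℕ.+ y) * (K * ι N) +_) (∑∈-cong-Pick U (λ {j} {U′} p →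
           trans (sym (∑⊎-*ˡ U′ (- (ι j * (ι y * inv (y ℕ.+ j)))) _))
            (trans (cong (- (ι j * (ι y * inv (y ℕ.+ j))) *_)
               (trans (∑⊎-comm U′ _) (trans (abel-FF U′ hx (ℕₚ.≤-trans hy (ℕₚ.m≤m+n y j)))
                  (trans (cong (λ m → F m U′) (sym (ℕₚ.+-assoc x y j))) (F-Pick xy≥1 p)))))
              (ring₄ (ι j) (ι y) (inv (y ℕ.+ j)) (ι (x ℕ.+ y ℕ.+ j)) K)))) ⟩
    ι (x ℕ.+ y) * (K * ι N) + ∑∈ U (λ j U′ → - (ι y * K) * (ι j * (ι (x ℕ.+ y ℕ.+ j) * inv (y ℕ.+ j))))
      ≡⟨ cong₂ _+_ (trans (sym (*-identityˡ (ι (x ℕ.+ y) * (K * ι N)))) (cong (_* (ι (x ℕ.+ y) * (K * ι N))) (sym (ι-inv⁺ hy)))) (sym (∑∈-*ˡ U (- (ι y * K)) _)) ⟩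
    ι y * inv y * (ι (x ℕ.+ y) * (K * ι N)) + - (ι y * K) * ∑∈ U (λ j U′ → ι j * (ι (x ℕ.+ y ℕ.+ j) * inv (y ℕ.+ j)))
      ≡⟨ ring₅ (ι y) (inv y) (ι (x ℕ.+ y)) K (ι N) _ ⟩
    ι y * (K * (inv y * (ι (x ℕ.+ y) * ι N) - ∑∈ U (λ j _ → ι j * (ι (x ℕ.+ y ℕ.+ j) * inv (y ℕ.+ j))))) ∎)
    where
    N : ℕ
    N = x ℕ.+ y ℕ.+ sum U
    K : ℚ
    K = E (x ℕ.+ y) U
    xy≥1 : 1 ≤ x ℕ.+ y
    xy≥1 = ℕₚ.≤-trans hx (ℕₚ.m≤m+n x y)
    ring₁ : ∀ y f e → y * (f * e) ≡ f * (y * e)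
    ring₁ = solve-∀ ℚ-ring
    ring₂ : ∀ f g s → f * (g - s) ≡ f * g + (- f) * s
    ring₂ = solve-∀ ℚ-ring
    neg-∑ : ∀ f T g → (- f) * ∑∈ T g ≡ ∑∈ T (λ j T′ → (- f) * g j T′)
    neg-∑ f T g = ∑∈-*ˡ T (- f) g
    ring₃ : ∀ f j y i g → (- f) * (j * (y * (i * g))) ≡ - (j * (y * i)) * (f * g)
    ring₃ = solve-∀ ℚ-ring
    ring₄ : ∀ j y i m k → - (j * (y * i)) * (m * k) ≡ - (y * k) * (j * (m * i))
    ring₄ = solve-∀ ℚ-ring
    ring₅ : ∀ y i m k n s → y * i * (m * (k * n)) + - (y * k) * s ≡ y * (k * (i * (m * n) - s))
    ring₅ = solve-∀ ℚ-ring

  -- As in `abel-FF`, the total splits as (x + s) + (y + t), and by `E-total` each summand promotes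
  -- one `E` to an `F`.
  abel-EE : ∀ U {x y} → 1 ≤ x → 1 ≤ y →
    ι (x ℕ.+ y ℕ.+ sum U) * (ι x * ι y * ∑⊎ U (λ S T → E x S * E y T))
      ≡ E (x ℕ.+ y) U * ((inv x + inv y) * (ι (x ℕ.+ y) * ι (x ℕ.+ y ℕ.+ sum U))
                         - ∑∈ U (λ j _ → ι j * (ι (x ℕ.+ y ℕ.+ j) * (inv (x ℕ.+ j) + inv (y ℕ.+ j)))))
  abel-EE U {x} {y} hx hy = begin
    ι N * (ι x * ι y * ∑⊎ U (λ S T → E x S * E y T))
      ≡⟨ cong (ι N *_) (∑⊎-*ˡ U (ι x * ι y) _) ⟩
    ι N * ∑⊎ U (λ S T → ι x * ι y * (E x S * E y T))
      ≡⟨ ∑⊎-*ˡ U (ι N) _ ⟩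
    ∑⊎ U (λ S T → ι N * (ι x * ι y * (E x S * E y T)))
      ≡⟨ ∑⊎-cong-Split U (λ {S} {T} sp → trans (cong (_* (ι x * ι y * (E x S * E y T))) (total x y sp))
           (trans (ring₁ (ι (x ℕ.+ sum S)) (ι (y ℕ.+ sum T)) (ι x) (ι y) (E x S) (E y T))
            (cong₂ (λ a b → a * (ι y * E y T) + b * (ι x * E x S)) (E-total S hx) (E-total T hy)))) ⟩
    ∑⊎ U (λ S T → F x S * (ι y * E y T) + F y T * (ι x * E x S))
      ≡⟨ ∑⊎-+ U _ _ ⟩
    ∑⊎ U (λ S T → F x S * (ι y * E y T)) + ∑⊎ U (λ S T → F y T * (ι x * E x S))
      ≡⟨ cong₂ _+_ (abel-FE U hx hy) (trans (∑⊎-comm U _) (trans (abel-FE U hy hx)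
          (cong (λ m → E m U * (inv x * (ι m * ι (m ℕ.+ sum U)) - ∑∈ U (λ j _ → ι j * (ι (m ℕ.+ j) * inv (x ℕ.+ j)))))
            (ℕₚ.+-comm y x)))) ⟩
    K * (inv y * (ι (x ℕ.+ y) * ι N) - ∑y) + K * (inv x * (ι (x ℕ.+ y) * ι N) - ∑x)
      ≡⟨ ring₂ K (inv x) (inv y) (ι (x ℕ.+ y) * ι N) ∑x ∑y ⟩
    K * ((inv x + inv y) * (ι (x ℕ.+ y) * ι N) - (∑x + ∑y))
      ≡⟨ cong (λ q → K * ((inv x + inv y) * (ι (x ℕ.+ y) * ι N) - q))
          (trans (sym (∑∈-+ U _ _)) (∑∈-cong U (λ j _ → ring₃ (ι j) (ι (x ℕ.+ y ℕ.+ j)) (inv (x ℕ.+ j)) (inv (y ℕ.+ j))))) ⟩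
    K * ((inv x + inv y) * (ι (x ℕ.+ y) * ι N) - ∑∈ U (λ j _ → ι j * (ι (x ℕ.+ y ℕ.+ j) * (inv (x ℕ.+ j) + inv (y ℕ.+ j))))) ∎
    where
    N : ℕ
    N = x ℕ.+ y ℕ.+ sum U
    K ∑x ∑y : ℚ
    K = E (x ℕ.+ y) U
    ∑x = ∑∈ U (λ j _ → ι j * (ι (x ℕ.+ y ℕ.+ j) * inv (x ℕ.+ j)))
    ∑y = ∑∈ U (λ j _ → ι j * (ι (x ℕ.+ y ℕ.+ j) * inv (y ℕ.+ j)))
    ring₁ : ∀ a b x y e f → (a + b) * (x * y * (e * f)) ≡ (a * (x * e)) * (y * f) + (b * (y * f)) * (x * e)
    ring₁ = solve-∀ ℚ-ring
    ring₂ : ∀ k i j m s t → k * (j * m - t) + k * (i * m - s) ≡ k * ((i + j) * m - (s + t))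
    ring₂ = solve-∀ ℚ-ring
    ring₃ : ∀ j m a b → j * (m * a) + j * (m * b) ≡ j * (m * (a + b))
    ring₃ = solve-∀ ℚ-ring

  -- M S = s^{#S-1}, with the convenient junk value M [] = 0.
  M : List ℕ → ℚ
  M S = P 0 S * inv (sum S)

  -- The correction for the empty set, where `M []` is 0 although `P 0 []` is 1.
  isNil : List ℕ → ℚ
  isNil []      = 1ℚ
  isNil (_ ∷ _) = 0ℚ

  ∑⊎-isNil : ∀ U f → ∑⊎ U (λ S T → f S * isNil T) ≡ f U
  ∑⊎-isNil []      f = *-identityʳ (f [])
  ∑⊎-isNil (x ∷ U) f = begin
    ∑⊎ U (λ S T → f (x ∷ S) * isNil T) + ∑⊎ U (λ S T → f S * 0ℚ)
      ≡⟨ cong₂ _+_ (∑⊎-isNil U (λ S → f (x ∷ S))) (trans (∑⊎-cong U (λ S T → trans (*-zeroʳ (f S)) (sym (*-zeroˡ (f S))))) (sym (∑⊎-*ˡ U 0ℚ (λ S T → f S)))) ⟩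
    f (x ∷ U) + 0ℚ * ∑⊎ U (λ S T → f S)
      ≡⟨ trans (cong (f (x ∷ U) +_) (*-zeroˡ (∑⊎ U (λ S T → f S)))) (+-identityʳ _) ⟩
    f (x ∷ U) ∎

  Positive⁺ : List ℕ → Set
  Positive⁺ = All (1 ≤_)

  M-total : ∀ {T} → Positive⁺ T → ι (sum T) * M T ≡ P 0 T - isNil T
  M-total [] = trans (cong (_* M []) ι-0) (*-zeroˡ (M []))
  M-total {x ∷ T} (h ∷ _) = begin
    ι m * (P 0 (x ∷ T) * inv m)   ≡⟨ lem (ι m) (P 0 (x ∷ T)) (inv m) ⟩
    ι m * inv m * P 0 (x ∷ T)     ≡⟨ trans (cong (_* P 0 (x ∷ T)) (ι-inv⁺ (x+s≥1 T h))) (*-identityˡ _) ⟩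
    P 0 (x ∷ T)                   ≡⟨ +-identityʳ _ ⟨
    P 0 (x ∷ T) - 0ℚ ∎
    where
    m : ℕ
    m = x ℕ.+ sum T
    lem : ∀ a b c → a * (b * c) ≡ a * c * b
    lem = solve-∀ ℚ-ring

  M-Pick : ∀ {i U′ U} → Positive⁺ U → Pick i U′ U → P i U′ ≡ M U
  M-Pick h p = P-Pick {0} (proj₁ (Pick-All p h)) p

  -- One factor s is spread over the entries of S. Each entry i then plays the role of the positive
  -- parameter required by `abel-FP`; on the empty list both sides are 0.
  M-expand : ∀ {S} → Positive⁺ S → M S ≡ ∑∈ S F
  M-expand [] = trans (cong (1ℚ *_) inv-0) (*-zeroʳ 1ℚ)
  M-expand {S@(x ∷ S₁)} (h ∷ hs) = sym (begin
    ∑∈ S F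
      ≡⟨ ∑∈-cong-Pick S (λ {i} p → cong₂ (λ a b → ι i * (a * inv b)) (M-Pick (h ∷ hs) p) (Pick-total {0} p)) ⟩
    ∑∈ S (λ i _ → ι i * (M S * inv (sum S)))
      ≡⟨ ∑∈-ι* S _ ⟩
    ι (sum S) * (M S * inv (sum S))
      ≡⟨ lem (ι (sum S)) (M S) (inv (sum S)) ⟩
    ι (sum S) * inv (sum S) * M S
      ≡⟨ trans (cong (_* M S) (ι-inv⁺ (x+s≥1 S₁ h))) (*-identityˡ _) ⟩
    M S ∎)
    where
    lem : ∀ a b c → a * (b * c) ≡ a * c * b
    lem = solve-∀ ℚ-ring

  -- The factor sum U = s + t divides the sum into two equal halves Y. In Y, t turns `M T` into t^#T
  -- except for T = ∅. Rooting S at an entry and summing out the others with `abel-FP` gives `M U`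
  -- for each of the l roots, and the exception T = ∅ takes one `M U` away. Since `M []` is 0, only
  -- nonempty S and T count on the left.
  abel-MM : ∀ {U} → Positive⁺ U → ι (sum U) * ∑⊎ U (λ S T → M S * M T) ≡ 2ℚ * ((ι (length U) - 1ℚ) * M U)
  abel-MM {U} h = begin
    ι (sum U) * ∑⊎ U (λ S T → M S * M T)
      ≡⟨ ∑⊎-*ˡ U (ι (sum U)) _ ⟩
    ∑⊎ U (λ S T → ι (sum U) * (M S * M T))
      ≡⟨ ∑⊎-cong-Split U (λ {S} {T} sp → trans (cong (_* (M S * M T)) (trans (cong ι (Split-sum sp)) (ι-+ (sum S) (sum T))))
           (ring₁ (ι (sum S)) (ι (sum T)) (M S) (M T))) ⟩
    ∑⊎ U (λ S T → M T * (ι (sum S) * M S) + M S * (ι (sum T) * M T))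
      ≡⟨ trans (∑⊎-+ U _ _) (cong (_+ Y) (∑⊎-comm U _)) ⟩
    Y + Y
      ≡⟨ cong (λ q → q + q) Y≡ ⟩
    (ι (length U) * M U - M U) + (ι (length U) * M U - M U)
      ≡⟨ ring₄ (ι (length U)) (M U) ⟩
    2ℚ * ((ι (length U) - 1ℚ) * M U) ∎
    where
    ring₁ : ∀ s t m k → (s + t) * (m * k) ≡ k * (s * m) + m * (t * k)
    ring₁ = solve-∀ ℚ-ring
    ring₂ : ∀ a b c → a * (b - c) ≡ a * b + - 1ℚ * (a * c)
    ring₂ = solve-∀ ℚ-ring
    ring₃ : ∀ a b → a + - 1ℚ * b ≡ a - b
    ring₃ = solve-∀ ℚ-ring
    ring₄ : ∀ l m → (l * m - m) + (l * m - m) ≡ 2ℚ * ((l - 1ℚ) * m)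
    ring₄ = solve-∀ ℚ-ring
    Y : ℚ
    Y = ∑⊎ U (λ S T → M S * (ι (sum T) * M T))
    Y≡ : Y ≡ ι (length U) * M U - M U
    Y≡ = begin
      Y
        ≡⟨ ∑⊎-cong-Split U (λ {S} {T} sp → trans (cong (M S *_) (M-total (proj₂ (Split-All sp h)))) (ring₂ (M S) (P 0 T) (isNil T))) ⟩
      ∑⊎ U (λ S T → M S * P 0 T + - 1ℚ * (M S * isNil T))
        ≡⟨ trans (∑⊎-+ U _ _) (cong₂ _+_ MP (trans (sym (∑⊎-*ˡ U (- 1ℚ) _)) (cong (- 1ℚ *_) (∑⊎-isNil U M)))) ⟩
      ι (length U) * M U + - 1ℚ * M U
        ≡⟨ ring₃ (ι (length U) * M U) (M U) ⟩
      ι (length U) * M U - M U ∎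
      where
      MP : ∑⊎ U (λ S T → M S * P 0 T) ≡ ι (length U) * M U
      MP = begin
        ∑⊎ U (λ S T → M S * P 0 T)
          ≡⟨ ∑⊎-cong-Split U (λ {S} {T} sp → trans (cong (_* P 0 T) (M-expand (proj₁ (Split-All sp h))))
               (trans (*-comm _ (P 0 T)) (trans (∑∈-*ˡ S (P 0 T) F) (∑∈-cong S (λ i S′ → *-comm (P 0 T) (F i S′)))))) ⟩
        ∑⊎ U (λ S T → ∑∈ S (λ i S′ → F i S′ * P 0 T))
          ≡⟨ ∑⊎-∑∈ U (λ i S′ T → F i S′ * P 0 T) ⟩
        ∑∈ U (λ i U′ → ∑⊎ U′ (λ S T → F i S * P 0 T))
          ≡⟨ ∑∈-cong-Pick U (λ {i} {U′} p → trans (abel-FP U′ 0 (proj₁ (Pick-All p h)))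
               (trans (cong (λ m → P m U′) (ℕₚ.+-identityʳ i)) (M-Pick h p))) ⟩
        ∑∈ U (λ _ _ → M U)
          ≡⟨ ∑∈-const U (M U) ⟩
        ι (length U) * M U ∎

-- Divided powers and convolution identities for m^m / m!

module Convolution where
  open Rationals
  open Sums
  open Hurwitz
  open ≡-Reasoning

  inv! : ℕ → ℚ
  inv! m = inv (m !)

  !≥1 : ∀ m → 1 ≤ m !
  !≥1 zero    = ℕₚ.≤-refl
  !≥1 (suc m) = ℕₚ.*-mono-≤ {1} {suc m} (s≤s z≤n) (!≥1 m)

  ι!-inv! : ∀ m → ι (m !) * inv! m ≡ 1ℚ
  ι!-inv! m = ι-inv⁺ (!≥1 m)

  inv!-suc : ∀ m → ι (suc m) * inv! (suc m) ≡ inv! m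
  inv!-suc m = begin
    ι (suc m) * inv (suc m ℕ.* m !)       ≡⟨ cong (ι (suc m) *_) (inv-* {suc m} (s≤s z≤n) (!≥1 m)) ⟩
    ι (suc m) * (inv (suc m) * inv! m)    ≡⟨ *-assoc (ι (suc m)) _ _ ⟨
    ι (suc m) * inv (suc m) * inv! m      ≡⟨ trans (cong (_* inv! m) (ι-inv m)) (*-identityˡ _) ⟩
    inv! m ∎

  dp : ℚ → ℕ → ℚ
  dp x i = x ^ i * inv! i

  dp-suc : ∀ x i → ι (suc i) * dp x (suc i) ≡ x * dp x i
  dp-suc x i = trans (lem (ι (suc i)) x (x ^ i) (inv! (suc i))) (cong (λ q → x * (x ^ i * q)) (inv!-suc i))
    where
    lem : ∀ n x p i → n * (x * p * i) ≡ x * (p * (n * i))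
    lem = solve-∀ ℚ-ring

  dp-0 : ∀ x → dp x 0 ≡ 1ℚ
  dp-0 x = trans (*-identityˡ _) inv-1

  -- The binomial theorem: after multiplication by n + 1, `∑⋆-Leibniz` and `dp-suc` extract the
  -- factor x + y.
  ∑⋆-dp : ∀ x y n → ∑⋆ (λ i j → dp x i * dp y j) n ≡ dp (x + y) n
  ∑⋆-dp x y zero    = trans (cong₂ _*_ (dp-0 x) (dp-0 y)) (sym (dp-0 (x + y)))
  ∑⋆-dp x y (suc n) = ι-cancelˡ {suc n} (s≤s z≤n) (begin
    ι (suc n) * ∑⋆ (λ i j → dp x i * dp y j) (suc n)
      ≡⟨ ∑⋆-Leibniz n (λ i j → dp x i * dp y j) ⟨
    ∑⋆ (λ i j → ι (suc i) * (dp x (suc i) * dp y j)) n + ∑⋆ (λ i j → ι (suc j) * (dp x i * dp y (suc j))) n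
      ≡⟨ cong₂ _+_ (trans (∑⋆-cong n (λ i j → trans (sym (*-assoc (ι (suc i)) (dp x (suc i)) (dp y j)))
                                      (trans (cong (_* dp y j) (dp-suc x i)) (*-assoc x _ _)))) (sym (∑⋆-*ˡ n x _)))
                   (trans (∑⋆-cong n (λ i j → trans (lem (ι (suc j)) (dp x i) (dp y (suc j)))
                                      (trans (cong (dp x i *_) (dp-suc y j)) (lem (dp x i) y (dp y j))))) (sym (∑⋆-*ˡ n y _))) ⟩
    x * ∑⋆ (λ i j → dp x i * dp y j) n + y * ∑⋆ (λ i j → dp x i * dp y j) n
      ≡⟨ *-distribʳ-+ _ x y ⟨
    (x + y) * ∑⋆ (λ i j → dp x i * dp y j) n
      ≡⟨ cong ((x + y) *_) (∑⋆-dp x y n) ⟩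
    (x + y) * dp (x + y) n
      ≡⟨ dp-suc (x + y) n ⟨
    ι (suc n) * dp (x + y) (suc n) ∎)
    where
    lem : ∀ a b c → a * (b * c) ≡ b * (a * c)
    lem = solve-∀ ℚ-ring

  Δ^ : ℕ → (ℕ → ℚ) → ℕ → ℚ
  Δ^ zero    g i = g i
  Δ^ (suc n) g i = Δ^ n g (suc i) - Δ^ n g i

  Δ^-cong : ∀ n {f g} → (∀ i → f i ≡ g i) → ∀ i → Δ^ n f i ≡ Δ^ n g i
  Δ^-cong zero    h i = h i
  Δ^-cong (suc n) h i = cong₂ _-_ (Δ^-cong n h (suc i)) (Δ^-cong n h i)

  Δ^-+ : ∀ n c f g i → Δ^ n (λ j → c * f j + g j) i ≡ c * Δ^ n f i + Δ^ n g i
  Δ^-+ zero    c f g i = refl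
  Δ^-+ (suc n) c f g i = trans (cong₂ _-_ (Δ^-+ n c f g (suc i)) (Δ^-+ n c f g i)) (lem c (Δ^ n f (suc i)) (Δ^ n f i) _ _)
    where
    lem : ∀ c a b d e → (c * a + d) - (c * b + e) ≡ c * (a - b) + (d - e)
    lem = solve-∀ ℚ-ring

  Δ^-Δ : ∀ n f i → Δ^ n (λ j → f (suc j) - f j) i ≡ Δ^ (suc n) f i
  Δ^-Δ zero    f i = refl
  Δ^-Δ (suc n) f i = cong₂ _-_ (Δ^-Δ n f (suc i)) (Δ^-Δ n f i)

  -- The Leibniz rule for iterated differences of a product with the identity, whose second
  -- difference vanishes.
  Δ^-X : ∀ n g i → Δ^ (suc n) (λ j → ι j * g j) i ≡ ι i * Δ^ (suc n) g i + ι (suc n) * Δ^ n g (suc i)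
  Δ^-X zero    g i = trans (cong (λ q → q * g (suc i) - ι i * g i) (ι-suc i))
                       (trans (lem (ι i) (g (suc i)) (g i)) (cong (λ q → ι i * (g (suc i) - g i) + q * g (suc i)) (sym ι-1)))
    where
    lem : ∀ i a b → (1ℚ + i) * a - i * b ≡ i * (a - b) + 1ℚ * a
    lem = solve-∀ ℚ-ring
  Δ^-X (suc n) g i = begin
    Δ^ (suc n) (λ j → ι j * g j) (suc i) - Δ^ (suc n) (λ j → ι j * g j) i
      ≡⟨ cong₂ _-_ (Δ^-X n g (suc i)) (Δ^-X n g i) ⟩
    (ι (suc i) * (c - b) + ι (suc n) * c) - (ι i * (b - a) + ι (suc n) * b)
      ≡⟨ cong (λ q → (q * (c - b) + ι (suc n) * c) - (ι i * (b - a) + ι (suc n) * b)) (ι-suc i) ⟩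
    ((1ℚ + ι i) * (c - b) + ι (suc n) * c) - (ι i * (b - a) + ι (suc n) * b)
      ≡⟨ lem (ι i) (ι (suc n)) a b c ⟩
    ι i * ((c - b) - (b - a)) + (1ℚ + ι (suc n)) * (c - b)
      ≡⟨ cong (λ q → ι i * ((c - b) - (b - a)) + q * (c - b)) (ι-suc (suc n)) ⟨
    ι i * ((c - b) - (b - a)) + ι (suc (suc n)) * (c - b) ∎
    where
    a b c : ℚ
    a = Δ^ n g i
    b = Δ^ n g (suc i)
    c = Δ^ n g (suc (suc i))
    lem : ∀ i n a b c → ((1ℚ + i) * (c - b) + n * c) - (i * (b - a) + n * b)
                        ≡ i * ((c - b) - (b - a)) + (1ℚ + n) * (c - b)
    lem = solve-∀ ℚ-ring

  Δ^-power : ∀ p i → Δ^ (suc p) (λ j → ι j ^ p) i ≡ 0ℚ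
  Δ^-power zero    i = +-inverseʳ 1ℚ
  Δ^-power (suc p) i = begin
    Δ^ (suc (suc p)) (λ j → ι j * ι j ^ p) i
      ≡⟨ Δ^-X (suc p) (λ j → ι j ^ p) i ⟩
    ι i * (Δ^ (suc p) (λ j → ι j ^ p) (suc i) - Δ^ (suc p) (λ j → ι j ^ p) i) + ι (suc (suc p)) * Δ^ (suc p) (λ j → ι j ^ p) (suc i)
      ≡⟨ cong₂ (λ a b → ι i * (a - b) + ι (suc (suc p)) * a) (Δ^-power p (suc i)) (Δ^-power p i) ⟩
    ι i * (0ℚ - 0ℚ) + ι (suc (suc p)) * 0ℚ
      ≡⟨ lem (ι i) (ι (suc (suc p))) ⟩
    0ℚ ∎
    where
    lem : ∀ i n → i * (0ℚ - 0ℚ) + n * 0ℚ ≡ 0ℚ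
    lem = solve-∀ ℚ-ring

  -- The Abel sums W satisfy (a + 1) W_{a+1} f = y W_a f + Δ (W_a (X f)), where X
  -- multiplies by the argument.  Hence W_a 1 is constant, and for f = 1/(X + b),
  -- where X f = 1 - b f, the recursion closes up and can be solved (V below).
  module AbelSums (y : ℚ) where

    W : ℕ → (ℕ → ℚ) → ℕ → ℚ
    W a f e = ∑⋆ (λ i j → dp (ι (e ℕ.+ i)) i * dp (y - ι (e ℕ.+ i)) j * f (e ℕ.+ i)) a

    W-suc : ∀ a f e → ι (suc a) * W (suc a) f e ≡ y * W a f e + (W a (λ i → ι i * f i) (suc e) - W a (λ i → ι i * f i) e)
    W-suc a f e = begin
      ι (suc a) * W (suc a) f e
        ≡⟨ ∑⋆-Leibniz a t ⟨
      ∑⋆ (λ i j → ι (suc i) * t (suc i) j) a + ∑⋆ (λ i j → ι (suc j) * t i (suc j)) a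
        ≡⟨ cong₂ _+_ (∑⋆-cong a up) (∑⋆-cong a right) ⟩
      W a (λ i → ι i * f i) (suc e) + ∑⋆ (λ i j → y * t i j + - 1ℚ * t′ i j) a
        ≡⟨ cong (W a (λ i → ι i * f i) (suc e) +_) (trans (∑⋆-+ a _ _) (cong₂ _+_ (sym (∑⋆-*ˡ a y t)) (sym (∑⋆-*ˡ a (- 1ℚ) t′)))) ⟩
      W a (λ i → ι i * f i) (suc e) + (y * W a f e + - 1ℚ * W a (λ i → ι i * f i) e)
        ≡⟨ lem (W a (λ i → ι i * f i) (suc e)) (y * W a f e) _ ⟩
      y * W a f e + (W a (λ i → ι i * f i) (suc e) - W a (λ i → ι i * f i) e) ∎
      where
      t t′ : ℕ → ℕ → ℚ
      t  i j = dp (ι (e ℕ.+ i)) i * dp (y - ι (e ℕ.+ i)) j * f (e ℕ.+ i)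
      t′ i j = dp (ι (e ℕ.+ i)) i * dp (y - ι (e ℕ.+ i)) j * (ι (e ℕ.+ i) * f (e ℕ.+ i))
      lem : ∀ a b c → a + (b + - 1ℚ * c) ≡ b + (a - c)
      lem = solve-∀ ℚ-ring
      ring-up : ∀ m x d g → m * (x * d * g) ≡ (m * x) * (d * g)
      ring-up = solve-∀ ℚ-ring
      ring-up′ : ∀ n x d g → (n * x) * (d * g) ≡ x * d * (n * g)
      ring-up′ = solve-∀ ℚ-ring
      up : ∀ i j → ι (suc i) * t (suc i) j
                   ≡ dp (ι (suc e ℕ.+ i)) i * dp (y - ι (suc e ℕ.+ i)) j * (ι (suc e ℕ.+ i) * f (suc e ℕ.+ i))
      up i j rewrite ℕₚ.+-suc e i = begin
        ι (suc i) * (dp n (suc i) * dp (y - n) j * f (suc (e ℕ.+ i)))   ≡⟨ ring-up (ι (suc i)) (dp n (suc i)) (dp (y - n) j) (f (suc (e ℕ.+ i))) ⟩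
        ι (suc i) * dp n (suc i) * (dp (y - n) j * f (suc (e ℕ.+ i)))   ≡⟨ cong (_* (dp (y - n) j * f (suc (e ℕ.+ i)))) (dp-suc n i) ⟩
        n * dp n i * (dp (y - n) j * f (suc (e ℕ.+ i)))                 ≡⟨ ring-up′ n (dp n i) (dp (y - n) j) (f (suc (e ℕ.+ i))) ⟩
        dp n i * dp (y - n) j * (n * f (suc (e ℕ.+ i))) ∎
        where
        n : ℚ
        n = ι (suc (e ℕ.+ i))
      ring-r : ∀ m x d g → m * (x * d * g) ≡ x * (m * d) * g
      ring-r = solve-∀ ℚ-ring
      ring-r′ : ∀ y n x d g → x * ((y - n) * d) * g ≡ y * (x * d * g) + - 1ℚ * (x * d * (n * g))
      ring-r′ = solve-∀ ℚ-ring
      right : ∀ i j → ι (suc j) * t i (suc j) ≡ y * t i j + - 1ℚ * t′ i j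
      right i j = trans (ring-r (ι (suc j)) (dp n i) (dp (y - n) (suc j)) (f (e ℕ.+ i)))
        (trans (cong (λ q → dp n i * q * f (e ℕ.+ i)) (dp-suc (y - n) j)) (ring-r′ y n (dp n i) (dp (y - n) j) (f (e ℕ.+ i))))
        where
        n : ℚ
        n = ι (e ℕ.+ i)

    W-0 : ∀ f e → W 0 f e ≡ f e
    W-0 f e = trans (cong₂ (λ a b → a * b * f (e ℕ.+ 0)) (dp-0 (ι (e ℕ.+ 0))) (dp-0 (y - ι (e ℕ.+ 0))))
                (trans (lem (f (e ℕ.+ 0))) (cong f (ℕₚ.+-identityʳ e)))
      where
      lem : ∀ q → 1ℚ * 1ℚ * q ≡ q
      lem = solve-∀ ℚ-ring

    -- The target is p = 0. `W-suc` trades one step in a for one more power of the argument together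
    -- with one more difference, so the induction on a has to treat all p at once.
    Δ^-W-power : ∀ a p e → Δ^ (suc p) (W a (λ i → ι i ^ p)) e ≡ 0ℚ
    Δ^-W-power zero    p e = trans (Δ^-cong (suc p) (W-0 (λ i → ι i ^ p)) e) (Δ^-power p e)
    Δ^-W-power (suc a) p e = ι-cancelˡ {suc a} (s≤s z≤n) (begin
      ι (suc a) * Δ^ (suc p) (W (suc a) g) e
        ≡⟨ trans (sym (+-identityʳ _)) (cong (ι (suc a) * Δ^ (suc p) (W (suc a) g) e +_) (sym (Δ0 (suc p) e))) ⟩
      ι (suc a) * Δ^ (suc p) (W (suc a) g) e + Δ^ (suc p) (λ _ → 0ℚ) e
        ≡⟨ Δ^-+ (suc p) (ι (suc a)) (W (suc a) g) (λ _ → 0ℚ) e ⟨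
      Δ^ (suc p) (λ i → ι (suc a) * W (suc a) g i + 0ℚ) e
        ≡⟨ Δ^-cong (suc p) (λ i → trans (+-identityʳ _) (W-suc a g i)) e ⟩
      Δ^ (suc p) (λ i → y * W a g i + (W a g′ (suc i) - W a g′ i)) e
        ≡⟨ Δ^-+ (suc p) y (W a g) _ e ⟩
      y * Δ^ (suc p) (W a g) e + Δ^ (suc p) (λ i → W a g′ (suc i) - W a g′ i) e
        ≡⟨ cong₂ (λ q r → y * q + r) (Δ^-W-power a p e) (trans (Δ^-Δ (suc p) (W a g′) e) (Δ^-W-power a (suc p) e)) ⟩
      y * 0ℚ + 0ℚ
        ≡⟨ lem y (ι (suc a)) ⟩
      ι (suc a) * 0ℚ ∎)
      where
      g g′ : ℕ → ℚ
      g  i = ι i ^ p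
      g′ i = ι i ^ suc p
      lem : ∀ y n → y * 0ℚ + 0ℚ ≡ n * 0ℚ
      lem = solve-∀ ℚ-ring
      Δ0 : ∀ n i → Δ^ n (λ _ → 0ℚ) i ≡ 0ℚ
      Δ0 zero    i = refl
      Δ0 (suc n) i = cong₂ _-_ (Δ0 n (suc i)) (Δ0 n i)

    W-1 : ∀ a e → W a (λ _ → 1ℚ) (suc e) ≡ W a (λ _ → 1ℚ) e
    W-1 a e = trans (lem (W a (λ _ → 1ℚ) (suc e)) (W a (λ _ → 1ℚ) e))
                (trans (cong (_+ W a (λ _ → 1ℚ) e) (Δ^-W-power a 0 e)) (+-identityˡ _))
      where
      lem : ∀ p q → p ≡ (p - q) + q
      lem = solve-∀ ℚ-ring

    module _ (b′ : ℕ) where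

      b : ℕ
      b = suc b′

      f : ℕ → ℚ
      f i = inv (i ℕ.+ b)

      W-f : ∀ a e → W a (λ i → ι i * f i) e ≡ W a (λ _ → 1ℚ) e - ι b * W a f e
      W-f a e = trans (∑⋆-cong a (λ i j → term (e ℕ.+ i) (dp (ι (e ℕ.+ i)) i * dp (y - ι (e ℕ.+ i)) j)))
        (trans (∑⋆-+ a _ _) (trans (cong (W a (λ _ → 1ℚ) e +_) (sym (∑⋆-*ˡ a (- ι b) _))) (lem (W a (λ _ → 1ℚ) e) (ι b) _)))
        where
        lem : ∀ p b q → p + (- b) * q ≡ p - b * q
        lem = solve-∀ ℚ-ring
        ring : ∀ x i b g → x * (i * g) ≡ x * ((i + b) * g) + (- b) * (x * g)
        ring = solve-∀ ℚ-ring
        term : ∀ m x → x * (ι m * f m) ≡ x * 1ℚ + (- ι b) * (x * f m)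
        term m x = trans (ring x (ι m) (ι b) (f m))
          (cong (λ q → x * q + (- ι b) * (x * f m))
            (trans (cong (_* f m) (sym (ι-+ m b))) (ι-inv⁺ (ℕₚ.≤-trans (s≤s z≤n) (ℕₚ.m≤n+m b m)))))

      -- With z = e + b this is 1 / (z (z + 1) ... (z + m)), that is (-Δ)^m / m! applied to 1/z.
      τ : ℕ → ℕ → ℚ
      τ e m = ι ((e ℕ.+ b′) !) * inv! (e ℕ.+ b ℕ.+ m)

      τ-diff : ∀ e m → ι (suc m) * τ e (suc m) ≡ τ e m - τ (suc e) m
      τ-diff e m = begin
        ι (suc m) * (ι ((e ℕ.+ b′) !) * inv! (e ℕ.+ b ℕ.+ suc m))
          ≡⟨ cong (λ k → ι (suc m) * (ι ((e ℕ.+ b′) !) * inv! k)) (ℕₚ.+-suc (e ℕ.+ b) m) ⟩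
        ι (suc m) * (z! * inv! (suc N))
          ≡⟨ ring (ι (suc m)) (ι (e ℕ.+ b)) z! (inv! (suc N)) ⟩
        z! * ((ι (e ℕ.+ b) + ι (suc m)) * inv! (suc N)) - ι (e ℕ.+ b) * z! * inv! (suc N)
          ≡⟨ cong (λ q → z! * (q * inv! (suc N)) - ι (e ℕ.+ b) * z! * inv! (suc N))
               (trans (sym (ι-+ (e ℕ.+ b) (suc m))) (cong ι (ℕₚ.+-suc (e ℕ.+ b) m))) ⟩
        z! * (ι (suc N) * inv! (suc N)) - ι (e ℕ.+ b) * z! * inv! (suc N)
          ≡⟨ cong₂ (λ p q → z! * p - q * inv! (suc N)) (inv!-suc N)
               (trans (cong (λ k → ι k * z!) (ℕₚ.+-suc e b′)) (sym (ι-* (suc (e ℕ.+ b′)) ((e ℕ.+ b′) !)))) ⟩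
        τ e m - τ (suc e) m ∎
        where
        N : ℕ
        N = e ℕ.+ b ℕ.+ m
        z! : ℚ
        z! = ι ((e ℕ.+ b′) !)
        ring : ∀ m z f i → m * (f * i) ≡ f * ((z + m) * i) - z * f * i
        ring = solve-∀ ℚ-ring

      -- For f = 1/(X + b) the constant sums W_a 1 drop out of the difference, leaving (a + 1)
      -- W_(a+1) f = (y - bΔ) W_a f. Hence W_a f is (y - bΔ)^a / a! applied to f, and this is its
      -- binomial expansion.
      V : ℕ → ℕ → ℚ
      V a e = ∑⋆ (λ m k → dp y k * (ι b ^ m * τ e m)) a

      V-suc : ∀ a e → ι (suc a) * V (suc a) e ≡ y * V a e + ι b * (V a e - V a (suc e))
      V-suc a e = begin
        ι (suc a) * V (suc a) e
          ≡⟨ ∑⋆-Leibniz a (λ m k → dp y k * (ι b ^ m * τ e m)) ⟨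
        ∑⋆ (λ m k → ι (suc m) * (dp y k * (ι b * ι b ^ m * τ e (suc m)))) a + ∑⋆ (λ m k → ι (suc k) * (dp y (suc k) * (ι b ^ m * τ e m))) a
          ≡⟨ cong₂ _+_ (∑⋆-cong a (λ m k → trans (ring (ι (suc m)) (dp y k) (ι b) (ι b ^ m) (τ e (suc m)))
                                       (trans (cong (λ q → ι b * (dp y k * (ι b ^ m * q))) (τ-diff e m))
                                          (ring′ (ι b) (dp y k) (ι b ^ m) (τ e m) (τ (suc e) m)))))
                       (∑⋆-cong a (λ m k → trans (sym (*-assoc (ι (suc k)) (dp y (suc k)) _)) (trans (cong (_* (ι b ^ m * τ e m)) (dp-suc y k)) (*-assoc y _ _)))) ⟩
        ∑⋆ (λ m k → ι b * (dp y k * (ι b ^ m * τ e m)) + (- ι b) * (dp y k * (ι b ^ m * τ (suc e) m))) a + ∑⋆ (λ m k → y * (dp y k * (ι b ^ m * τ e m))) a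
          ≡⟨ cong₂ _+_ (trans (∑⋆-+ a _ _) (cong₂ _+_ (sym (∑⋆-*ˡ a (ι b) _)) (sym (∑⋆-*ˡ a (- ι b) _)))) (sym (∑⋆-*ˡ a y _)) ⟩
        ι b * V a e + (- ι b) * V a (suc e) + y * V a e
          ≡⟨ ring″ (ι b) (V a e) (V a (suc e)) y ⟩
        y * V a e + ι b * (V a e - V a (suc e)) ∎
        where
        ring : ∀ m d b p t → m * (d * (b * p * t)) ≡ b * (d * (p * (m * t)))
        ring = solve-∀ ℚ-ring
        ring′ : ∀ b d p t u → b * (d * (p * (t - u))) ≡ b * (d * (p * t)) + (- b) * (d * (p * u))
        ring′ = solve-∀ ℚ-ring
        ring″ : ∀ b v w y → b * v + (- b) * w + y * v ≡ y * v + b * (v - w)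
        ring″ = solve-∀ ℚ-ring

      W≡V : ∀ a e → W a f e ≡ V a e
      W≡V zero    e = sym (begin
        dp y 0 * (1ℚ * τ e 0)
          ≡⟨ trans (cong (_* (1ℚ * τ e 0)) (dp-0 y)) (trans (*-identityˡ _) (*-identityˡ (τ e 0))) ⟩
        ι ((e ℕ.+ b′) !) * inv! (e ℕ.+ b ℕ.+ 0)
          ≡⟨ cong (λ k → ι ((e ℕ.+ b′) !) * inv! k) (trans (ℕₚ.+-identityʳ (e ℕ.+ b)) (ℕₚ.+-suc e b′)) ⟩
        ι ((e ℕ.+ b′) !) * inv (suc (e ℕ.+ b′) ℕ.* (e ℕ.+ b′) !)
          ≡⟨ cong (ι ((e ℕ.+ b′) !) *_) (inv-* {suc (e ℕ.+ b′)} (s≤s z≤n) (!≥1 (e ℕ.+ b′))) ⟩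
        ι ((e ℕ.+ b′) !) * (inv (suc (e ℕ.+ b′)) * inv! (e ℕ.+ b′))
          ≡⟨ ring (ι ((e ℕ.+ b′) !)) (inv (suc (e ℕ.+ b′))) (inv! (e ℕ.+ b′)) ⟩
        inv (suc (e ℕ.+ b′)) * (ι ((e ℕ.+ b′) !) * inv! (e ℕ.+ b′))
          ≡⟨ trans (cong (inv (suc (e ℕ.+ b′)) *_) (ι!-inv! (e ℕ.+ b′))) (*-identityʳ _) ⟩
        inv (suc (e ℕ.+ b′))
          ≡⟨ cong inv (ℕₚ.+-suc e b′) ⟨
        inv (e ℕ.+ b)
          ≡⟨ W-0 f e ⟨
        W 0 f e ∎)
        where
        ring : ∀ a b c → a * (b * c) ≡ b * (a * c)
        ring = solve-∀ ℚ-ring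
      W≡V (suc a) e = ι-cancelˡ {suc a} (s≤s z≤n) (begin
        ι (suc a) * W (suc a) f e
          ≡⟨ W-suc a f e ⟩
        y * W a f e + (W a (λ i → ι i * f i) (suc e) - W a (λ i → ι i * f i) e)
          ≡⟨ cong₂ (λ p q → y * W a f e + (p - q)) (trans (W-f a (suc e)) (cong (_- ι b * W a f (suc e)) (W-1 a e))) (W-f a e) ⟩
        y * W a f e + ((W a (λ _ → 1ℚ) e - ι b * W a f (suc e)) - (W a (λ _ → 1ℚ) e - ι b * W a f e))
          ≡⟨ ring (y * W a f e) (W a (λ _ → 1ℚ) e) (ι b) (W a f (suc e)) (W a f e) ⟩
        y * W a f e + ι b * (W a f e - W a f (suc e))
          ≡⟨ cong₂ (λ p q → y * p + ι b * (p - q)) (W≡V a e) (W≡V a (suc e)) ⟩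
        y * V a e + ι b * (V a e - V a (suc e))
          ≡⟨ V-suc a e ⟨
        ι (suc a) * V (suc a) e ∎)
        where
        ring : ∀ p o b u v → p + ((o - b * u) - (o - b * v)) ≡ p + b * (v - u)
        ring = solve-∀ ℚ-ring

  c : ℕ → ℚ
  c m = dp (ι m) m

  c-W : ℕ → ℕ → ℚ
  c-W a b = ∑⋆ (λ i j → c i * c j * inv (i ℕ.+ b)) a

  -- At e = 0 and y = a the Abel sum is `c-W`. In its closed form the prefactor `ι b * c b`
  -- completes b^m `τ` to b^(b+m) / (b + m)!. What remains are the terms of (a + b)^(a+b) / (a + b)!
  -- in which b has exponent at least b.
  c-W-tail : ∀ a {b} → 1 ≤ b → ι b * (c b * c-W a b) ≡ ∑⋆ (λ m k → dp (ι b) (b ℕ.+ m) * dp (ι a) k) a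
  c-W-tail a {suc b′} _ = begin
    ι b * (c b * c-W a b)
      ≡⟨ cong (λ q → ι b * (c b * q)) (trans (∑⋆-cong-+ a term) (W≡V b′ a 0)) ⟩
    ι b * (c b * V b′ a 0)
      ≡⟨ trans (sym (*-assoc (ι b) (c b) _)) (∑⋆-*ˡ a (ι b * c b) _) ⟩
    ∑⋆ (λ m k → ι b * c b * (dp (ι a) k * (ι b ^ m * τ b′ 0 m))) a
      ≡⟨ ∑⋆-cong a (λ m k → trans (ring (ι b) (ι b ^ b) (inv! b) (dp (ι a) k) (ι b ^ m) (ι (b′ !)) (inv! (b ℕ.+ m)))
           (trans (cong (λ q → q * ι (b′ !) * (ι b ^ b * ι b ^ m) * inv! (b ℕ.+ m) * dp (ι a) k) (inv!-suc b′))
            (trans (cong (λ q → q * (ι b ^ b * ι b ^ m) * inv! (b ℕ.+ m) * dp (ι a) k) (trans (*-comm (inv! b′) _) (ι!-inv! b′)))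
             (trans (cong (λ q → q * inv! (b ℕ.+ m) * dp (ι a) k) (trans (*-identityˡ _) (sym (^-+ (ι b) b m)))) refl)))) ⟩
    ∑⋆ (λ m k → dp (ι b) (b ℕ.+ m) * dp (ι a) k) a ∎
    where
    b : ℕ
    b = suc b′
    open AbelSums (ι a) hiding (b)
    ring : ∀ b p i d q f j → b * (p * i) * (d * (q * (f * j))) ≡ (b * i) * f * (p * q) * j * d
    ring = solve-∀ ℚ-ring
    term : ∀ i j → i ℕ.+ j ≡ a → c i * c j * inv (i ℕ.+ b) ≡ dp (ι i) i * dp (ι a - ι i) j * inv (i ℕ.+ b)
    term i j e = cong (λ q → c i * dp q j * inv (i ℕ.+ b))
      (trans (sub (ι i) (ι j)) (cong (_- ι i) (trans (sym (ι-+ i j)) (cong ι e))))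
      where
      sub : ∀ i j → j ≡ (i + j) - i
      sub = solve-∀ ℚ-ring

  -- The two tails of the binomial expansion of (a + b)^{a+b} overlap in one term.
  ∑⋆-overlap : ∀ a b f → ∑⋆ (λ i j → f i (a ℕ.+ j)) b + ∑⋆ (λ i j → f (b ℕ.+ i) j) a ≡ ∑⋆ f (b ℕ.+ a) + f b a
  ∑⋆-overlap a zero    f = trans (+-comm (f 0 (a ℕ.+ 0)) _) (cong (λ k → ∑⋆ f a + f 0 k) (ℕₚ.+-identityʳ a))
  ∑⋆-overlap a (suc b) f = begin
    f 0 (a ℕ.+ suc b) + ∑⋆ (λ i j → f (suc i) (a ℕ.+ j)) b + ∑⋆ (λ i j → f (suc (b ℕ.+ i)) j) a
      ≡⟨ +-assoc (f 0 (a ℕ.+ suc b)) _ _ ⟩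
    f 0 (a ℕ.+ suc b) + (∑⋆ (λ i j → f (suc i) (a ℕ.+ j)) b + ∑⋆ (λ i j → f (suc (b ℕ.+ i)) j) a)
      ≡⟨ cong₂ (λ k q → f 0 k + q) (ℕₚ.+-comm a (suc b)) (∑⋆-overlap a b (λ i → f (suc i))) ⟩
    f 0 (suc b ℕ.+ a) + (∑⋆ (λ i → f (suc i)) (b ℕ.+ a) + f (suc b) a)
      ≡⟨ +-assoc (f 0 (suc b ℕ.+ a)) _ _ ⟨
    ∑⋆ f (suc b ℕ.+ a) + f (suc b) a ∎

  c-W-symmetric : ∀ {a b} → 1 ≤ a → 1 ≤ b → ι b * (c b * c-W a b) + ι a * (c a * c-W b a) ≡ c (b ℕ.+ a) + c b * c a
  c-W-symmetric {a} {b} ha hb = begin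
    ι b * (c b * c-W a b) + ι a * (c a * c-W b a)
      ≡⟨ cong₂ _+_ (c-W-tail a hb) (trans (c-W-tail b ha) (trans (∑⋆-comm b _) (∑⋆-cong b (λ i j → *-comm _ (dp (ι b) i))))) ⟩
    ∑⋆ (λ i j → dp (ι b) (b ℕ.+ i) * dp (ι a) j) a + ∑⋆ (λ i j → dp (ι b) i * dp (ι a) (a ℕ.+ j)) b
      ≡⟨ +-comm (∑⋆ (λ i j → dp (ι b) (b ℕ.+ i) * dp (ι a) j) a) _ ⟩
    ∑⋆ (λ i j → dp (ι b) i * dp (ι a) (a ℕ.+ j)) b + ∑⋆ (λ i j → dp (ι b) (b ℕ.+ i) * dp (ι a) j) a
      ≡⟨ ∑⋆-overlap a b (λ i j → dp (ι b) i * dp (ι a) j) ⟩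
    ∑⋆ (λ i j → dp (ι b) i * dp (ι a) j) (b ℕ.+ a) + c b * c a
      ≡⟨ cong (_+ c b * c a) (trans (∑⋆-dp (ι b) (ι a) (b ℕ.+ a)) (cong (λ q → dp q (b ℕ.+ a)) (sym (ι-+ b a)))) ⟩
    c (b ℕ.+ a) + c b * c a ∎

  ∑⁺ : (ℕ → ℕ → ℚ) → ℕ → ℚ
  ∑⁺ f 0             = 0ℚ
  ∑⁺ f 1             = 0ℚ
  ∑⁺ f (suc (suc n)) = ∑⋆ (λ i j → f (suc i) (suc j)) n

  ∑⋆-∑⁺ : ∀ {n} f → 1 ≤ n → ∑⋆ f n ≡ f 0 n + ∑⁺ f n + f n 0
  ∑⋆-∑⁺ {suc zero}    f _ = cong (_+ f 1 0) (sym (+-identityʳ (f 0 1)))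
  ∑⋆-∑⁺ {suc (suc n)} f _ = trans (cong (f 0 (suc (suc n)) +_) (∑⋆-last n (λ i j → f (suc i) j)))
                                  (sym (+-assoc (f 0 (suc (suc n))) _ _))

  R : ℕ → ℕ → ℚ
  R a b = ∑⁺ (λ i j → c i * c j * inv (i ℕ.+ b)) a

  -- The end terms i = 0 and j = 0 are stripped off `c-W-symmetric`. Together they are 3
  -- `c a * c b`, because a/a + b/b + (a + b)/(a + b) = 3; the overlap term removes one of these,
  -- hence the coefficient 2.
  c-R : ∀ {a b} → 1 ≤ a → 1 ≤ b →
        c (a ℕ.+ b) ≡ 2ℚ * (c a * c b) + (ι b * (c b * R a b) + ι a * (c a * R b a))
  c-R {a} {b} ha hb = begin
    c (a ℕ.+ b)
      ≡⟨ cong c (ℕₚ.+-comm a b) ⟩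
    c (b ℕ.+ a)
      ≡⟨ ring₁ (c (b ℕ.+ a)) (c b * c a) ⟩
    (c (b ℕ.+ a) + c b * c a) - c b * c a
      ≡⟨ cong (_- c b * c a) (c-W-symmetric ha hb) ⟨
    (ι b * (c b * c-W a b) + ι a * (c a * c-W b a)) - c b * c a
      ≡⟨ cong₂ (λ p q → (ι b * (c b * p) + ι a * (c a * q)) - c b * c a) (expand ha) (expand hb) ⟩
    (ι b * (c b * (c a * inv b + R a b + c a * inv (a ℕ.+ b))) + ι a * (c a * (c b * inv a + R b a + c b * inv (b ℕ.+ a)))) - c b * c a
      ≡⟨ cong (λ k → (ι b * (c b * (c a * inv b + R a b + c a * inv (a ℕ.+ b))) + ι a * (c a * (c b * inv a + R b a + c b * inv k))) - c b * c a)
           (ℕₚ.+-comm b a) ⟩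
    (ι b * (c b * (c a * inv b + R a b + c a * inv (a ℕ.+ b))) + ι a * (c a * (c b * inv a + R b a + c b * inv (a ℕ.+ b)))) - c b * c a
      ≡⟨ ring₂ (ι a) (ι b) (c a) (c b) (inv a) (inv b) (inv (a ℕ.+ b)) (R a b) (R b a) ⟩
    c a * c b * (ι a * inv a + ι b * inv b + (ι a + ι b) * inv (a ℕ.+ b) - 1ℚ) + (ι b * (c b * R a b) + ι a * (c a * R b a))
      ≡⟨ cong (_+ (ι b * (c b * R a b) + ι a * (c a * R b a))) (trans (cong (c a * c b *_) units) (*-comm (c a * c b) 2ℚ)) ⟩
    2ℚ * (c a * c b) + (ι b * (c b * R a b) + ι a * (c a * R b a)) ∎
    where
    expand : ∀ {a b} → 1 ≤ a → c-W a b ≡ c a * inv b + R a b + c a * inv (a ℕ.+ b)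
    expand {a} {b} ha = trans (∑⋆-∑⁺ _ ha) (cong₂ (λ p q → p * inv b + R a b + q * inv (a ℕ.+ b))
      (trans (cong (_* c a) (dp-0 (ι 0))) (*-identityˡ (c a))) (trans (cong (c a *_) (dp-0 (ι 0))) (*-identityʳ (c a))))
    units : ι a * inv a + ι b * inv b + (ι a + ι b) * inv (a ℕ.+ b) - 1ℚ ≡ 2ℚ
    units = cong₂ (λ p q → p + q - 1ℚ) (cong₂ _+_ (ι-inv⁺ ha) (ι-inv⁺ hb))
      (trans (cong (_* inv (a ℕ.+ b)) (sym (ι-+ a b))) (ι-inv⁺ (ℕₚ.≤-trans ha (ℕₚ.m≤m+n a b))))
    ring₁ : ∀ p q → p ≡ (p + q) - q
    ring₁ = solve-∀ ℚ-ring
    ring₂ : ∀ a b p q i j k r s → (b * (q * (p * j + r + p * k)) + a * (p * (q * i + s + q * k))) - q * p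
                                  ≡ p * q * (a * i + b * j + (a + b) * k - 1ℚ) + (b * (q * r) + a * (p * s))
    ring₂ = solve-∀ ℚ-ring

  -- Subsets of a multiset, via divided powers: a run of d equal elements is
  -- cut into i + j = d in d! / (i! j!) ways.
  ∑⊎-replicate : ∀ d v e (Ψ : List ℕ → List ℕ → ℚ) →
    ∑⊎ (replicate d v ++ e) Ψ
      ≡ ι (d !) * ∑⋆ (λ i j → inv! i * inv! j * ∑⊎ e (λ S T → Ψ (replicate i v ++ S) (replicate j v ++ T))) d
  ∑⊎-replicate zero    v e Ψ = sym (trans (cong₂ (λ p q → p * (q * q * ∑⊎ e Ψ)) ι-1 inv-1) (lem (∑⊎ e Ψ)))
    where
    lem : ∀ q → 1ℚ * (1ℚ * 1ℚ * q) ≡ q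
    lem = solve-∀ ℚ-ring
  ∑⊎-replicate (suc d) v e Ψ = begin
    ∑⊎ (replicate d v ++ e) (λ S T → Ψ (v ∷ S) T) + ∑⊎ (replicate d v ++ e) (λ S T → Ψ S (v ∷ T))
      ≡⟨ cong₂ _+_ (∑⊎-replicate d v e (λ S T → Ψ (v ∷ S) T)) (∑⊎-replicate d v e (λ S T → Ψ S (v ∷ T))) ⟩
    ι (d !) * ∑⋆ (λ i j → inv! i * inv! j * Θ (suc i) j) d + ι (d !) * ∑⋆ (λ i j → inv! i * inv! j * Θ i (suc j)) d
      ≡⟨ *-distribˡ-+ (ι (d !)) _ _ ⟨
    ι (d !) * (∑⋆ (λ i j → inv! i * inv! j * Θ (suc i) j) d + ∑⋆ (λ i j → inv! i * inv! j * Θ i (suc j)) d)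
      ≡⟨ cong (ι (d !) *_) (cong₂ _+_
           (∑⋆-cong d (λ i j → trans (cong (λ q → q * inv! j * Θ (suc i) j) (sym (inv!-suc i))) (ring₁ (ι (suc i)) (inv! (suc i)) (inv! j) (Θ (suc i) j))))
           (∑⋆-cong d (λ i j → trans (cong (λ q → inv! i * q * Θ i (suc j)) (sym (inv!-suc j))) (ring₂ (ι (suc j)) (inv! (suc j)) (inv! i) (Θ i (suc j)))))) ⟩
    ι (d !) * (∑⋆ (λ i j → ι (suc i) * (inv! (suc i) * inv! j * Θ (suc i) j)) d + ∑⋆ (λ i j → ι (suc j) * (inv! i * inv! (suc j) * Θ i (suc j))) d)
      ≡⟨ cong (ι (d !) *_) (∑⋆-Leibniz d (λ i j → inv! i * inv! j * Θ i j)) ⟩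
    ι (d !) * (ι (suc d) * ∑⋆ (λ i j → inv! i * inv! j * Θ i j) (suc d))
      ≡⟨ trans (ring₃ (ι (d !)) (ι (suc d)) _) (cong (_* ∑⋆ (λ i j → inv! i * inv! j * Θ i j) (suc d)) (sym (ι-* (suc d) (d !)))) ⟩
    ι (suc d !) * ∑⋆ (λ i j → inv! i * inv! j * Θ i j) (suc d) ∎
    where
    Θ : ℕ → ℕ → ℚ
    Θ i j = ∑⊎ e (λ S T → Ψ (replicate i v ++ S) (replicate j v ++ T))
    ring₁ : ∀ n i j t → n * i * j * t ≡ n * (i * j * t)
    ring₁ = solve-∀ ℚ-ring
    ring₂ : ∀ n j i t → i * (n * j) * t ≡ n * (i * j * t)
    ring₂ = solve-∀ ℚ-ring
    ring₃ : ∀ a b c → a * (b * c) ≡ b * a * c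
    ring₃ = solve-∀ ℚ-ring

  -- This is `abel-MM` for m parts equal to 1: by `∑⊎-replicate` the decompositions become a
  -- convolution with weights 1/(i! j!), and `M` of i ones is i^(i-1) for i ≥ 1.
  c-c : ∀ {m} → 1 ≤ m → ι m * (ι m * ∑⁺ (λ i j → c i * c j * (inv i * inv j)) m) ≡ 2ℚ * ((ι m - 1ℚ) * c m)
  c-c {m} h = cancelˡ-inv (ι (m !)) (inv! m) (ι!-inv! m) (begin
    ι (m !) * (ι m * (ι m * ∑⁺ g m))
      ≡⟨ cong (λ q → ι (m !) * (ι m * (ι m * q))) (sym (trans (∑⋆-∑⁺ g h) (trans (cong₂ (λ p q → p + ∑⁺ g m + q) left right) (0+0 (∑⁺ g m))))) ⟩
    ι (m !) * (ι m * (ι m * ∑⋆ g m))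
      ≡⟨ ring (ι (m !)) (ι m) (∑⋆ g m) ⟩
    ι m * (ι m * (ι (m !) * ∑⋆ g m))
      ≡⟨ cong (λ q → ι m * (ι m * q)) (sym (trans (∑⊎-replicate m 1 [] (λ S T → M S * M T)) (cong (ι (m !) *_) (∑⋆-cong m term)))) ⟩
    ι m * (ι m * ∑⊎ U (λ S T → M S * M T))
      ≡⟨ cong (λ k → ι m * (ι k * ∑⊎ U (λ S T → M S * M T))) (sum-ones m) ⟨
    ι m * (ι (sum U) * ∑⊎ U (λ S T → M S * M T))
      ≡⟨ cong (ι m *_) (abel-MM (ones-positive m)) ⟩
    ι m * (2ℚ * ((ι (length U) - 1ℚ) * M U))
      ≡⟨ cong₂ (λ k q → ι m * (2ℚ * ((ι k - 1ℚ) * q))) (length-ones m) (M-ones m) ⟩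
    ι m * (2ℚ * ((ι m - 1ℚ) * (ι m ^ m * inv m)))
      ≡⟨ ring₂ (ι m) (ι m ^ m) (inv m) ⟩
    ι m * inv m * (2ℚ * ((ι m - 1ℚ) * ι m ^ m))
      ≡⟨ cong (_* (2ℚ * ((ι m - 1ℚ) * ι m ^ m))) (trans (ι-inv⁺ h) (sym (ι!-inv! m))) ⟩
    ι (m !) * inv! m * (2ℚ * ((ι m - 1ℚ) * ι m ^ m))
      ≡⟨ ring₃ (ι (m !)) (inv! m) (ι m) (ι m ^ m) ⟩
    ι (m !) * (2ℚ * ((ι m - 1ℚ) * c m)) ∎)
    where
    U : List ℕ
    U = replicate m 1 ++ []
    g : ℕ → ℕ → ℚ
    g i j = c i * c j * (inv i * inv j)
    sum-ones : ∀ i → sum (replicate i 1 ++ []) ≡ i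
    sum-ones zero    = refl
    sum-ones (suc i) = cong suc (sum-ones i)
    length-ones : ∀ i → length (replicate i 1 ++ []) ≡ i
    length-ones i = trans (cong length (++-identityʳ (replicate i 1))) (length-replicate i)
    ones-positive : ∀ i → Positive⁺ (replicate i 1 ++ [])
    ones-positive zero    = []
    ones-positive (suc i) = ℕₚ.≤-refl ∷ ones-positive i
    M-ones : ∀ i → M (replicate i 1 ++ []) ≡ ι i ^ i * inv i
    M-ones i = cong₂ (λ k l → ι k ^ l * inv k) (sum-ones i) (length-ones i)
    0+0 : ∀ q → 0ℚ + q + 0ℚ ≡ q
    0+0 = solve-∀ ℚ-ring
    left : g 0 m ≡ 0ℚ
    left = trans (cong (λ q → c 0 * c m * (q * inv m)) inv-0) (lem (c 0 * c m) (inv m))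
      where
      lem : ∀ x i → x * (0ℚ * i) ≡ 0ℚ
      lem = solve-∀ ℚ-ring
    right : g m 0 ≡ 0ℚ
    right = trans (cong (λ q → c m * c 0 * (inv m * q)) inv-0) (lem (c m * c 0) (inv m))
      where
      lem : ∀ x i → x * (i * 0ℚ) ≡ 0ℚ
      lem = solve-∀ ℚ-ring
    ring : ∀ f m s → f * (m * (m * s)) ≡ m * (m * (f * s))
    ring = solve-∀ ℚ-ring
    ring₂ : ∀ m p i → m * (2ℚ * ((m - 1ℚ) * (p * i))) ≡ m * i * (2ℚ * ((m - 1ℚ) * p))
    ring₂ = solve-∀ ℚ-ring
    ring₃ : ∀ f i m p → f * i * (2ℚ * ((m - 1ℚ) * p)) ≡ f * (2ℚ * ((m - 1ℚ) * (p * i)))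
    ring₃ = solve-∀ ℚ-ring
    ring₄ : ∀ i! j! p q i j → i! * j! * (p * i * (q * j)) ≡ p * i! * (q * j!) * (i * j)
    ring₄ = solve-∀ ℚ-ring
    term : ∀ i j → inv! i * inv! j * (M (replicate i 1 ++ []) * M (replicate j 1 ++ [])) ≡ g i j
    term i j = trans (cong₂ (λ p q → inv! i * inv! j * (p * q)) (M-ones i) (M-ones j))
                     (ring₄ (inv! i) (inv! j) (ι i ^ i) (ι j ^ j) (inv i) (inv j))

-- The Goulden-Jackson numbers satisfy the cut-and-join recursion

module CutJoin where
  open Rationals
  open Sums
  open Hurwitz
  open Convolution
  open ≡-Reasoning

  ∑⁺-cong : ∀ n {f g} → (∀ {i j} → 1 ≤ i → 1 ≤ j → i ℕ.+ j ≡ n → f i j ≡ g i j) → ∑⁺ f n ≡ ∑⁺ g n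
  ∑⁺-cong 0             h = refl
  ∑⁺-cong 1             h = refl
  ∑⁺-cong (suc (suc n)) h = ∑⋆-cong-+ n (λ i j e → h (s≤s z≤n) (s≤s z≤n)
    (cong suc (trans (ℕₚ.+-suc i j) (cong suc e))))

  ∑⁺-+ : ∀ n f g → ∑⁺ (λ i j → f i j + g i j) n ≡ ∑⁺ f n + ∑⁺ g n
  ∑⁺-+ 0             f g = refl
  ∑⁺-+ 1             f g = refl
  ∑⁺-+ (suc (suc n)) f g = ∑⋆-+ n _ _

  ∑⁺-*ˡ : ∀ n k f → k * ∑⁺ f n ≡ ∑⁺ (λ i j → k * f i j) n
  ∑⁺-*ˡ 0             k f = *-zeroʳ k
  ∑⁺-*ˡ 1             k f = *-zeroʳ k
  ∑⁺-*ˡ (suc (suc n)) k f = ∑⋆-*ˡ n k _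

  ∑⁺-comm : ∀ n f → ∑⁺ f n ≡ ∑⁺ (λ i j → f j i) n
  ∑⁺-comm 0             f = refl
  ∑⁺-comm 1             f = refl
  ∑⁺-comm (suc (suc n)) f = ∑⋆-comm n _

  ∑⁺-0 : ∀ n → ∑⁺ (λ _ _ → 0ℚ) n ≡ 0ℚ
  ∑⁺-0 0             = refl
  ∑⁺-0 1             = refl
  ∑⁺-0 (suc (suc n)) = ∑⋆-0 n

  ∑⁺-∑∈ : ∀ n U (f : ℕ → ℕ → ℕ → List ℕ → ℚ) →
          ∑⁺ (λ i j → ∑∈ U (f i j)) n ≡ ∑∈ U (λ x V → ∑⁺ (λ i j → f i j x V) n)
  ∑⁺-∑∈ n []      f = ∑⁺-0 n
  ∑⁺-∑∈ n (x ∷ U) f = trans (∑⁺-+ n _ _) (cong (∑⁺ (λ i j → f i j x U) n +_) (∑⁺-∑∈ n U (λ i j y ys → f i j y (x ∷ ys))))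

  -- The factor m^m / (m - 1)! of the Goulden–Jackson formula.
  φ : ℕ → ℚ
  φ m = ι m * c m

  Φ : List ℕ → ℚ
  Φ []      = 1ℚ
  Φ (m ∷ a) = φ m * Φ a

  Φ-Pick : ∀ {m V U} → Pick m V U → Φ U ≡ φ m * Φ V
  Φ-Pick here = refl
  Φ-Pick {m} (there {y} {V} p) = trans (cong (φ y *_) (Φ-Pick p)) (lem (φ y) (φ m) (Φ V))
    where
    lem : ∀ a b c → a * (b * c) ≡ b * (a * c)
    lem = solve-∀ ℚ-ring

  Φ-Split : ∀ {S T U} → Split S T U → Φ U ≡ Φ S * Φ T
  Φ-Split [] = refl
  Φ-Split (inˡ {x} {S} {T} sp) = trans (cong (φ x *_) (Φ-Split sp)) (sym (*-assoc (φ x) (Φ S) (Φ T)))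
  Φ-Split (inʳ {x} {S} {T} sp) = trans (cong (φ x *_) (Φ-Split sp)) (lem (φ x) (Φ S) (Φ T))
    where
    lem : ∀ a b c → a * (b * c) ≡ b * (a * c)
    lem = solve-∀ ℚ-ring

  -- The Goulden–Jackson number H_a divided by (n + l - 2)!, i.e. n^{l-3} Φ(a).
  G : List ℕ → ℚ
  G a = Φ a * (ι (sum a) ^ length a * (inv (sum a) * inv (sum a) * inv (sum a)))

  -- With b set apart as the parameter x, the exponent l - 3 becomes #S - 2, so that `abel-EE`
  -- applies to products of two `G`.
  G-∷ : ∀ {b} S → 1 ≤ b → G (b ∷ S) ≡ φ b * Φ S * E b S
  G-∷ {b} S h = cong (φ b * Φ S *_) (begin
    ι n * ι n ^ length S * (inv n * inv n * inv n)     ≡⟨ ring (ι n) (ι n ^ length S) (inv n) ⟩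
    ι n * inv n * (ι n ^ length S * (inv n * inv n))   ≡⟨ cong (_* (ι n ^ length S * (inv n * inv n))) (ι-inv⁺ (x+s≥1 S h)) ⟩
    1ℚ * (ι n ^ length S * (inv n * inv n))            ≡⟨ *-identityˡ _ ⟩
    E b S ∎)
    where
    n : ℕ
    n = b ℕ.+ sum S
    ring : ∀ n p i → n * p * (i * i * i) ≡ n * i * (p * (i * i))
    ring = solve-∀ ℚ-ring

  cut : ℕ → ℕ → List ℕ → ℚ
  cut b b′ U = ∑⊎ U (λ S T → G (b ∷ S) * G (b′ ∷ T))

  cut-≡ : ∀ {b b′} U → 1 ≤ b → 1 ≤ b′ → cut b b′ U ≡ c b * c b′ * Φ U * (ι b * ι b′ * ∑⊎ U (λ S T → E b S * E b′ T))
  cut-≡ {b} {b′} U hb hb′ = begin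
    ∑⊎ U (λ S T → G (b ∷ S) * G (b′ ∷ T))
      ≡⟨ ∑⊎-cong-Split U (λ {S} {T} sp → trans (cong₂ _*_ (G-∷ S hb) (G-∷ T hb′))
           (trans (ring (φ b) (Φ S) (E b S) (φ b′) (Φ T) (E b′ T)) (cong (λ q → φ b * φ b′ * q * (E b S * E b′ T)) (sym (Φ-Split sp))))) ⟩
    ∑⊎ U (λ S T → φ b * φ b′ * Φ U * (E b S * E b′ T))
      ≡⟨ ∑⊎-*ˡ U (φ b * φ b′ * Φ U) _ ⟨
    φ b * φ b′ * Φ U * ∑⊎ U (λ S T → E b S * E b′ T)
      ≡⟨ ring′ (ι b) (c b) (ι b′) (c b′) (Φ U) _ ⟩
    c b * c b′ * Φ U * (ι b * ι b′ * ∑⊎ U (λ S T → E b S * E b′ T)) ∎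
    where
    ring : ∀ f p e f′ p′ e′ → f * p * e * (f′ * p′ * e′) ≡ f * f′ * (p * p′) * (e * e′)
    ring = solve-∀ ℚ-ring
    ring′ : ∀ b c b′ c′ p x → b * c * (b′ * c′) * p * x ≡ c * c′ * p * (b * b′ * x)
    ring′ = solve-∀ ℚ-ring

  inv-+ : ∀ {a b} → 1 ≤ a → 1 ≤ b → inv a + inv b ≡ ι (a ℕ.+ b) * (inv a * inv b)
  inv-+ {a} {b} ha hb = sym (begin
    ι (a ℕ.+ b) * (inv a * inv b)                   ≡⟨ cong (_* (inv a * inv b)) (ι-+ a b) ⟩
    (ι a + ι b) * (inv a * inv b)                   ≡⟨ ring (ι a) (ι b) (inv a) (inv b) ⟩
    ι b * inv b * inv a + ι a * inv a * inv b       ≡⟨ cong₂ (λ p q → p * inv a + q * inv b) (ι-inv⁺ hb) (ι-inv⁺ ha) ⟩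
    1ℚ * inv a + 1ℚ * inv b                         ≡⟨ cong₂ _+_ (*-identityˡ (inv a)) (*-identityˡ (inv b)) ⟩
    inv a + inv b ∎)
    where
    ring : ∀ a b i j → (a + b) * (i * j) ≡ b * j * i + a * i * j
    ring = solve-∀ ℚ-ring

  -- In `abel-EE` the main term has 1/b + 1/b′ = m/(b b′), which `c-c` sums over b + b′ = m. The
  -- terms with 1/(b + j) and 1/(b′ + j) have equal sums by symmetry and leave twice the convolution
  -- `R m j`.
  ∑⁺-cut : ∀ {m} U → 1 ≤ m →
    ι (m ℕ.+ sum U) * ∑⁺ (λ b b′ → cut b b′ U) m
      ≡ E m U * (ι (m ℕ.+ sum U) * (2ℚ * ((ι m - 1ℚ) * (c m * Φ U))) - ∑∈ U (λ j _ → 2ℚ * (ι j * (ι (m ℕ.+ j) * (R m j * Φ U)))))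
  ∑⁺-cut {m} U h = begin
    ι N * ∑⁺ (λ b b′ → cut b b′ U) m
      ≡⟨ ∑⁺-*ˡ m (ι N) _ ⟩
    ∑⁺ (λ b b′ → ι N * cut b b′ U) m
      ≡⟨ ∑⁺-cong m term ⟩
    ∑⁺ (λ b b′ → K * (ι N * ι m * ι m * Φ U) * (c b * c b′ * (inv b * inv b′)) + (- K) * ∑∈ U (λ j _ → r b b′ j)) m
      ≡⟨ trans (∑⁺-+ m _ _) (cong₂ _+_ (sym (∑⁺-*ˡ m (K * (ι N * ι m * ι m * Φ U)) _))
           (trans (sym (∑⁺-*ˡ m (- K) _)) (cong (- K *_) (∑⁺-∑∈ m U (λ b b′ j _ → r b b′ j))))) ⟩
    K * (ι N * ι m * ι m * Φ U) * ∑⁺ (λ b b′ → c b * c b′ * (inv b * inv b′)) m + (- K) * ∑∈ U (λ j _ → ∑⁺ (λ b b′ → r b b′ j) m)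
      ≡⟨ cong₂ (λ p q → p + (- K) * q)
           (trans (ring₁ K (ι N) (ι m) (Φ U) _) (trans (cong (λ q → K * (ι N * (q * Φ U))) (c-c h)) (ring₂ K (ι N) (ι m - 1ℚ) (c m) (Φ U))))
           (∑∈-cong U (λ j _ → sumR j)) ⟩
    K * (ι N * (2ℚ * ((ι m - 1ℚ) * (c m * Φ U)))) + (- K) * ∑∈ U (λ j _ → 2ℚ * (ι j * (ι (m ℕ.+ j) * (R m j * Φ U))))
      ≡⟨ ring₃ K (ι N * (2ℚ * ((ι m - 1ℚ) * (c m * Φ U)))) _ ⟩
    K * (ι N * (2ℚ * ((ι m - 1ℚ) * (c m * Φ U))) - ∑∈ U (λ j _ → 2ℚ * (ι j * (ι (m ℕ.+ j) * (R m j * Φ U))))) ∎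
    where
    N : ℕ
    N = m ℕ.+ sum U
    K : ℚ
    K = E m U
    r : ℕ → ℕ → ℕ → ℚ
    r b b′ j = ι j * (ι (m ℕ.+ j) * Φ U) * (c b * c b′ * inv (b ℕ.+ j) + c b * c b′ * inv (b′ ℕ.+ j))
    ring₁ : ∀ k n m f s → k * (n * m * m * f) * s ≡ k * (n * (m * (m * s) * f))
    ring₁ = solve-∀ ℚ-ring
    ring₂ : ∀ k n m c f → k * (n * (2ℚ * (m * c) * f)) ≡ k * (n * (2ℚ * (m * (c * f))))
    ring₂ = solve-∀ ℚ-ring
    ring₃ : ∀ k a b → k * a + (- k) * b ≡ k * (a - b)
    ring₃ = solve-∀ ℚ-ring
    ring₄ : ∀ n c c′ p x → n * (c * c′ * p * x) ≡ c * c′ * p * (n * x)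
    ring₄ = solve-∀ ℚ-ring
    ring₅ : ∀ c c′ p k m ij n s → c * c′ * p * (k * ((m * ij) * (m * n) - s)) ≡ k * (n * m * m * p) * (c * c′ * ij) + (- k) * (c * c′ * p * s)
    ring₅ = solve-∀ ℚ-ring
    ring₆ : ∀ c c′ p j m i i′ → c * c′ * p * (j * (m * (i + i′))) ≡ j * (m * p) * (c * c′ * i + c * c′ * i′)
    ring₆ = solve-∀ ℚ-ring
    term : ∀ {b b′} → 1 ≤ b → 1 ≤ b′ → b ℕ.+ b′ ≡ m →
           ι N * cut b b′ U ≡ K * (ι N * ι m * ι m * Φ U) * (c b * c b′ * (inv b * inv b′)) + (- K) * ∑∈ U (λ j _ → r b b′ j)
    term {b} {b′} hb hb′ refl = begin
      ι N * cut b b′ U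
        ≡⟨ cong (ι N *_) (cut-≡ U hb hb′) ⟩
      ι N * (c b * c b′ * Φ U * (ι b * ι b′ * ∑⊎ U (λ S T → E b S * E b′ T)))
        ≡⟨ ring₄ (ι N) (c b) (c b′) (Φ U) _ ⟩
      c b * c b′ * Φ U * (ι N * (ι b * ι b′ * ∑⊎ U (λ S T → E b S * E b′ T)))
        ≡⟨ cong (c b * c b′ * Φ U *_) (abel-EE U hb hb′) ⟩
      c b * c b′ * Φ U * (K * ((inv b + inv b′) * (ι m * ι N) - s))
        ≡⟨ cong (λ q → c b * c b′ * Φ U * (K * (q * (ι m * ι N) - s))) (inv-+ hb hb′) ⟩
      c b * c b′ * Φ U * (K * (ι m * (inv b * inv b′) * (ι m * ι N) - s))
        ≡⟨ ring₅ (c b) (c b′) (Φ U) K (ι m) (inv b * inv b′) (ι N) s ⟩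
      K * (ι N * ι m * ι m * Φ U) * (c b * c b′ * (inv b * inv b′)) + (- K) * (c b * c b′ * Φ U * s)
        ≡⟨ cong (λ q → K * (ι N * ι m * ι m * Φ U) * (c b * c b′ * (inv b * inv b′)) + (- K) * q)
             (trans (∑∈-*ˡ U (c b * c b′ * Φ U) _) (∑∈-cong U (λ j _ → ring₆ (c b) (c b′) (Φ U) (ι j) (ι (m ℕ.+ j)) (inv (b ℕ.+ j)) (inv (b′ ℕ.+ j))))) ⟩
      K * (ι N * ι m * ι m * Φ U) * (c b * c b′ * (inv b * inv b′)) + (- K) * ∑∈ U (λ j _ → r b b′ j) ∎
      where
      s : ℚ
      s = ∑∈ U (λ j _ → ι j * (ι (m ℕ.+ j) * (inv (b ℕ.+ j) + inv (b′ ℕ.+ j))))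
    sumR : ∀ j → ∑⁺ (λ b b′ → r b b′ j) m ≡ 2ℚ * (ι j * (ι (m ℕ.+ j) * (R m j * Φ U)))
    sumR j = begin
      ∑⁺ (λ b b′ → r b b′ j) m
        ≡⟨ ∑⁺-*ˡ m (ι j * (ι (m ℕ.+ j) * Φ U)) _ ⟨
      ι j * (ι (m ℕ.+ j) * Φ U) * ∑⁺ (λ b b′ → c b * c b′ * inv (b ℕ.+ j) + c b * c b′ * inv (b′ ℕ.+ j)) m
        ≡⟨ cong (ι j * (ι (m ℕ.+ j) * Φ U) *_) (trans (∑⁺-+ m _ _) (cong (R m j +_)
             (trans (∑⁺-comm m _) (∑⁺-cong m (λ {b} {b′} _ _ _ → cong (_* inv (b ℕ.+ j)) (*-comm (c b′) (c b))))))) ⟩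
      ι j * (ι (m ℕ.+ j) * Φ U) * (R m j + R m j)
        ≡⟨ ring (ι j) (ι (m ℕ.+ j)) (Φ U) (R m j) ⟩
      2ℚ * (ι j * (ι (m ℕ.+ j) * (R m j * Φ U))) ∎
      where
      ring : ∀ j m p r → j * (m * p) * (r + r) ≡ 2ℚ * (j * (m * (r * p)))
      ring = solve-∀ ℚ-ring

  2ℚ-cancelˡ : ∀ {x y} → 2ℚ * x ≡ 2ℚ * y → x ≡ y
  2ℚ-cancelˡ = cancelˡ-inv 2ℚ ½ refl

  -- Up to a common factor, the main cut terms 2(m - 1) add up to 2(n - l). The remaining cut terms
  -- and the joins are both indexed by ordered pairs of parts and contribute 4(l - 1). The total 2(n
  -- + l - 2) is the number of factors, doubled for the orientation of the first one.
  cut-join : ∀ {a} → Positive⁺ a → 1 ≤ sum a →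
    ∑∈ a (λ m as → ι m * (∑⁺ (λ b b′ → cut b b′ as) m + ∑∈ as (λ d as′ → ι d * G ((m ℕ.+ d) ∷ as′))))
      ≡ 2ℚ * ((ι (sum a) + ι (length a) - 2ℚ) * G a)
  cut-join {a} pos n≥1 = ι-cancelˡ n≥1 (begin
    ι N * ∑∈ a (λ m as → ι m * (∑⁺ (λ b b′ → cut b b′ as) m + ∑∈ as (λ d as′ → ι d * G ((m ℕ.+ d) ∷ as′))))
      ≡⟨ ∑∈-*ˡ a (ι N) _ ⟩
    ∑∈ a (λ m as → ι N * (ι m * (∑⁺ (λ b b′ → cut b b′ as) m + ∑∈ as (λ d as′ → ι d * G ((m ℕ.+ d) ∷ as′)))))
      ≡⟨ ∑∈-cong-Pick a step ⟩
    ∑∈ a (λ m as → 2ℚ * K * (Φ a * ι N) * (ι m - 1ℚ) + K * ∑∈ as (λ d as′ → H m d as′))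
      ≡⟨ trans (∑∈-+ a _ _) (cong₂ _+_ (trans (sym (∑∈-*ˡ a (2ℚ * K * (Φ a * ι N)) _)) (cong (2ℚ * K * (Φ a * ι N) *_) ∑m-1))
           (trans (sym (∑∈-*ˡ a K _)) (cong (K *_) ∑H))) ⟩
    2ℚ * K * (Φ a * ι N) * (ι N - ι l) + K * (2ℚ * (2ℚ * (Φ a * ((ι l - 1ℚ) * ι N))))
      ≡⟨ ring₁ K (Φ a) (ι N) (ι l) ⟩
    ι N * (2ℚ * ((ι N + ι l - 2ℚ) * (Φ a * K)))
      ≡⟨ cong (λ q → ι N * (2ℚ * ((ι N + ι l - 2ℚ) * q))) (G≡ pos n≥1) ⟨
    ι N * (2ℚ * ((ι N + ι l - 2ℚ) * G a)) ∎)
    where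
    N l : ℕ
    N = sum a
    l = length a
    -- This is N^(l-3), the value of `E m as` whichever part m is removed.
    K : ℚ
    K = ι N ^ (l ∸ 1) * (inv N * inv N)
    E≡K : ∀ {m as} → Pick m as a → E m as ≡ K
    E≡K p = cong₂ (λ k n → ι n ^ k * (inv n * inv n)) (sym (cong (_∸ 1) (Pick-length p))) (sym (Pick-sum p))
    G≡ : ∀ {a} → Positive⁺ a → 1 ≤ sum a → G a ≡ Φ a * (ι (sum a) ^ (length a ∸ 1) * (inv (sum a) * inv (sum a)))
    G≡ {b ∷ S} (hb ∷ _) _ = G-∷ S hb
    ring₁ : ∀ k p n l → 2ℚ * k * (p * n) * (n - l) + k * (2ℚ * (2ℚ * (p * ((l - 1ℚ) * n)))) ≡ n * (2ℚ * ((n + l - 2ℚ) * (p * k)))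
    ring₁ = solve-∀ ℚ-ring
    H : ℕ → ℕ → List ℕ → ℚ
    H m d r = ι m * (ι d * (φ (m ℕ.+ d) * Φ r - 2ℚ * (ι (m ℕ.+ d) * (R m d * (φ d * Φ r)))))
    ∑m-1 : ∑∈ a (λ m _ → ι m - 1ℚ) ≡ ι N - ι l
    ∑m-1 = trans (∑∈-+ a (λ m _ → ι m) (λ _ _ → - 1ℚ)) (cong₂ _+_ (∑∈-ι a) (trans (∑∈-const a (- 1ℚ)) (ring (ι l))))
      where
      ring : ∀ l → l * - 1ℚ ≡ - l
      ring = solve-∀ ℚ-ring
    ∑pairs : ∑∈ a (λ m as → ∑∈ as (λ d _ → ι m + ι d)) ≡ 2ℚ * ((ι l - 1ℚ) * ι N)
    ∑pairs = begin
      ∑∈ a (λ m as → ∑∈ as (λ d _ → ι m + ι d))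
        ≡⟨ ∑∈-cong-Pick a (λ {m} {as} p → trans (∑∈-+ as _ _) (trans (cong₂ _+_ (∑∈-const as (ι m)) (∑∈-ι as))
             (trans (cong₂ (λ x y → x * ι m + y) (len p) (tot p)) (ring (ι l) (ι m) (ι N))))) ⟩
      ∑∈ a (λ m as → (ι l - 2ℚ) * ι m + ι N)
        ≡⟨ trans (∑∈-+ a _ _) (cong₂ _+_ (trans (sym (∑∈-*ˡ a (ι l - 2ℚ) _)) (cong ((ι l - 2ℚ) *_) (∑∈-ι a))) (∑∈-const a (ι N))) ⟩
      (ι l - 2ℚ) * ι N + ι l * ι N
        ≡⟨ ring′ (ι l) (ι N) ⟩
      2ℚ * ((ι l - 1ℚ) * ι N) ∎
      where
      ring : ∀ l m n → (l - 1ℚ) * m + (n - m) ≡ (l - 2ℚ) * m + n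
      ring = solve-∀ ℚ-ring
      ring′ : ∀ l n → (l - 2ℚ) * n + l * n ≡ 2ℚ * ((l - 1ℚ) * n)
      ring′ = solve-∀ ℚ-ring
      sub : ∀ x y → y ≡ (x + y) - x
      sub = solve-∀ ℚ-ring
      len : ∀ {m as} → Pick m as a → ι (length as) ≡ ι l - 1ℚ
      len {m} {as} p = trans (sub 1ℚ (ι (length as))) (cong (_- 1ℚ) (trans (sym (ι-suc (length as))) (cong ι (sym (Pick-length p)))))
      tot : ∀ {m as} → Pick m as a → ι (sum as) ≡ ι N - ι m
      tot {m} {as} p = trans (sub (ι m) (ι (sum as))) (cong (_- ι m) (trans (sym (ι-+ m (sum as))) (cong ι (sym (Pick-sum p)))))
    -- Only the symmetric sum simplifies: `c-R` expands the join factor `c (m ℕ.+ d)`, and its two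
    -- convolutions cancel the `R` terms left by the cuts of m and of d.
    H-sym : ∀ {m d as r} → Pick m as a → Pick d r as → H m d r + H d m r ≡ 2ℚ * (2ℚ * Φ a) * (ι m + ι d)
    H-sym {m} {d} {as} {r} p q = begin
      H m d r + H d m r
        ≡⟨ cong (λ k → H m d r + ι d * (ι m * (φ k * Φ r - 2ℚ * (ι k * (R d m * (φ m * Φ r)))))) (ℕₚ.+-comm d m) ⟩
      H m d r + ι d * (ι m * (φ (m ℕ.+ d) * Φ r - 2ℚ * (ι (m ℕ.+ d) * (R d m * (φ m * Φ r)))))
        ≡⟨ cong (λ k → ι m * (ι d * (ι (m ℕ.+ d) * k * Φ r - 2ℚ * (ι (m ℕ.+ d) * (R m d * (φ d * Φ r)))))
                     + ι d * (ι m * (ι (m ℕ.+ d) * k * Φ r - 2ℚ * (ι (m ℕ.+ d) * (R d m * (φ m * Φ r)))))) (c-R hm hd) ⟩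
      _
        ≡⟨ ring (ι m) (ι d) (ι (m ℕ.+ d)) (c m) (c d) (R m d) (R d m) (Φ r) ⟩
      2ℚ * (2ℚ * (φ m * (φ d * Φ r))) * ι (m ℕ.+ d)
        ≡⟨ cong₂ (λ x y → 2ℚ * (2ℚ * x) * y) (sym (trans (Φ-Pick p) (cong (φ m *_) (Φ-Pick q)))) (ι-+ m d) ⟩
      2ℚ * (2ℚ * Φ a) * (ι m + ι d) ∎
      where
      hm : 1 ≤ m
      hm = proj₁ (Pick-All p pos)
      hd : 1 ≤ d
      hd = proj₁ (Pick-All q (proj₂ (Pick-All p pos)))
      ring : ∀ m d s x y r r′ p →
        m * (d * (s * (2ℚ * (x * y) + (d * (y * r) + m * (x * r′))) * p - 2ℚ * (s * (r * (d * y * p)))))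
        + d * (m * (s * (2ℚ * (x * y) + (d * (y * r) + m * (x * r′))) * p - 2ℚ * (s * (r′ * (m * x * p)))))
        ≡ 2ℚ * (2ℚ * (m * x * (d * y * p))) * s
      ring = solve-∀ ℚ-ring
    ∑H : ∑∈ a (λ m as → ∑∈ as (λ d r → H m d r)) ≡ 2ℚ * (2ℚ * (Φ a * ((ι l - 1ℚ) * ι N)))
    ∑H = 2ℚ-cancelˡ (begin
      2ℚ * X
        ≡⟨ ring X ⟩
      X + X
        ≡⟨ cong (X +_) (∑∈-∑∈-comm a H) ⟩
      X + ∑∈ a (λ m as → ∑∈ as (λ d r → H d m r))
        ≡⟨ trans (sym (∑∈-+ a _ _)) (∑∈-cong-Pick a (λ {m} {as} p → trans (sym (∑∈-+ as _ _))
             (trans (∑∈-cong-Pick as (λ q → H-sym p q)) (sym (∑∈-*ˡ as (2ℚ * (2ℚ * Φ a)) _))))) ⟩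
      ∑∈ a (λ m as → 2ℚ * (2ℚ * Φ a) * ∑∈ as (λ d _ → ι m + ι d))
        ≡⟨ trans (sym (∑∈-*ˡ a (2ℚ * (2ℚ * Φ a)) _)) (cong (2ℚ * (2ℚ * Φ a) *_) ∑pairs) ⟩
      2ℚ * (2ℚ * Φ a) * (2ℚ * ((ι l - 1ℚ) * ι N))
        ≡⟨ ring′ (Φ a) ((ι l - 1ℚ) * ι N) ⟩
      2ℚ * (2ℚ * (2ℚ * (Φ a * ((ι l - 1ℚ) * ι N)))) ∎)
      where
      X : ℚ
      X = ∑∈ a (λ m as → ∑∈ as (λ d r → H m d r))
      ring : ∀ x → 2ℚ * x ≡ x + x
      ring = solve-∀ ℚ-ring
      ring′ : ∀ p x → 2ℚ * (2ℚ * p) * (2ℚ * x) ≡ 2ℚ * (2ℚ * (2ℚ * (p * x)))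
      ring′ = solve-∀ ℚ-ring
    step : ∀ {m as} → Pick m as a →
           ι N * (ι m * (∑⁺ (λ b b′ → cut b b′ as) m + ∑∈ as (λ d as′ → ι d * G ((m ℕ.+ d) ∷ as′))))
           ≡ 2ℚ * K * (Φ a * ι N) * (ι m - 1ℚ) + K * ∑∈ as (λ d as′ → H m d as′)
    step {m} {as} p = begin
      ι N * (ι m * (∑⁺ (λ b b′ → cut b b′ as) m + ∑∈ as (λ d as′ → ι d * G ((m ℕ.+ d) ∷ as′))))
        ≡⟨ ring₂ (ι N) (ι m) _ _ ⟩
      ι m * (ι N * ∑⁺ (λ b b′ → cut b b′ as) m) + ι m * (ι N * ∑∈ as (λ d as′ → ι d * G ((m ℕ.+ d) ∷ as′)))
        ≡⟨ cong₂ (λ x y → ι m * x + ι m * y) cuts joins ⟩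
      ι m * (K * (ι N * (2ℚ * ((ι m - 1ℚ) * (c m * Φ as))) - ∑r)) + ι m * (K * ∑j)
        ≡⟨ ring₃ (ι m) K (ι N) (c m) (Φ as) ∑r ∑j ⟩
      2ℚ * K * (φ m * Φ as * ι N) * (ι m - 1ℚ) + K * (ι m * (∑j + - 1ℚ * ∑r))
        ≡⟨ cong₂ (λ x y → 2ℚ * K * (x * ι N) * (ι m - 1ℚ) + K * y) (sym (Φ-Pick p))
             (trans (cong (ι m *_) (trans (cong (∑j +_) (∑∈-*ˡ as (- 1ℚ) _)) (sym (∑∈-+ as _ _)))) (trans (∑∈-*ˡ as (ι m) _)
               (∑∈-cong-Pick as (λ {d} {r} q → trans (cong (λ x → ι m * (ι d * (φ (m ℕ.+ d) * Φ r) + - 1ℚ * (2ℚ * (ι d * (ι (m ℕ.+ d) * (R m d * x)))))) (Φ-Pick q))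
                   (ring₄ (ι m) (ι d) (φ (m ℕ.+ d)) (Φ r) (ι (m ℕ.+ d)) (R m d) (φ d)))))) ⟩
      2ℚ * K * (Φ a * ι N) * (ι m - 1ℚ) + K * ∑∈ as (λ d as′ → H m d as′) ∎
      where
      ∑r ∑j : ℚ
      ∑r = ∑∈ as (λ j _ → 2ℚ * (ι j * (ι (m ℕ.+ j) * (R m j * Φ as))))
      ∑j = ∑∈ as (λ d r → ι d * (φ (m ℕ.+ d) * Φ r))
      ring₂ : ∀ n m x y → n * (m * (x + y)) ≡ m * (n * x) + m * (n * y)
      ring₂ = solve-∀ ℚ-ring
      ring₃ : ∀ m k n c f r j → m * (k * (n * (2ℚ * ((m - 1ℚ) * (c * f))) - r)) + m * (k * j)
                                ≡ 2ℚ * k * (m * c * f * n) * (m - 1ℚ) + k * (m * (j + - 1ℚ * r))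
      ring₃ = solve-∀ ℚ-ring
      ring₄ : ∀ m d f p s r g → m * (d * (f * p) + - 1ℚ * (2ℚ * (d * (s * (r * (g * p)))))) ≡ m * (d * (f * p - 2ℚ * (s * (r * (g * p)))))
      ring₄ = solve-∀ ℚ-ring
      cuts : ι N * ∑⁺ (λ b b′ → cut b b′ as) m ≡ K * (ι N * (2ℚ * ((ι m - 1ℚ) * (c m * Φ as))) - ∑r)
      cuts = trans (cong (λ n → ι n * ∑⁺ (λ b b′ → cut b b′ as) m) (Pick-sum p)) (trans (∑⁺-cut as (proj₁ (Pick-All p pos)))
               (cong₂ (λ k n → k * (ι n * (2ℚ * ((ι m - 1ℚ) * (c m * Φ as))) - ∑r)) (E≡K p) (sym (Pick-sum p))))
      joins : ι N * ∑∈ as (λ d as′ → ι d * G ((m ℕ.+ d) ∷ as′)) ≡ K * ∑j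
      joins = trans (∑∈-*ˡ as (ι N) _) (trans (∑∈-cong-Pick as joined) (sym (∑∈-*ˡ as K _)))
        where
        ring₅ : ∀ n d f p e i → n * (d * (f * p * (e * i))) ≡ n * i * (e * (d * (f * p)))
        ring₅ = solve-∀ ℚ-ring
        joined : ∀ {d r} → Pick d r as → ι N * (ι d * G ((m ℕ.+ d) ∷ r)) ≡ K * (ι d * (φ (m ℕ.+ d) * Φ r))
        joined {d} {r} q = begin
          ι N * (ι d * G ((m ℕ.+ d) ∷ r))
            ≡⟨ cong (λ x → ι N * (ι d * x)) (trans (G-∷ r md≥1) (cong (φ (m ℕ.+ d) * Φ r *_) E≡)) ⟩
          ι N * (ι d * (φ (m ℕ.+ d) * Φ r * (K * inv N)))
            ≡⟨ ring₅ (ι N) (ι d) (φ (m ℕ.+ d)) (Φ r) K (inv N) ⟩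
          ι N * inv N * (K * (ι d * (φ (m ℕ.+ d) * Φ r)))
            ≡⟨ trans (cong (_* (K * (ι d * (φ (m ℕ.+ d) * Φ r)))) (ι-inv⁺ n≥1)) (*-identityˡ _) ⟩
          K * (ι d * (φ (m ℕ.+ d) * Φ r)) ∎
          where
          md≥1 : 1 ≤ m ℕ.+ d
          md≥1 = ℕₚ.≤-trans (proj₁ (Pick-All p pos)) (ℕₚ.m≤m+n m d)
          ring₆ : ∀ p i → p * i * (i * i) ≡ p * (i * i) * i
          ring₆ = solve-∀ ℚ-ring
          tot : m ℕ.+ d ℕ.+ sum r ≡ m ℕ.+ sum as
          tot = Pick-total {m} q
          E≡ : E (m ℕ.+ d) r ≡ K * inv N
          E≡ = begin
            P (m ℕ.+ d) r * (inv (m ℕ.+ d ℕ.+ sum r) * inv (m ℕ.+ d ℕ.+ sum r))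
              ≡⟨ cong₂ (λ x n → x * (inv n * inv n)) (P-Pick {m} md≥1 q) tot ⟩
            P m as * inv (m ℕ.+ sum as) * (inv (m ℕ.+ sum as) * inv (m ℕ.+ sum as))
              ≡⟨ ring₆ (P m as) (inv (m ℕ.+ sum as)) ⟩
            E m as * inv (m ℕ.+ sum as)
              ≡⟨ cong₂ (λ x n → x * inv n) (E≡K p) (sym (Pick-sum p)) ⟩
            K * inv N ∎

-- Counting by enumeration, by fibres and by shuffles

module Counting where
  open Rationals
  open Sums

  private variable
    A B I : Set

  Unique-resp-↭ : {xs ys : List A} → xs ↭ ys → Unique xs → Unique ys
  Unique-resp-↭ Perm.refl           u                  = u
  Unique-resp-↭ (prep x p)     (a ∷ u)            = All-resp-↭ p a ∷ Unique-resp-↭ p u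
  Unique-resp-↭ (Perm.swap x y p)   ((xy ∷ a) ∷ b ∷ u) =
    ((λ e → xy (sym e)) ∷ All-resp-↭ p b) ∷ All-resp-↭ p a ∷ Unique-resp-↭ p u
  Unique-resp-↭ (Perm.trans p q)    u                  = Unique-resp-↭ q (Unique-resp-↭ p u)

  Unique-++⁻ : ∀ (xs : List A) {ys} → Unique (xs ++ ys) →
               Unique xs × Unique ys × (∀ {v} → v ∈ xs → v ∈ ys → ⊥)
  Unique-++⁻ []       u       = [] , u , λ ()
  Unique-++⁻ (x ∷ xs) (a ∷ u) =
    let (u₁ , u₂ , d) = Unique-++⁻ xs u
    in Allₚ.++⁻ˡ xs a ∷ u₁ , u₂ , λ { (here refl) q → All.lookup (Allₚ.++⁻ʳ xs a) q refl ; (there p) q → d p q }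

  Unique-∉ : {x : A} {xs : List A} → Unique (x ∷ xs) → x ∉ xs
  Unique-∉ (a ∷ _) p = All.lookup a p refl

  Unique-⊆-length : ∀ {xs ys : List A} → Unique xs → (∀ {v} → v ∈ xs → v ∈ ys) → length xs ≤ length ys
  Unique-⊆-length [] h = z≤n
  Unique-⊆-length {xs = x ∷ xs} (a ∷ u) h with ∈-∃++ (h (here refl))
  ... | zs₁ , zs₂ , refl = subst (suc (length xs) ≤_) (sym len) (s≤s (Unique-⊆-length u sub))
    where
    len : length (zs₁ ++ x ∷ zs₂) ≡ suc (length (zs₁ ++ zs₂))
    len = trans (length-++ zs₁) (trans (ℕₚ.+-suc (length zs₁) (length zs₂)) (cong suc (sym (length-++ zs₁))))
    sub : ∀ {v} → v ∈ xs → v ∈ zs₁ ++ zs₂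
    sub {v} p with ∈-++⁻ zs₁ (h (there p))
    ... | inj₁ q           = ∈-++⁺ˡ q
    ... | inj₂ (here refl) = ⊥-elim (All.lookup a p refl)
    ... | inj₂ (there q)   = ∈-++⁺ʳ zs₁ q

  -- A finite set is given by an enumeration without repetition. Its size is a rational because it
  -- is compared with formulas that contain denominators.
  record Count {B : Set} (P : B → Set) (q : ℚ) : Set where
    constructor count
    field
      list     : List B
      unique   : Unique list
      sound    : ∀ {x} → x ∈ list → P x
      complete : ∀ {x} → P x → x ∈ list
      size     : ι (length list) ≡ q
  open Count

  count-∅ : ∀ {P : B → Set} → (∀ {x} → ¬ P x) → Count P 0ℚ
  count-∅ h = count [] [] (λ ()) (⊥-elim ∘ h) ι-0

  count-≡ : ∀ {P : B → Set} {p q} → p ≡ q → Count P p → Count P q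
  count-≡ e c = count (list c) (unique c) (sound c) (complete c) (trans (size c) e)

  module _ {B : Set} {P Q : B → Set} where

    count-unique : ∀ {p q} → Count P p → Count P q → p ≡ q
    count-unique c d = trans (sym (size c)) (trans (cong ι (ℕₚ.≤-antisym
      (Unique-⊆-length (unique c) (complete d ∘ sound c)) (Unique-⊆-length (unique d) (complete c ∘ sound d)))) (size d))

    count-⇔ : ∀ {q} → (∀ {x} → P x → Q x) → (∀ {x} → Q x → P x) → Count P q → Count Q q
    count-⇔ f g c = count (list c) (unique c) (f ∘ sound c) (complete c ∘ g) (size c)

    count-⊎ : ∀ {p q} → Count P p → Count Q q → (∀ {x} → P x → Q x → ⊥) → Count (λ x → P x ⊎ Q x) (p + q)
    count-⊎ c d disjoint = count (list c ++ list d)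
      (Uniqueₚ.++⁺ (unique c) (unique d) (λ (p , q) → disjoint (sound c p) (sound d q)))
      sound′
      (λ { (inj₁ p) → ∈-++⁺ˡ (complete c p) ; (inj₂ q) → ∈-++⁺ʳ (list c) (complete d q) })
      (trans (cong ι (length-++ (list c))) (trans (ι-+ (length (list c)) _) (cong₂ _+_ (size c) (size d))))
      where
      sound′ : ∀ {x} → x ∈ list c ++ list d → P x ⊎ Q x
      sound′ p with ∈-++⁻ (list c) p
      ... | inj₁ q = inj₁ (sound c q)
      ... | inj₂ q = inj₂ (sound d q)

  count-singleton : (b : B) → Count (_≡ b) 1ℚ
  count-singleton b = count (b ∷ []) ([] ∷ []) (λ { (here e) → e }) here ι-1

  count-image : ∀ {P : A → Set} {q} (f : A → B) → (∀ {x y} → f x ≡ f y → x ≡ y) →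
                Count P q → Count (λ y → ∃ λ x → P x × y ≡ f x) q
  count-image f inj c = count (map f (list c)) (Uniqueₚ.map⁺ inj (unique c))
    (λ p → let (x , q , e) = ∈-map⁻ f p in x , sound c q , e)
    (λ { (x , p , refl) → ∈-map⁺ f (complete c p) })
    (trans (cong ι (length-map f (list c))) (size c))

  -- The indices may carry more data than their keys, such as a point together with its cycle; the
  -- fibre sizes depend on the index, while distinctness concerns the keys alone.
  count-classes : ∀ {K : Set} {P : B → Set} (cls : B → K) (is : List I) (key : I → K) (q : I → ℚ) →
    Unique (map key is) → (∀ {i} → i ∈ is → Count (λ b → P b × cls b ≡ key i) (q i)) →
    Count (λ b → P b × cls b ∈ map key is) (∑ is q)
  count-classes cls [] key q u h = count-∅ λ { (_ , ()) }
  count-classes cls (i ∷ is) key q (a ∷ u) h = count-⇔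
    (λ { (inj₁ (p , e)) → p , here e ; (inj₂ (p , e)) → p , there e })
    (λ { (p , here e) → inj₁ (p , e) ; (p , there e) → inj₂ (p , e) })
    (count-⊎ (h (here refl)) (count-classes cls is key q u (h ∘ there))
      (λ { (_ , e) (_ , m) → All.lookup a m (sym e) }))

  classify : ∀ {K : Set} {P : B → Set} (cls : B → K) (is : List I) (key : I → K) (q : I → ℚ) →
    Unique (map key is) → (∀ {b} → P b → cls b ∈ map key is) →
    (∀ {i} → i ∈ is → Count (λ b → P b × cls b ≡ key i) (q i)) → Count P (∑ is q)
  classify cls is key q u total h = count-⇔ proj₁ (λ p → p , total p) (count-classes cls is key q u h)

  -- The binomial coefficient (a + b choose a) by Pascal's rule, which matches the recursion on the
  -- first letter of a shuffle.
  shuffles : ℕ → ℕ → ℚ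
  shuffles zero    b       = 1ℚ
  shuffles (suc a) zero    = 1ℚ
  shuffles (suc a) (suc b) = shuffles a (suc b) + shuffles (suc a) b

  shuffles-! : ∀ a b → shuffles a b * (ι (a !) * ι (b !)) ≡ ι ((a ℕ.+ b) !)
  shuffles-! zero    b       = trans (cong (λ q → 1ℚ * (q * ι (b !))) ι-1) (lem (ι (b !)))
    where
    lem : ∀ x → 1ℚ * (1ℚ * x) ≡ x
    lem = solve-∀ ℚ-ring
  shuffles-! (suc a) zero    = trans (cong (λ q → 1ℚ * (ι (suc a !) * q)) ι-1)
    (trans (lem (ι (suc a !))) (cong (λ k → ι (k !)) (sym (ℕₚ.+-identityʳ (suc a)))))
    where
    lem : ∀ x → 1ℚ * (x * 1ℚ) ≡ x
    lem = solve-∀ ℚ-ring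
  shuffles-! (suc a) (suc b) = begin
    (x + y) * (ι (suc a ℕ.* a !) * ι (suc b ℕ.* b !))
      ≡⟨ cong₂ (λ p q → (x + y) * (p * q)) (ι-* (suc a) (a !)) (ι-* (suc b) (b !)) ⟩
    (x + y) * ((ι (suc a) * ι (a !)) * (ι (suc b) * ι (b !)))
      ≡⟨ ring x y (ι (suc a)) (ι (a !)) (ι (suc b)) (ι (b !)) ⟩
    ι (suc a) * (x * (ι (a !) * (ι (suc b) * ι (b !)))) + ι (suc b) * (y * ((ι (suc a) * ι (a !)) * ι (b !)))
      ≡⟨ cong₂ (λ p q → ι (suc a) * (x * (ι (a !) * p)) + ι (suc b) * (y * (q * ι (b !)))) (sym (ι-* (suc b) (b !))) (sym (ι-* (suc a) (a !))) ⟩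
    ι (suc a) * (x * (ι (a !) * ι (suc b !))) + ι (suc b) * (y * (ι (suc a !) * ι (b !)))
      ≡⟨ cong₂ (λ p q → ι (suc a) * p + ι (suc b) * q)
           (trans (shuffles-! a (suc b)) (cong (λ k → ι (k !)) (ℕₚ.+-suc a b))) (shuffles-! (suc a) b) ⟩
    ι (suc a) * ι (suc (a ℕ.+ b) !) + ι (suc b) * ι (suc (a ℕ.+ b) !)
      ≡⟨ *-distribʳ-+ (ι (suc (a ℕ.+ b) !)) (ι (suc a)) (ι (suc b)) ⟨
    (ι (suc a) + ι (suc b)) * ι (suc (a ℕ.+ b) !)
      ≡⟨ cong (_* ι (suc (a ℕ.+ b) !)) (trans (sym (ι-+ (suc a) (suc b))) (cong (λ k → ι (suc k)) (ℕₚ.+-suc a b))) ⟩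
    ι (suc (suc (a ℕ.+ b))) * ι (suc (a ℕ.+ b) !)
      ≡⟨ ι-* (suc (suc (a ℕ.+ b))) (suc (a ℕ.+ b) !) ⟨
    ι (suc (suc (a ℕ.+ b)) !)
      ≡⟨ cong (λ k → ι (suc k !)) (ℕₚ.+-suc a b) ⟨
    ι ((suc a ℕ.+ suc b) !) ∎
    where
    open ≡-Reasoning
    x y : ℚ
    x = shuffles a (suc b)
    y = shuffles (suc a) b
    ring : ∀ x y s a t b → (x + y) * ((s * a) * (t * b)) ≡ s * (x * (a * (t * b))) + t * (y * ((s * a) * b))
    ring = solve-∀ ℚ-ring

  module _ {B : Set} (p : B → Bool) where

    Shuffle : List B → List B → List B → Set
    Shuffle s t u = filterᵇ p u ≡ s × filterᵇ (not ∘ p) u ≡ t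

    -- As p holds throughout s and fails throughout t, it tells for the first letter which list it
    -- comes from; the two possibilities exclude each other.
    count-shuffles : ∀ {s t} → All (λ x → p x ≡ true) s → All (λ x → p x ≡ false) t →
                     Count (Shuffle s t) (shuffles (length s) (length t))
    count-shuffles {[]} {t} [] h = count-⇔ (λ { refl → only h }) (λ (e , e′) → inverse e e′) (count-singleton t)
      where
      only : ∀ {t} → All (λ x → p x ≡ false) t → filterᵇ p t ≡ [] × filterᵇ (not ∘ p) t ≡ t
      only [] = refl , refl
      only {x ∷ t} (e ∷ h) rewrite e = proj₁ (only h) , cong (x ∷_) (proj₂ (only h))
      inverse : ∀ {u t} → filterᵇ p u ≡ [] → filterᵇ (not ∘ p) u ≡ t → u ≡ t
      inverse {[]}    e e′ = e′
      inverse {x ∷ u} e e′ with p x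
      inverse {x ∷ u} () e′   | true
      inverse {x ∷ u} e  refl | false = cong (x ∷_) (inverse e refl)
    count-shuffles {s@(_ ∷ _)} {[]} h [] = count-⇔ (λ { refl → only h }) (λ (e , e′) → inverse e e′) (count-singleton s)
      where
      only : ∀ {t} → All (λ x → p x ≡ true) t → filterᵇ p t ≡ t × filterᵇ (not ∘ p) t ≡ []
      only [] = refl , refl
      only {x ∷ t} (e ∷ h) rewrite e = cong (x ∷_) (proj₁ (only h)) , proj₂ (only h)
      inverse : ∀ {u s} → filterᵇ p u ≡ s → filterᵇ (not ∘ p) u ≡ [] → u ≡ s
      inverse {[]}    e e′ = e
      inverse {x ∷ u} e e′ with p x
      inverse {x ∷ u} e    () | false
      inverse {x ∷ u} refl e′ | true = cong (x ∷_) (inverse refl e′)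
    count-shuffles {a ∷ s} {b ∷ t} (e ∷ h) (e′ ∷ h′) = count-⇔ to from
      (count-⊎ (count-image (a ∷_) (λ { refl → refl }) (count-shuffles h (e′ ∷ h′)))
               (count-image (b ∷_) (λ { refl → refl }) (count-shuffles (e ∷ h) h′))
               (λ { (_ , _ , refl) (_ , _ , refl) → true≢false (trans (sym e) e′) }))
      where
      true≢false : true ≡ false → ⊥
      true≢false ()
      to : ∀ {u} → (∃ λ v → Shuffle s (b ∷ t) v × u ≡ a ∷ v) ⊎ (∃ λ v → Shuffle (a ∷ s) t v × u ≡ b ∷ v) → Shuffle (a ∷ s) (b ∷ t) u
      to (inj₁ (v , (q , r) , refl)) rewrite e  = cong (a ∷_) q , r
      to (inj₂ (v , (q , r) , refl)) rewrite e′ = q , cong (b ∷_) r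
      from : ∀ {u} → Shuffle (a ∷ s) (b ∷ t) u → (∃ λ v → Shuffle s (b ∷ t) v × u ≡ a ∷ v) ⊎ (∃ λ v → Shuffle (a ∷ s) t v × u ≡ b ∷ v)
      from {[]}    (() , _)
      from {x ∷ u} (q , r) with p x
      from {x ∷ u} (refl , r) | true  = inj₁ (u , (refl , r) , refl)
      from {x ∷ u} (q , refl) | false = inj₂ (u , (q , refl) , refl)

-- Graphs of transpositions, factorizations, and the cutting and joining of cycles

module Factorizations where
  open import Data.Nat using (_≟_)
  open import Defs using (swap; prodT)
  open Sums using (Pick; here; there)
  open Counting using (Unique-resp-↭; Unique-++⁻; Unique-∉)

  ≡ᵇ-refl : ∀ x → (x ≡ᵇ x) ≡ true
  ≡ᵇ-refl zero    = refl
  ≡ᵇ-refl (suc x) = ≡ᵇ-refl x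

  ≢⇒≡ᵇ-false : ∀ {x y} → x ≢ y → (x ≡ᵇ y) ≡ false
  ≢⇒≡ᵇ-false {x} {y} h with x ≡ᵇ y in e
  ... | true  = contradiction (ℕₚ.≡ᵇ⇒≡ x y (subst T (sym e) _)) h
  ... | false = refl

  swap-≡ˡ : ∀ i j → swap (i , j) i ≡ j
  swap-≡ˡ i j rewrite ≡ᵇ-refl i = refl

  swap-≡ʳ : ∀ i j → swap (i , j) j ≡ i
  swap-≡ʳ i j with j ≟ i
  ... | yes refl rewrite ≡ᵇ-refl i = refl
  ... | no  j≢i rewrite ≢⇒≡ᵇ-false j≢i | ≡ᵇ-refl j = refl

  swap-≢ : ∀ {i j x} → x ≢ i → x ≢ j → swap (i , j) x ≡ x
  swap-≢ x≢i x≢j rewrite ≢⇒≡ᵇ-false x≢i | ≢⇒≡ᵇ-false x≢j = refl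

  swap-elim : ∀ (P : ℕ → ℕ → Set) {i j} → P i j → P j i → (∀ {x} → x ≢ i → x ≢ j → P x x) → ∀ x → P x (swap (i , j) x)
  swap-elim P {i} {j} p q r x with x ≟ i
  ... | yes refl = subst (P x) (sym (swap-≡ˡ i j)) p
  ... | no x≢i with x ≟ j
  ...   | yes refl = subst (P x) (sym (swap-≡ʳ i j)) q
  ...   | no x≢j   = subst (P x) (sym (swap-≢ x≢i x≢j)) (r x≢i x≢j)

  swap-involutive : ∀ i j x → swap (i , j) (swap (i , j) x) ≡ x
  swap-involutive i j = swap-elim (λ x y → swap (i , j) y ≡ x) (swap-≡ʳ i j) (swap-≡ˡ i j) swap-≢

  swap-reverse : ∀ i j x → swap (i , j) x ≡ swap (j , i) x
  swap-reverse i j = swap-elim (λ x y → y ≡ swap (j , i) x) (sym (swap-≡ʳ j i)) (sym (swap-≡ˡ j i))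
                       (λ x≢i x≢j → sym (swap-≢ x≢j x≢i))

  merge : ℕ → ℕ → ℕ → ℕ
  merge a b v = if v ≡ᵇ a then b else v

  merge-≡ : ∀ a b → merge a b a ≡ b
  merge-≡ a b rewrite ≡ᵇ-refl a = refl

  merge-≢ : ∀ {a v} b → v ≢ a → merge a b v ≡ v
  merge-≢ b h rewrite ≢⇒≡ᵇ-false h = refl

  merge-target : ∀ a b → merge a b b ≡ b
  merge-target a b with b ≟ a
  ... | yes refl = merge-≡ a a
  ... | no b≢a   = merge-≢ b b≢a

  merge-same : ∀ a v → merge a a v ≡ v
  merge-same a v with v ≟ a
  ... | yes refl = merge-≡ a a
  ... | no v≢a   = merge-≢ a v≢a

  -- A canonical representative of the connected component of v in the graph
  -- whose edges are the given transpositions.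
  rep : List (ℕ × ℕ) → ℕ → ℕ
  rep []             v = v
  rep ((i , j) ∷ ts) v = merge (rep ts i) (rep ts j) (rep ts v)

  Invariant : (ℕ → ℕ) → List (ℕ × ℕ) → Set
  Invariant f = All (λ τ → f (proj₁ τ) ≡ f (proj₂ τ))

  rep-Invariant : ∀ ts → Invariant (rep ts) ts
  rep-Invariant []             = []
  rep-Invariant ((i , j) ∷ ts) = trans (merge-≡ (rep ts i) (rep ts j)) (sym (merge-target (rep ts i) (rep ts j)))
                                 ∷ All.map (cong (merge (rep ts i) (rep ts j))) (rep-Invariant ts)

  -- Each merge identifies two representatives on which f already agrees, so any function constant
  -- along the edges is constant on components. Arguments about paths thus become arguments about
  -- such functions.
  Invariant-rep : ∀ {f ts} → Invariant f ts → ∀ v → f (rep ts v) ≡ f v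
  Invariant-rep []                        v = refl
  Invariant-rep {f} {(i , j) ∷ ts} (e ∷ h) v with rep ts v ≟ rep ts i
  ... | yes p = begin
    f (merge (rep ts i) (rep ts j) (rep ts v)) ≡⟨ cong (f ∘ merge (rep ts i) (rep ts j)) p ⟩
    f (merge (rep ts i) (rep ts j) (rep ts i)) ≡⟨ cong f (merge-≡ (rep ts i) (rep ts j)) ⟩
    f (rep ts j)                               ≡⟨ Invariant-rep h j ⟩
    f j                                        ≡⟨ e ⟨
    f i                                        ≡⟨ Invariant-rep h i ⟨
    f (rep ts i)                               ≡⟨ cong f p ⟨
    f (rep ts v)                               ≡⟨ Invariant-rep h v ⟩
    f v ∎
    where open ≡-Reasoning
  ... | no ¬p = trans (cong f (merge-≢ (rep ts j) ¬p)) (Invariant-rep h v)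

  Invariant-swap : ∀ {f : ℕ → ℕ} {i j} → f i ≡ f j → ∀ x → f (swap (i , j) x) ≡ f x
  Invariant-swap {f} e = swap-elim (λ x y → f y ≡ f x) (sym e) e (λ _ _ → refl)

  Invariant-prodT : ∀ {f ts} → Invariant f ts → ∀ x → f (prodT ts x) ≡ f x
  Invariant-prodT []                       x = refl
  Invariant-prodT {f} {_ ∷ ts} (e ∷ h) x = trans (Invariant-swap {f} e (prodT ts x)) (Invariant-prodT h x)

  Conn : List ℕ → List (ℕ × ℕ) → Set
  Conn V ts = ∀ {u v} → u ∈ V → v ∈ V → rep ts u ≡ rep ts v

  Sep : List ℕ → ℕ → ℕ → List (ℕ × ℕ) → Set
  Sep V x y ts = rep ts x ≢ rep ts y × (∀ {v} → v ∈ V → rep ts v ≡ rep ts x ⊎ rep ts v ≡ rep ts y)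

  Conn-∷ : ∀ {V τ ts} → Conn V ts → Conn V (τ ∷ ts)
  Conn-∷ {τ = i , j} {ts} h u v = cong (merge (rep ts i) (rep ts j)) (h u v)

  Sep-∷ : ∀ {V x y ts} → Sep V x y ts → Conn V ((x , y) ∷ ts)
  Sep-∷ {V} {x} {y} {ts} (_ , h) u v = trans (value u) (sym (value v))
    where
    value : ∀ {u} → u ∈ V → merge (rep ts x) (rep ts y) (rep ts u) ≡ rep ts y
    value u with h u
    ... | inj₁ e = trans (cong (merge (rep ts x) (rep ts y)) e) (merge-≡ (rep ts x) (rep ts y))
    ... | inj₂ e = trans (cong (merge (rep ts x) (rep ts y)) e) (merge-target (rep ts x) (rep ts y))

  -- The added edge merges at most the components of x and y. If these were already equal, nothing
  -- changes; otherwise they are the only two components meeting V.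
  Conn-∷⁻ : ∀ {V x y ts} → y ∈ V → Conn V ((x , y) ∷ ts) → Conn V ts ⊎ Sep V x y ts
  Conn-∷⁻ {V} {x} {y} {ts} y∈ h with rep ts x ≟ rep ts y
  ... | yes e = inj₁ λ {u} {v} p q → trans (sym (same u)) (trans (h p q) (same v))
    where
    same : ∀ v → merge (rep ts x) (rep ts y) (rep ts v) ≡ rep ts v
    same v = trans (cong (λ b → merge (rep ts x) b (rep ts v)) (sym e)) (merge-same (rep ts x) (rep ts v))
  ... | no ne = inj₂ (ne , λ {v} p → cases v p)
    where
    cases : ∀ v → v ∈ V → rep ts v ≡ rep ts x ⊎ rep ts v ≡ rep ts y
    cases v p with rep ts v ≟ rep ts x
    ... | yes e = inj₁ e
    ... | no ¬e = inj₂ (trans (sym (merge-≢ (rep ts y) ¬e)) (trans (h p y∈) (merge-target (rep ts x) (rep ts y))))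

  Valid : List ℕ → ℕ × ℕ → Set
  Valid V (i , j) = i ∈ V × j ∈ V × i ≢ j

  record Pre (r : ℕ) (π : ℕ → ℕ) (V : List ℕ) (ts : List (ℕ × ℕ)) : Set where
    constructor pre
    field
      len   : length ts ≡ r
      valid : All (Valid V) ts
      prod  : ∀ {v} → v ∈ V → prodT ts v ≡ π v
  open Pre public

  -- Transitive factorizations of π on V into r transpositions, each of which is
  -- given with an orientation: (i , j) and (j , i) are counted separately.
  Fact : ℕ → (ℕ → ℕ) → List ℕ → List (ℕ × ℕ) → Set
  Fact r π V ts = Pre r π V ts × Conn V ts

  module _ {V W : List ℕ} (p : V ↭ W) where

    Valid-resp-↭ : ∀ {τ} → Valid V τ → Valid W τ
    Valid-resp-↭ (i , j , ne) = ∈-resp-↭ p i , ∈-resp-↭ p j , ne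

    Pre-resp-↭ : ∀ {r π ts} → Pre r π V ts → Pre r π W ts
    Pre-resp-↭ h = pre (len h) (All.map (λ {τ} → Valid-resp-↭ {τ}) (valid h)) (prod h ∘ ∈-resp-↭ (↭-sym p))

    Fact-resp-↭ : ∀ {r π ts} → Fact r π V ts → Fact r π W ts
    Fact-resp-↭ (h , c) = Pre-resp-↭ h , λ u v → c (∈-resp-↭ (↭-sym p) u) (∈-resp-↭ (↭-sym p) v)

  -- The head of a list of factors acts last and is an involution, so the product of the other
  -- factors is obtained from π by composing with τ on the left.
  _⟨_⟩ : (ℕ → ℕ) → ℕ × ℕ → ℕ → ℕ
  (π ⟨ τ ⟩) v = swap τ (π v)

  Pre-∷⁻ : ∀ {r π V x y ts} → Pre (suc r) π V ((x , y) ∷ ts) → Valid V (x , y) × Pre r (π ⟨ x , y ⟩) V ts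
  Pre-∷⁻ {x = x} {y} {ts} (pre l (a ∷ h) p) = a , pre (ℕₚ.suc-injective l) h
    (λ {v} v∈ → trans (sym (swap-involutive x y (prodT ts v))) (cong (swap (x , y)) (p v∈)))

  Pre-∷ : ∀ {r π V x y ts} → Valid V (x , y) → Pre r (π ⟨ x , y ⟩) V ts → Pre (suc r) π V ((x , y) ∷ ts)
  Pre-∷ {π = π} {x = x} {y} a h = pre (cong suc (len h)) (a ∷ valid h)
    (λ {v} v∈ → trans (cong (swap (x , y)) (prod h v∈)) (swap-involutive x y (π v)))

  Chain : (ℕ → ℕ) → ℕ → List ℕ → ℕ → Set
  Chain π x []      z = π x ≡ z
  Chain π x (c ∷ p) z = π x ≡ c × Chain π c p z

  IsCycle : (ℕ → ℕ) → List ℕ → Set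
  IsCycle π []      = ⊥
  IsCycle π (x ∷ c) = Chain π x c x

  Chain-++ : ∀ {π x z} p {q s} → Chain π x p q → Chain π q s z → Chain π x (p ++ q ∷ s) z
  Chain-++ []      h       k = h , k
  Chain-++ (_ ∷ p) (e , h) k = e , Chain-++ p h k

  Chain-++⁻ : ∀ {π x z} p {q s} → Chain π x (p ++ q ∷ s) z → Chain π x p q × Chain π q s z
  Chain-++⁻ []      h       = h
  Chain-++⁻ (_ ∷ p) (e , h) = let (a , b) = Chain-++⁻ p h in (e , a) , b

  IsCycle-rotate : ∀ {π} u {x v} → IsCycle π (u ++ x ∷ v) → IsCycle π (x ∷ v ++ u)
  IsCycle-rotate {π} []      {x} {v} h = subst (λ w → Chain π x w x) (sym (++-identityʳ v)) h
  IsCycle-rotate     (w ∷ u) {x} {v} h = let (a , b) = Chain-++⁻ u h in Chain-++ v b a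

  -- Composing with (x y) on the left redirects only the arrows that point to x or y; inside the
  -- path there are none, so only its end moves.
  Chain-swap : ∀ {π x y a z} p → x ∉ p → y ∉ p → Chain π a p z → Chain (π ⟨ x , y ⟩) a p (swap (x , y) z)
  Chain-swap {x = x} {y} []      _  _  h       = cong (swap (x , y)) h
  Chain-swap {x = x} {y} (c ∷ p) ∉x ∉y (e , h) =
    trans (cong (swap (x , y)) e) (swap-≢ (λ q → ∉x (here (sym q))) (λ q → ∉y (here (sym q))))
    , Chain-swap p (∉x ∘ there) (∉y ∘ there) h

  IsCycle-swap : ∀ {π x y} d → x ∉ d → y ∉ d → IsCycle π d → IsCycle (π ⟨ x , y ⟩) d
  IsCycle-swap {π} {x} {y} (e ∷ d) ∉x ∉y h =
    subst (Chain _ e d) (swap-≢ (λ q → ∉x (here (sym q))) (λ q → ∉y (here (sym q)))) (Chain-swap d (∉x ∘ there) (∉y ∘ there) h)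

  IsCycles-swap : ∀ {π x y} D → x ∉ concat D → y ∉ concat D → All (IsCycle π) D → All (IsCycle (π ⟨ x , y ⟩)) D
  IsCycles-swap []      ∉x ∉y []      = []
  IsCycles-swap (d ∷ D) ∉x ∉y (h ∷ hs) =
    IsCycle-swap d (∉x ∘ ∈-++⁺ˡ) (∉y ∘ ∈-++⁺ˡ) h ∷ IsCycles-swap D (∉x ∘ ∈-++⁺ʳ d) (∉y ∘ ∈-++⁺ʳ d) hs

  Cycles : (ℕ → ℕ) → List (List ℕ) → Set
  Cycles π C = All (IsCycle π) C × Unique (concat C)

  -- View C x c D: the cycle of C through x is x ∷ c, and D are the others.
  record View (C : List (List ℕ)) (x : ℕ) (c : List ℕ) (D : List (List ℕ)) : Set where
    constructor view
    field
      before after : List ℕ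
      pick         : Pick (before ++ x ∷ after) D C
      rest         : c ≡ after ++ before

  Pick-concat : ∀ {d : List ℕ} {D C} → Pick d D C → concat C ↭ d ++ concat D
  Pick-concat here = ↭-refl
  Pick-concat {d} (there {y} {V} p) = ↭-trans (++⁺ˡ y (Pick-concat p))
    (↭-trans (↭-reflexive (sym (++-assoc y d (concat V))))
      (↭-trans (++⁺ʳ (concat V) (++-comm y d)) (↭-reflexive (++-assoc d y (concat V)))))

  Pick-map : ∀ {A B : Set} (f : A → B) {d D C} → Pick d D C → Pick (f d) (map f D) (map f C)
  Pick-map f here      = here
  Pick-map f (there p) = there (Pick-map f p)

  View-↭ : ∀ {C x c D} → View C x c D → concat C ↭ x ∷ c ++ concat D
  View-↭ {x = x} {D = D} (view u v p refl) = ↭-trans (Pick-concat p)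
    (++⁺ʳ (concat D) (↭-trans (shift x u v) (prep x (++-comm u v))))

  View-length : ∀ (u : List ℕ) {x} v → length (u ++ x ∷ v) ≡ suc (length (v ++ u))
  View-length u {x} v = begin
    length (u ++ x ∷ v)            ≡⟨ length-++ u ⟩
    length u ℕ.+ suc (length v)    ≡⟨ ℕₚ.+-suc (length u) (length v) ⟩
    suc (length u ℕ.+ length v)    ≡⟨ cong suc (ℕₚ.+-comm (length u) (length v)) ⟩
    suc (length v ℕ.+ length u)    ≡⟨ cong suc (length-++ v) ⟨
    suc (length (v ++ u)) ∎
    where open ≡-Reasoning

  View-Pick : ∀ {C x c D} → View C x c D → Pick (suc (length c)) (map length D) (map length C)
  View-Pick {C} {x} {D = D} (view u v p refl) = subst (λ k → Pick k (map length D) (map length C)) (View-length u {x} v) (Pick-map length p)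

  View-Cycles : ∀ {π C x c D} → View C x c D → Cycles π C → Cycles π ((x ∷ c) ∷ D)
  View-Cycles w@(view u v p refl) (h , uq) = let (a , b) = All-Pick p h in
    IsCycle-rotate u a ∷ b , Unique-resp-↭ (View-↭ w) uq
    where
    All-Pick : ∀ {π d D C} → Pick d D C → All (IsCycle π) C → IsCycle π d × All (IsCycle π) D
    All-Pick here      (h ∷ hs) = h , hs
    All-Pick (there p) (h ∷ hs) = let (a , b) = All-Pick p hs in a , h ∷ b

  -- The arrow entering y is redirected to x and the arrow entering x to y, which closes the two
  -- arcs x ∷ u and y ∷ v separately.
  cut-Cycles : ∀ {π x u y v D} → Cycles π ((x ∷ u ++ y ∷ v) ∷ D) → Cycles (π ⟨ x , y ⟩) ((x ∷ u) ∷ (y ∷ v) ∷ D)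
  cut-Cycles {π} {x} {u} {y} {v} {D} (h ∷ hs , uq) = let (a , b) = Chain-++⁻ u h in
    subst (Chain _ x u) (swap-≡ʳ x y) (Chain-swap u (x∉ ∘ ∈-++⁺ˡ) (λ q → disj (there q) (here refl)) a)
    ∷ subst (Chain _ y v) (swap-≡ˡ x y) (Chain-swap v (x∉ ∘ ∈-++⁺ʳ u ∘ there) (Unique-∉ (proj₁ (proj₂ (Unique-++⁻ (x ∷ u) uq₁)))) b)
    ∷ IsCycles-swap D (d₁ (here refl)) (d₁ (there (∈-++⁺ʳ u (here refl)))) hs
    , subst Unique (++-assoc (x ∷ u) (y ∷ v) (concat D)) uq
    where
    uq₁ : Unique (x ∷ u ++ y ∷ v)
    uq₁ = proj₁ (Unique-++⁻ (x ∷ u ++ y ∷ v) uq)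
    x∉ : x ∉ u ++ y ∷ v
    x∉ = Unique-∉ uq₁
    disj : ∀ {w} → w ∈ x ∷ u → w ∈ y ∷ v → ⊥
    disj = proj₂ (proj₂ (Unique-++⁻ (x ∷ u) uq₁))
    d₁ : ∀ {w} → w ∈ x ∷ u ++ y ∷ v → w ∈ concat D → ⊥
    d₁ = proj₂ (proj₂ (Unique-++⁻ (x ∷ u ++ y ∷ v) uq))

  -- The same redirection with x and y on different cycles splices the cycles into one.
  join-Cycles : ∀ {π x c D y e} → Cycles π ((x ∷ c) ∷ (y ∷ e) ∷ D) → Cycles (π ⟨ x , y ⟩) ((x ∷ c ++ y ∷ e) ∷ D)
  join-Cycles {π} {x} {c} {D} {y} {e} (h ∷ k ∷ hs , uq) =
    Chain-++ c (subst (Chain _ x c) (swap-≡ˡ x y) (Chain-swap c (Unique-∉ uq₁) (λ q → disj (there q) (here refl)) h))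
               (subst (Chain _ y e) (swap-≡ʳ x y) (Chain-swap e (λ q → disj (here refl) (there (∈-++⁺ˡ q))) (Unique-∉ uq₃) k))
    ∷ IsCycles-swap D (disj (here refl) ∘ ∈-++⁺ʳ (y ∷ e)) (disj₂ (here refl)) hs
    , subst Unique (sym (++-assoc (x ∷ c) (y ∷ e) (concat D))) uq
    where
    uq₁ : Unique (x ∷ c)
    uq₁ = proj₁ (Unique-++⁻ (x ∷ c) uq)
    disj : ∀ {w} → w ∈ x ∷ c → w ∈ y ∷ e ++ concat D → ⊥
    disj = proj₂ (proj₂ (Unique-++⁻ (x ∷ c) uq))
    uq₂ : Unique (y ∷ e ++ concat D)
    uq₂ = proj₁ (proj₂ (Unique-++⁻ (x ∷ c) uq))
    uq₃ : Unique (y ∷ e)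
    uq₃ = proj₁ (Unique-++⁻ (y ∷ e) uq₂)
    disj₂ : ∀ {w} → w ∈ y ∷ e → w ∈ concat D → ⊥
    disj₂ = proj₂ (proj₂ (Unique-++⁻ (y ∷ e) uq₂))

  module _ {r π V ts} (h : Pre r π V ts) {f : ℕ → ℕ} (inv : Invariant f ts) where

    Invariant-π : ∀ {v} → v ∈ V → f (π v) ≡ f v
    Invariant-π {v} v∈ = trans (cong f (sym (prod h v∈))) (Invariant-prodT inv v)

    Invariant-Chain : ∀ {x z} p → x ∈ V → (∀ {v} → v ∈ p → v ∈ V) → Chain π x p z → ∀ {v} → v ∈ p → f v ≡ f x
    Invariant-Chain (c ∷ p) x∈ p⊆ (refl , k) (here refl) = Invariant-π x∈
    Invariant-Chain (c ∷ p) x∈ p⊆ (refl , k) (there q)   =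
      trans (Invariant-Chain p (p⊆ (here refl)) (p⊆ ∘ there) k q) (Invariant-π x∈)

    -- On V, π is the product of the factors, which preserves every function constant along the
    -- edges. For f = `rep` this says that a cycle stays inside one component.
    Invariant-Cycle : ∀ {x c} → (∀ {v} → v ∈ x ∷ c → v ∈ V) → IsCycle π (x ∷ c) → ∀ {v} → v ∈ x ∷ c → f v ≡ f x
    Invariant-Cycle c⊆ k (here refl) = refl
    Invariant-Cycle c⊆ k (there q)   = Invariant-Chain _ (c⊆ (here refl)) (c⊆ ∘ there) k q

-- Splitting into two components and the Riemann-Hurwitz inequality

module Recursion where
  open import Data.List.Membership.DecPropositional ℕ._≟_ using (_∈?_)
  open import Relation.Nullary.Decidable using (dec-true; dec-false)
  open import Defs using (swap; prodT)
  open Sums using (Pick; here; there; Pick-length)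
  open Counting using (Unique-resp-↭; Unique-++⁻)
  open Factorizations

  module _ (A : List ℕ) where

    -- The indicator of A takes values in ℕ, so that the lemmas on `Invariant` functions apply to
    -- membership in A.
    side : ℕ → ℕ
    side v = if does (v ∈? A) then 1 else 0

    side-∈ : ∀ {v} → v ∈ A → side v ≡ 1
    side-∈ {v} h rewrite dec-true (v ∈? A) h = refl

    side-∉ : ∀ {v} → v ∉ A → side v ≡ 0
    side-∉ {v} h rewrite dec-false (v ∈? A) h = refl

    side-∈⁻ : ∀ {v} → side v ≡ 1 → v ∈ A
    side-∈⁻ {v} e with v ∈? A
    ... | yes h = h
    side-∈⁻ {v} () | no _

    module _ (p : ℕ × ℕ → Bool) where

      Local : ℕ × ℕ → Set
      Local τ@(i , j) = (p τ ≡ true × i ∈ A × j ∈ A) ⊎ (p τ ≡ false × i ∉ A × j ∉ A)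

      Local-Invariant : ∀ {ts} → All Local ts → Invariant side ts
      Local-Invariant = All.map λ
        { (inj₁ (_ , i , j)) → trans (side-∈ i) (sym (side-∈ j))
        ; (inj₂ (_ , i , j)) → trans (side-∉ i) (sym (side-∉ j)) }

      prodT-∈ : ∀ {ts v} → All Local ts → v ∈ A → prodT ts v ∈ A
      prodT-∈ {ts} {v} h v∈ = side-∈⁻ (trans (Invariant-prodT {side} (Local-Invariant h) v) (side-∈ v∈))

      rep-∈ : ∀ {ts v} → All Local ts → v ∈ A → rep ts v ∈ A
      rep-∈ {ts} {v} h v∈ = side-∈⁻ (trans (Invariant-rep {side} (Local-Invariant h) v) (side-∈ v∈))

      rep-∉ : ∀ {ts v} → All Local ts → v ∉ A → rep ts v ∉ A
      rep-∉ {ts} {v} h v∉ r∈ = contradiction (trans (sym (side-∈ r∈)) (trans (Invariant-rep {side} (Local-Invariant h) v) (side-∉ v∉))) λ ()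

      -- The partial products keep a point of A inside A, where the factors lying off A act
      -- trivially.
      prodT-filter : ∀ {ts v} → All Local ts → v ∈ A → prodT ts v ≡ prodT (filterᵇ p ts) v
      prodT-filter []                                       v∈ = refl
      prodT-filter {τ ∷ ts} (inj₁ (e , _ , _) ∷ h)   v∈ rewrite e = cong (swap τ) (prodT-filter h v∈)
      prodT-filter {τ ∷ ts} (inj₂ (e , i , j) ∷ h) v∈ rewrite e =
        trans (swap-≢ (λ q → i (subst (_∈ A) q (prodT-∈ h v∈))) (λ q → j (subst (_∈ A) q (prodT-∈ h v∈)))) (prodT-filter h v∈)

      rep-filter : ∀ {ts v} → All Local ts → v ∈ A → rep ts v ≡ rep (filterᵇ p ts) v
      rep-filter []                                       v∈ = refl
      rep-filter {(i , j) ∷ ts} {v} (inj₁ (e , i∈ , j∈) ∷ h) v∈ rewrite e =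
        trans (cong₂ (λ a b → merge a b (rep ts v)) (rep-filter h i∈) (rep-filter h j∈))
              (cong (merge (rep (filterᵇ p ts) i) (rep (filterᵇ p ts) j)) (rep-filter h v∈))
      rep-filter {(i , j) ∷ ts} {v} (inj₂ (e , i∉ , j∉) ∷ h) v∈ rewrite e =
        trans (merge-≢ (rep ts j) (λ q → rep-∉ h i∉ (subst (_∈ A) q (rep-∈ h v∈)))) (rep-filter h v∈)

  length-filter : ∀ {B : Set} (p : B → Bool) xs → length (filterᵇ p xs) ℕ.+ length (filterᵇ (not ∘ p) xs) ≡ length xs
  length-filter p []       = refl
  length-filter p (x ∷ xs) with p x
  ... | true  = cong suc (length-filter p xs)
  ... | false = trans (ℕₚ.+-suc (length (filterᵇ p xs)) _) (cong suc (length-filter p xs))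

  All-filter⁻ : ∀ {B : Set} (p : B → Bool) {P Q : B → Set} xs → All P (filterᵇ p xs) → All Q (filterᵇ (not ∘ p) xs) →
                All (λ x → (p x ≡ true × P x) ⊎ (p x ≡ false × Q x)) xs
  All-filter⁻ p []       a b = []
  All-filter⁻ p (x ∷ xs) a b with p x in e
  All-filter⁻ p (x ∷ xs) (a ∷ as) b | true  = inj₁ (e , a) ∷ All-filter⁻ p xs as b
  All-filter⁻ p (x ∷ xs) a (b ∷ bs) | false = inj₂ (e , b) ∷ All-filter⁻ p xs a bs

  All-filter : ∀ {B : Set} (p : B → Bool) {P : B → Set} {xs} → All (λ x → p x ≡ true → P x) xs → All P (filterᵇ p xs)
  All-filter p []           = []
  All-filter p {xs = x ∷ xs} (h ∷ hs) with p x in e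
  ... | true  = h refl ∷ All-filter p hs
  ... | false = All-filter p hs

  -- A factorization on A ∪ B whose graph has the components A ∋ x and B ∋ y is a
  -- shuffle of transitive factorizations on A and on B.
  module TwoComponents (A B : List ℕ) (disjoint : ∀ {v} → v ∈ A → v ∈ B → ⊥) {x y : ℕ} (x∈A : x ∈ A) (y∈B : y ∈ B) where

    inA : ℕ × ℕ → Bool
    inA τ = does (proj₁ τ ∈? A)

    inA-true : ∀ {τ} → proj₁ τ ∈ A → inA τ ≡ true
    inA-true {i , _} h = dec-true (i ∈? A) h

    inA-false : ∀ {τ} → proj₁ τ ∈ B → inA τ ≡ false
    inA-false {i , _} h = dec-false (i ∈? A) (λ a → disjoint a h)

    Components : List (ℕ × ℕ) → Set
    Components ts = rep ts x ≢ rep ts y × (∀ {v} → v ∈ A → rep ts v ≡ rep ts x) × (∀ {v} → v ∈ B → rep ts v ≡ rep ts y)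

    InOne : ℕ × ℕ → Set
    InOne τ@(i , j) = (inA τ ≡ true × i ∈ A × j ∈ A × i ≢ j) ⊎ (inA τ ≡ false × i ∈ B × j ∈ B × i ≢ j)

    InOne⇒LocalA : ∀ {τ} → InOne τ → Local A inA τ
    InOne⇒LocalA (inj₁ (e , i , j , _)) = inj₁ (e , i , j)
    InOne⇒LocalA (inj₂ (e , i , j , _)) = inj₂ (e , (λ a → disjoint a i) , (λ a → disjoint a j))

    InOne⇒LocalB : ∀ {τ} → InOne τ → Local B (not ∘ inA) τ
    InOne⇒LocalB (inj₁ (e , i , j , _)) = inj₂ (cong not e , (λ b → disjoint i b) , (λ b → disjoint j b))
    InOne⇒LocalB (inj₂ (e , i , j , _)) = inj₁ (cong not e , i , j)

    -- The ends of an edge have the same representative, whereas points of A and of B have different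
    -- ones, so no edge joins A to B.
    components-InOne : ∀ {ts} → All (Valid (A ++ B)) ts → Components ts → All InOne ts
    components-InOne {ts} valid (x≁y , onA , onB) = go ts valid (rep-Invariant ts)
      where
      edge : ∀ {i j} → Valid (A ++ B) (i , j) → rep ts i ≡ rep ts j → InOne (i , j)
      edge (i , j , ne) e with ∈-++⁻ A i | ∈-++⁻ A j
      ... | inj₁ a | inj₁ b = inj₁ (dec-true (_ ∈? A) a , a , b , ne)
      ... | inj₁ a | inj₂ b = contradiction (trans (sym (onA a)) (trans e (onB b))) x≁y
      ... | inj₂ a | inj₁ b = contradiction (trans (sym (onA b)) (trans (sym e) (onB a))) x≁y
      ... | inj₂ a | inj₂ b = inj₂ (dec-false (_ ∈? A) (λ z → disjoint z a) , a , b , ne)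
      go : ∀ us → All (Valid (A ++ B)) us → Invariant (rep ts) us → All InOne us
      go []       []       []       = []
      go (_ ∷ us) (v ∷ vs) (e ∷ es) = edge v e ∷ go us vs es

    split-Fact : ∀ {r π ts} → Pre r π (A ++ B) ts → Components ts →
      length (filterᵇ inA ts) ℕ.+ length (filterᵇ (not ∘ inA) ts) ≡ r ×
      Fact (length (filterᵇ inA ts)) π A (filterᵇ inA ts) × Fact (length (filterᵇ (not ∘ inA) ts)) π B (filterᵇ (not ∘ inA) ts)
    split-Fact {r} {π} {ts} h comp@(_ , onA , onB) = trans (length-filter inA ts) (len h) ,
      (pre refl (All-filter inA (All.map (λ {τ} → validA {τ}) one)) (λ v∈ → trans (sym (prodT-filter A inA localA v∈)) (prod h (∈-++⁺ˡ v∈)))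
        , λ u∈ v∈ → trans (sym (rep-filter A inA localA u∈)) (trans (trans (onA u∈) (sym (onA v∈))) (rep-filter A inA localA v∈))) ,
      (pre refl (All-filter (not ∘ inA) (All.map (λ {τ} → validB {τ}) one)) (λ v∈ → trans (sym (prodT-filter B (not ∘ inA) localB v∈)) (prod h (∈-++⁺ʳ A v∈)))
        , λ u∈ v∈ → trans (sym (rep-filter B (not ∘ inA) localB u∈)) (trans (trans (onB u∈) (sym (onB v∈))) (rep-filter B (not ∘ inA) localB v∈)))
      where
      one : All InOne ts
      one = components-InOne (valid h) comp
      localA : All (Local A inA) ts
      localA = All.map InOne⇒LocalA one
      localB : All (Local B (not ∘ inA)) ts
      localB = All.map InOne⇒LocalB one
      validA : ∀ {τ} → InOne τ → inA τ ≡ true → Valid A τ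
      validA (inj₁ (_ , h)) _ = h
      validA (inj₂ (e , _)) e′ = contradiction (trans (sym e′) e) λ ()
      validB : ∀ {τ} → InOne τ → not (inA τ) ≡ true → Valid B τ
      validB (inj₁ (e , _)) e′ = contradiction (trans (sym e′) (cong not e)) λ ()
      validB (inj₂ (_ , h)) _ = h

    join-Fact : ∀ {r₁ r₂ π ts} → Fact r₁ π A (filterᵇ inA ts) → Fact r₂ π B (filterᵇ (not ∘ inA) ts) →
                Pre (r₁ ℕ.+ r₂) π (A ++ B) ts × Components ts
    join-Fact {r₁} {r₂} {π} {ts} (h₁ , c₁) (h₂ , c₂) =
      pre (trans (sym (length-filter inA ts)) (cong₂ ℕ._+_ (len h₁) (len h₂)))
          (All.map (λ { (inj₁ (_ , i , j , ne)) → ∈-++⁺ˡ i , ∈-++⁺ˡ j , ne ; (inj₂ (_ , i , j , ne)) → ∈-++⁺ʳ A i , ∈-++⁺ʳ A j , ne }) one)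
          (λ v∈ → [ (λ a → trans (prodT-filter A inA localA a) (prod h₁ a)) , (λ b → trans (prodT-filter B (not ∘ inA) localB b) (prod h₂ b)) ]′ (∈-++⁻ A v∈))
      , (λ e → disjoint (rep-∈ A inA localA x∈A) (subst (_∈ B) (sym e) (rep-∈ B (not ∘ inA) localB y∈B)))
      , (λ v∈ → trans (rep-filter A inA localA v∈) (trans (c₁ v∈ x∈A) (sym (rep-filter A inA localA x∈A))))
      , (λ v∈ → trans (rep-filter B (not ∘ inA) localB v∈) (trans (c₂ v∈ y∈B) (sym (rep-filter B (not ∘ inA) localB y∈B))))
      where
      one : All InOne ts
      one = All-filter⁻ inA ts (valid h₁) (valid h₂)
      localA : All (Local A inA) ts
      localA = All.map InOne⇒LocalA one
      localB : All (Local B (not ∘ inA)) ts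
      localB = All.map InOne⇒LocalB one

    inA-true-All : ∀ {r π ts} → Fact r π A ts → All (λ τ → inA τ ≡ true) ts
    inA-true-All (h , _) = All.map (λ {τ} (i , _) → inA-true {τ} i) (valid h)

    inA-false-All : ∀ {r π ts} → Fact r π B ts → All (λ τ → inA τ ≡ false) ts
    inA-false-All (h , _) = All.map (λ {τ} (i , _) → inA-false {τ} i) (valid h)

  Sides : ℕ → ℕ → List (List ℕ) → List (List ℕ) → List (ℕ × ℕ) → Set
  Sides x y A B ts = All (All (λ v → rep ts v ≡ rep ts x)) A × All (All (λ v → rep ts v ≡ rep ts y)) B

  Separated : ℕ → (ℕ → ℕ) → List ℕ → ℕ → ℕ → List (List ℕ) → List (List ℕ) → List (ℕ × ℕ) → Set
  Separated r π V x y A B ts = (Pre r π V ts × Sep V x y ts) × Sides x y A B ts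

  module _ {π : ℕ → ℕ} {V : List ℕ} {x y : ℕ} {d : List ℕ} (cycle : IsCycle π d) (d⊆V : ∀ {v} → v ∈ d → v ∈ V) where

    -- A cycle lies inside one component, and the components of x and y are the only ones.
    Separated-∷ : ∀ {r A B ts} → Separated r π V x y A B ts →
                  Separated r π V x y (A ++ d ∷ []) B ts ⊎ Separated r π V x y A (B ++ d ∷ []) ts
    Separated-∷ {ts = ts} (h@(p , (_ , cover)) , a , b) = go d cycle d⊆V
      where
      go : ∀ d → IsCycle π d → (∀ {v} → v ∈ d → v ∈ V) →
           Separated _ π V x y (_ ++ d ∷ []) _ ts ⊎ Separated _ π V x y _ (_ ++ d ∷ []) ts
      go (e ∷ d) cycle d⊆V with cover (d⊆V (here refl))
      ... | inj₁ q = inj₁ (h , Allₚ.++⁺ a (All.tabulate (λ v∈ → trans (Invariant-Cycle p (rep-Invariant ts) d⊆V cycle v∈) q) ∷ []) , b)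
      ... | inj₂ q = inj₂ (h , a , Allₚ.++⁺ b (All.tabulate (λ v∈ → trans (Invariant-Cycle p (rep-Invariant ts) d⊆V cycle v∈) q) ∷ []))

  Separated-ˡ⁻ : ∀ {r π V x y} A {B d ts} → Separated r π V x y (A ++ d) B ts → Separated r π V x y A B ts
  Separated-ˡ⁻ A (h , a , b) = h , Allₚ.++⁻ˡ A a , b

  Separated-ʳ⁻ : ∀ {r π V x y A} B {d ts} → Separated r π V x y A (B ++ d) ts → Separated r π V x y A B ts
  Separated-ʳ⁻ B (h , a , b) = h , a , Allₚ.++⁻ˡ B b

  Separated-disjoint : ∀ {r π V x y} A B {d ts} → IsCycle π d →
    Separated r π V x y (A ++ d ∷ []) B ts → Separated r π V x y A (B ++ d ∷ []) ts → ⊥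
  Separated-disjoint A B {e ∷ d} _ ((_ , x≁y , _) , a , _) (_ , _ , b) with Allₚ.++⁻ʳ A a | Allₚ.++⁻ʳ B b
  ... | (p ∷ _) ∷ [] | (q ∷ _) ∷ [] = x≁y (trans (sym p) q)

  ∷ʳ-concat : ∀ A (d : List ℕ) → concat (A ++ d ∷ []) ≡ concat A ++ d
  ∷ʳ-concat A d = trans (sym (concat-++ A (d ∷ []))) (cong (concat A ++_) (++-identityʳ d))

  moveˡ : ∀ A B d D → concat A ++ (concat B ++ (d ++ concat D)) ↭ concat (A ++ d ∷ []) ++ (concat B ++ concat D)
  moveˡ A B d D = ↭-trans (++⁺ˡ (concat A) (shifts (concat B) d))
    (↭-reflexive (trans (sym (++-assoc (concat A) d _)) (cong (_++ (concat B ++ concat D)) (sym (∷ʳ-concat A d)))))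

  moveʳ : ∀ A B d D → concat A ++ (concat B ++ (d ++ concat D)) ↭ concat A ++ (concat (B ++ d ∷ []) ++ concat D)
  moveʳ A B d D = ↭-reflexive (cong (concat A ++_)
    (trans (sym (++-assoc (concat B) d _)) (cong (_++ concat D) (sym (∷ʳ-concat B d)))))

  concat-All : ∀ {P : ℕ → Set} {C} → All (All P) C → ∀ {v} → v ∈ concat C → P v
  concat-All {C = d ∷ C} (h ∷ hs) v∈ = [ All.lookup h , concat-All hs ]′ (∈-++⁻ d v∈)

  All-concat : ∀ {P : ℕ → Set} C → (∀ {v} → v ∈ concat C → P v) → All (All P) C
  All-concat []      h = []
  All-concat (d ∷ C) h = All.tabulate (h ∘ ∈-++⁺ˡ) ∷ All-concat C (h ∘ ∈-++⁺ʳ d)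

  -- The cycles of π on V, of which those in D are not yet assigned to the component of x or of y.
  record Triple (π : ℕ → ℕ) (V : List ℕ) (x y : ℕ) (A B D : List (List ℕ)) : Set where
    field
      perm    : V ↭ concat A ++ (concat B ++ concat D)
      unique  : Unique V
      cyclesA : All (IsCycle π) A
      cyclesB : All (IsCycle π) B
      cyclesD : All (IsCycle π) D
      x∈A     : x ∈ concat A
      y∈B     : y ∈ concat B

    unique′ : Unique (concat A ++ (concat B ++ concat D))
    unique′ = Unique-resp-↭ perm unique

    disjointAB : ∀ {v} → v ∈ concat A → v ∈ concat B → ⊥
    disjointAB a b = proj₂ (proj₂ (Unique-++⁻ (concat A) unique′)) a (∈-++⁺ˡ b)

    CyclesA : Cycles π A
    CyclesA = cyclesA , proj₁ (Unique-++⁻ (concat A) unique′)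

    CyclesB : Cycles π B
    CyclesB = cyclesB , proj₁ (Unique-++⁻ (concat B) (proj₁ (proj₂ (Unique-++⁻ (concat A) unique′))))

  open Triple

  module _ {π V x y A B d D} (t : Triple π V x y A B (d ∷ D)) where

    Triple-cycle : IsCycle π d
    Triple-cycle = All.head (cyclesD t)

    Triple-⊆ : ∀ {v} → v ∈ d → v ∈ V
    Triple-⊆ v∈ = ∈-resp-↭ (↭-sym (perm t)) (∈-++⁺ʳ (concat A) (∈-++⁺ʳ (concat B) (∈-++⁺ˡ v∈)))

    Triple-ˡ : Triple π V x y (A ++ d ∷ []) B D
    Triple-ˡ = record
      { perm = ↭-trans (perm t) (moveˡ A B d D) ; unique = unique t ; cyclesA = Allₚ.++⁺ (cyclesA t) (Triple-cycle ∷ [])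
      ; cyclesB = cyclesB t ; cyclesD = All.tail (cyclesD t)
      ; x∈A = subst (x ∈_) (sym (∷ʳ-concat A d)) (∈-++⁺ˡ (x∈A t)) ; y∈B = y∈B t }

    Triple-ʳ : Triple π V x y A (B ++ d ∷ []) D
    Triple-ʳ = record
      { perm = ↭-trans (perm t) (moveʳ A B d D) ; unique = unique t ; cyclesA = cyclesA t
      ; cyclesB = Allₚ.++⁺ (cyclesB t) (Triple-cycle ∷ []) ; cyclesD = All.tail (cyclesD t)
      ; x∈A = x∈A t ; y∈B = subst (y ∈_) (sym (∷ʳ-concat B d)) (∈-++⁺ˡ (y∈B t)) }

  Triple-↭ : ∀ {π V x y A B} → Triple π V x y A B [] → V ↭ concat A ++ concat B
  Triple-↭ {A = A} {B} t = ↭-trans (perm t) (↭-reflexive (cong (concat A ++_) (++-identityʳ (concat B))))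

  -- Number of points plus number of cycles. A transitive factorization is minimal when its number
  -- of factors is two less.
  size : List (List ℕ) → ℕ
  size C = length (concat C) ℕ.+ length C

  Triple-size : ∀ {π V x y A B} → Triple π V x y A B [] → length V ℕ.+ (length A ℕ.+ length B ℕ.+ 0) ≡ size A ℕ.+ size B
  Triple-size {A = A} {B} t = trans (cong (ℕ._+ (length A ℕ.+ length B ℕ.+ 0)) (trans (↭-length (Triple-↭ t)) (length-++ (concat A))))
    (lem (length (concat A)) (length (concat B)) (length A) (length B))
    where
    lem : ∀ a b c d → a ℕ.+ b ℕ.+ (c ℕ.+ d ℕ.+ 0) ≡ (a ℕ.+ c) ℕ.+ (b ℕ.+ d)
    lem = ℕ-Solver.solve-∀

  ∷ʳ-length : ∀ (A : List (List ℕ)) d → length (A ++ d ∷ []) ≡ suc (length A)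
  ∷ʳ-length A d = trans (length-++ A) (ℕₚ.+-comm (length A) 1)

  shape-ˡ : ∀ (A B : List (List ℕ)) d (D : List (List ℕ)) →
            length (A ++ d ∷ []) ℕ.+ length B ℕ.+ length D ≡ length A ℕ.+ length B ℕ.+ length (d ∷ D)
  shape-ˡ A B d D = trans (cong (λ k → k ℕ.+ length B ℕ.+ length D) (∷ʳ-length A d)) (lem (length A) (length B) (length D))
    where
    lem : ∀ a b c → suc a ℕ.+ b ℕ.+ c ≡ a ℕ.+ b ℕ.+ suc c
    lem = ℕ-Solver.solve-∀

  shape-ʳ : ∀ (A B : List (List ℕ)) d (D : List (List ℕ)) →
            length A ℕ.+ length (B ++ d ∷ []) ℕ.+ length D ≡ length A ℕ.+ length B ℕ.+ length (d ∷ D)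
  shape-ʳ A B d D = trans (cong (λ k → length A ℕ.+ k ℕ.+ length D) (∷ʳ-length B d)) (lem (length A) (length B) (length D))
    where
    lem : ∀ a b c → a ℕ.+ suc b ℕ.+ c ≡ a ℕ.+ b ℕ.+ suc c
    lem = ℕ-Solver.solve-∀

  Separated⇒Components : ∀ {r π V x y A B ts} (t : Triple π V x y A B []) → Separated r π V x y A B ts →
    Pre r π (concat A ++ concat B) ts × TwoComponents.Components (concat A) (concat B) (disjointAB t) (x∈A t) (y∈B t) ts
  Separated⇒Components t ((p , (x≁y , _)) , a , b) = Pre-resp-↭ (Triple-↭ t) p , x≁y , concat-All a , concat-All b

  Components⇒Separated : ∀ {r π V x y A B ts} (t : Triple π V x y A B []) → Pre r π (concat A ++ concat B) ts →
    TwoComponents.Components (concat A) (concat B) (disjointAB t) (x∈A t) (y∈B t) ts → Separated r π V x y A B ts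
  Components⇒Separated {A = A} {B} t p (x≁y , a , b) =
    (Pre-resp-↭ (↭-sym (Triple-↭ t)) p , x≁y , λ v∈ → [ inj₁ ∘ a , inj₂ ∘ b ]′ (∈-++⁻ (concat A) (∈-resp-↭ (Triple-↭ t) v∈)))
    , All-concat A a , All-concat B b

  RiemannHurwitz : ℕ → Set
  RiemannHurwitz r = ∀ {π C ts} → Cycles π C → Fact r π (concat C) ts → size C ≤ 2 ℕ.+ r

  -- The cycles of D are assigned one at a time. Once all are assigned, the inequalities on the two
  -- components add up; each contributes a constant 2, hence the 4.
  Separated-size : ∀ {r} → (∀ {s} → s ≤ r → RiemannHurwitz s) → ∀ D {π V x y A B ts} → Triple π V x y A B D →
    Separated r π V x y A B ts → length V ℕ.+ (length A ℕ.+ length B ℕ.+ length D) ≤ 4 ℕ.+ r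
  Separated-size {r} RH [] {A = A} {B} {ts} t h = begin
    _                                    ≡⟨ Triple-size t ⟩
    size A ℕ.+ size B                    ≤⟨ ℕₚ.+-mono-≤ (RH (ℕₚ.≤-trans (ℕₚ.m≤m+n r₁ r₂) (ℕₚ.≤-reflexive e)) (CyclesA t) f₁)
                                                        (RH (ℕₚ.≤-trans (ℕₚ.m≤n+m r₂ r₁) (ℕₚ.≤-reflexive e)) (CyclesB t) f₂) ⟩
    (2 ℕ.+ r₁) ℕ.+ (2 ℕ.+ r₂)            ≡⟨ lem r₁ r₂ ⟩
    4 ℕ.+ (r₁ ℕ.+ r₂)                    ≡⟨ cong (4 ℕ.+_) e ⟩
    4 ℕ.+ r ∎
    where
    open ℕₚ.≤-Reasoning
    open TwoComponents (concat A) (concat B) (disjointAB t) (x∈A t) (y∈B t)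
    splitted : _
    splitted = let (p , c) = Separated⇒Components t h in split-Fact p c
    r₁ r₂ : ℕ
    r₁ = length (filterᵇ inA ts)
    r₂ = length (filterᵇ (not ∘ inA) ts)
    e : r₁ ℕ.+ r₂ ≡ r
    e = proj₁ splitted
    f₁ : Fact r₁ _ (concat A) (filterᵇ inA ts)
    f₁ = proj₁ (proj₂ splitted)
    f₂ : Fact r₂ _ (concat B) (filterᵇ (not ∘ inA) ts)
    f₂ = proj₂ (proj₂ splitted)
    lem : ∀ a b → (2 ℕ.+ a) ℕ.+ (2 ℕ.+ b) ≡ 4 ℕ.+ (a ℕ.+ b)
    lem = ℕ-Solver.solve-∀
  Separated-size {r} RH (d ∷ D) {V = V} {A = A} {B} t h with Separated-∷ (Triple-cycle t) (Triple-⊆ t) h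
  ... | inj₁ h′ = subst (λ k → length V ℕ.+ k ≤ 4 ℕ.+ r) (shape-ˡ A B d D) (Separated-size RH D (Triple-ˡ t) h′)
  ... | inj₂ h′ = subst (λ k → length V ℕ.+ k ≤ 4 ℕ.+ r) (shape-ʳ A B d D) (Separated-size RH D (Triple-ʳ t) h′)

  cutsFrom : List ℕ → List ℕ → List (List ℕ × ℕ × List ℕ)
  cutsFrom u []      = []
  cutsFrom u (y ∷ v) = (u , y , v) ∷ cutsFrom (u ++ y ∷ []) v

  cutsFrom-key : ∀ u w → map (proj₁ ∘ proj₂) (cutsFrom u w) ≡ w
  cutsFrom-key u []      = refl
  cutsFrom-key u (y ∷ v) = cong (y ∷_) (cutsFrom-key _ v)

  cutsFrom-sound : ∀ u w {u′ y v′} → (u′ , y , v′) ∈ cutsFrom u w → u ++ w ≡ u′ ++ y ∷ v′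
  cutsFrom-sound u (y ∷ v) (here refl) = refl
  cutsFrom-sound u (y ∷ v) (there p)   = trans (sym (++-assoc u (y ∷ []) v)) (cutsFrom-sound (u ++ y ∷ []) v p)

  views : List (List ℕ) → List (ℕ × List ℕ × List (List ℕ))
  views []      = []
  views (d ∷ C) = map (λ (u , x , v) → x , v ++ u , C) (cutsFrom [] d) ++ map (λ (x , c , D) → x , c , d ∷ D) (views C)

  -- Every point is viewed exactly once, so classifying by a point inherits distinctness and
  -- completeness from `concat C`.
  views-key : ∀ C → map proj₁ (views C) ≡ concat C
  views-key []      = refl
  views-key (d ∷ C) = trans (map-++ proj₁ (map (λ (u , x , v) → x , v ++ u , C) (cutsFrom [] d)) _)
    (cong₂ _++_ (trans (sym (map-∘ (cutsFrom [] d))) (cutsFrom-key [] d)) (trans (sym (map-∘ (views C))) (views-key C)))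

  views-sound : ∀ C {x c D} → (x , c , D) ∈ views C → View C x c D
  views-sound (d ∷ C) p with ∈-++⁻ (map (λ (u , x , v) → x , v ++ u , C) (cutsFrom [] d)) p
  ... | inj₁ q with ∈-map⁻ (λ (u , x , v) → x , v ++ u , C) q
  ...   | (u , x , v) , m , refl = view u v (subst (λ w → Pick w C (d ∷ C)) (cutsFrom-sound [] d m) here) refl
  views-sound (d ∷ C) p | inj₂ q with ∈-map⁻ (λ (x , c , D) → x , c , d ∷ D) q
  ... | (x , c , D) , m , refl with views-sound C m
  ...   | view u v pk e = view u v (there pk) e

  ∈-View : ∀ C {x} → x ∈ concat C → ∃ λ c → ∃ λ D → View C x c D
  ∈-View C {x} h with ∈-map⁻ proj₁ (subst (x ∈_) (sym (views-key C)) h)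
  ... | (x , c , D) , m , refl = c , D , views-sound C m

  ∈-cut : ∀ c {y} → y ∈ c → ∃ λ u → ∃ λ v → c ≡ u ++ y ∷ v
  ∈-cut c {y} h with ∈-map⁻ (proj₁ ∘ proj₂) (subst (y ∈_) (sym (cutsFrom-key [] c)) h)
  ... | (u , y , v) , m , refl = u , v , cutsFrom-sound [] c m

  View-Cycles₂ : ∀ {π c D y e D′} → View D y e D′ → Cycles π (c ∷ D) → Cycles π (c ∷ (y ∷ e) ∷ D′)
  View-Cycles₂ {c = c} w (h ∷ hs , uq) =
    h ∷ proj₁ (View-Cycles w (hs , proj₁ (proj₂ (Unique-++⁻ c uq)))) , Unique-resp-↭ (++⁺ˡ c (View-↭ w)) uq

  cut-Triple : ∀ {π V x u y v D} → Cycles π ((x ∷ u ++ y ∷ v) ∷ D) → V ↭ x ∷ (u ++ y ∷ v) ++ concat D →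
               Triple (π ⟨ x , y ⟩) V x y ((x ∷ u) ∷ []) ((y ∷ v) ∷ []) D
  cut-Triple {π} {V} {x} {u} {y} {v} {D} cyc p with cut-Cycles {u = u} cyc
  ... | (h₁ ∷ h₂ ∷ hs , uq) = record
    { perm = ↭-trans p (↭-reflexive (trans (++-assoc (x ∷ u) (y ∷ v) (concat D))
               (cong₂ (λ a b → a ++ (b ++ concat D)) (sym (++-identityʳ (x ∷ u))) (sym (++-identityʳ (y ∷ v))))))
    ; unique = Unique-resp-↭ (↭-sym p) (proj₂ cyc)
    ; cyclesA = h₁ ∷ [] ; cyclesB = h₂ ∷ [] ; cyclesD = hs ; x∈A = here refl ; y∈B = here refl }

  -- Joining two cycles leaves x and y in one cycle of the product of the remaining factors.
  join-¬Sep : ∀ {r π V x y c e D ts} → Cycles (π ⟨ x , y ⟩) ((x ∷ c ++ y ∷ e) ∷ D) → V ↭ concat ((x ∷ c ++ y ∷ e) ∷ D) →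
              Pre r (π ⟨ x , y ⟩) V ts → ¬ Sep V x y ts
  join-¬Sep {c = c} (h ∷ _ , _) p q (x≁y , _) = x≁y (sym (Invariant-Cycle q (rep-Invariant _)
    (λ v∈ → ∈-resp-↭ (↭-sym p) (∈-++⁺ˡ v∈)) h (there (∈-++⁺ʳ c (here refl)))))

  join-↭ : ∀ {V x c y e D D′} → V ↭ x ∷ c ++ concat D → View D y e D′ → V ↭ concat ((x ∷ c ++ y ∷ e) ∷ D′)
  join-↭ {x = x} {c} {y} {e} {D′ = D′} p w = ↭-trans p (↭-trans (++⁺ˡ (x ∷ c) (View-↭ w)) (↭-reflexive (sym (++-assoc (x ∷ c) (y ∷ e) (concat D′)))))

  length-cycles : ∀ {π C} → All (IsCycle π) C → length C ≤ length (concat C)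
  length-cycles []                        = z≤n
  length-cycles {C = (x ∷ c) ∷ C} (_ ∷ h) = s≤s (ℕₚ.≤-trans (length-cycles h)
    (ℕₚ.≤-trans (ℕₚ.m≤n+m _ (length c)) (ℕₚ.≤-reflexive (sym (length-++ c)))))

  -- Removing the first factor changes the number of cycles by one. A join lowers the size, which
  -- fits r exactly. A cut raises it: if the rest is connected there is slack, and if it falls apart
  -- the bound 4 + r of `Separated-size` is what is required.
  riemannHurwitz : ∀ r → RiemannHurwitz r
  riemannHurwitz = <-rec RiemannHurwitz step
    where
    step : ∀ r → (∀ {s} → s < r → RiemannHurwitz s) → RiemannHurwitz r
    -- Without factors every point is its own component, so there is at most one point and at most
    -- one cycle.
    step zero rec {π} {C} {[]} (h , uq) (p , conn) = ℕₚ.+-mono-≤ n≤1 (ℕₚ.≤-trans (length-cycles h) n≤1)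
      where
      one : ∀ (V : List ℕ) → Unique V → Conn V [] → length V ≤ 1
      one []          _             _    = z≤n
      one (x ∷ [])    _             _    = s≤s z≤n
      one (x ∷ y ∷ V) ((ne ∷ _) ∷ _) conn = contradiction (conn (here refl) (there (here refl))) ne
      n≤1 : length (concat C) ≤ 1
      n≤1 = one (concat C) uq conn
    step zero rec {ts = _ ∷ _} _ (pre () _ _ , _)
    step (suc r) rec {ts = []} _ (pre () _ _ , _)
    step (suc r) rec {π} {C} {(x , y) ∷ ts} cyc (p , conn) with Pre-∷⁻ p
    ... | (x∈ , y∈ , x≢y) , q with ∈-View C x∈
    ...   | c , D , w with ∈-resp-↭ (View-↭ w) y∈
    ...     | here y≡x = contradiction (sym y≡x) x≢y
    ...     | there y∈′ with ∈-++⁻ c y∈′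
    ...       | inj₁ y∈c = subst (_≤ 2 ℕ.+ suc r) (cong (length (concat C) ℕ.+_) (sym (trans (sym (length-map length C)) (trans (Pick-length (View-Pick w)) (cong suc (length-map length D)))))) cutCase
      where
      cutCase : length (concat C) ℕ.+ suc (length D) ≤ 3 ℕ.+ r
      cutCase with ∈-cut c y∈c
      ... | u , v , refl with Conn-∷⁻ {x = x} {ts = ts} y∈ conn
      ...   | inj₁ conn′ = ℕₚ.≤-trans (ℕₚ.+-monoʳ-≤ (length (concat C)) (ℕₚ.n≤1+n (suc (length D))))
                (ℕₚ.≤-trans (subst (λ k → k ℕ.+ suc (suc (length D)) ≤ 2 ℕ.+ r) (sym (↭-length perm′)) (rec ℕₚ.≤-refl cyc′ (Fact-resp-↭ perm′ {ts = ts} (q , conn′))))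
                  (ℕₚ.n≤1+n (2 ℕ.+ r)))
                where
                cyc′ : Cycles (π ⟨ x , y ⟩) ((x ∷ u) ∷ (y ∷ v) ∷ D)
                cyc′ = cut-Cycles {u = u} (View-Cycles w cyc)
                perm′ : concat C ↭ concat ((x ∷ u) ∷ (y ∷ v) ∷ D)
                perm′ = ↭-trans (View-↭ w) (↭-reflexive (++-assoc (x ∷ u) (y ∷ v) (concat D)))
      ...   | inj₂ sep = ℕₚ.≤-pred (subst (_≤ 4 ℕ.+ r) (ℕₚ.+-suc (length (concat C)) (suc (length D)))
                (Separated-size (λ s≤r → rec (s≤s s≤r)) D t ((q , sep) , (All.tabulate sideA ∷ []) , (All.tabulate sideB ∷ []))))
                where
                t : Triple (π ⟨ x , y ⟩) (concat C) x y ((x ∷ u) ∷ []) ((y ∷ v) ∷ []) D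
                t = cut-Triple {u = u} (View-Cycles w cyc) (View-↭ w)
                sideA : ∀ {z} → z ∈ x ∷ u → rep ts z ≡ rep ts x
                sideA = Invariant-Cycle q (rep-Invariant ts) (λ z∈ → ∈-resp-↭ (↭-sym (perm t)) (∈-++⁺ˡ (∈-++⁺ˡ z∈))) (All.head (cyclesA t))
                sideB : ∀ {z} → z ∈ y ∷ v → rep ts z ≡ rep ts y
                sideB = Invariant-Cycle q (rep-Invariant ts)
                  (λ z∈ → ∈-resp-↭ (↭-sym (perm t)) (∈-++⁺ʳ (concat ((x ∷ u) ∷ [])) (∈-++⁺ˡ (∈-++⁺ˡ z∈)))) (All.head (cyclesB t))
    step (suc r) rec {π} {C} {(x , y) ∷ ts} cyc (p , conn) | (x∈ , y∈ , x≢y) , q | c , D , w | there y∈′ | inj₂ y∈D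
      with ∈-View D y∈D
    ... | e , D′ , w′ = subst (_≤ 2 ℕ.+ suc r) eq joinCase
      where
      eq : length (concat C) ℕ.+ suc (suc (length D′)) ≡ size C
      eq = cong (length (concat C) ℕ.+_) (sym (trans (sym (length-map length C)) (trans (Pick-length (View-Pick w))
             (cong suc (trans (Pick-length (View-Pick w′)) (cong suc (length-map length D′)))))))
      cyc′ : Cycles (π ⟨ x , y ⟩) ((x ∷ c ++ y ∷ e) ∷ D′)
      cyc′ = join-Cycles (View-Cycles₂ w′ (View-Cycles w cyc))
      perm′ : concat C ↭ concat ((x ∷ c ++ y ∷ e) ∷ D′)
      perm′ = join-↭ (View-↭ w) w′
      joinCase : length (concat C) ℕ.+ suc (suc (length D′)) ≤ 3 ℕ.+ r
      joinCase with Conn-∷⁻ {x = x} {ts = ts} y∈ conn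
      ... | inj₂ sep   = ⊥-elim (join-¬Sep {π = π} {c = c} {ts = ts} cyc′ perm′ q sep)
      ... | inj₁ conn′ = subst (_≤ 3 ℕ.+ r) (sym (ℕₚ.+-suc (length (concat C)) (suc (length D′))))
            (s≤s (subst (λ k → k ℕ.+ suc (length D′) ≤ 2 ℕ.+ r) (sym (↭-length perm′)) (rec ℕₚ.≤-refl cyc′ (Fact-resp-↭ perm′ {ts = ts} (q , conn′)))))

-- Counting minimal transitive factorizations by recursion on the number of factors

module Enumeration where
  open Rationals
  open Sums
  open Hurwitz using (Positive⁺)
  open Convolution using (∑⁺)
  open CutJoin using (G; cut; cut-join)
  open Counting
  open Factorizations
  open Recursion
  open Count hiding (size)

  -- The expected number of oriented factorizations: 2^r orientations, and r! times the normalised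
  -- number `G`.
  K : ℕ → List ℕ → ℚ
  K r a = 2ℚ ^ r * (ι (r !) * G a)

  FactCount : ℕ → Set
  FactCount r = ∀ {π C} → Cycles π C → size C ≡ 2 ℕ.+ r → Count (Fact r π (concat C)) (K r (map length C))

  squeeze : ∀ {a b c d} → a ≤ b → c ≤ d → b ℕ.+ d ≡ a ℕ.+ c → a ≡ b × c ≡ d
  squeeze {a} {b} {c} {d} p q e = ℕₚ.≤-antisym p b≤a , ℕₚ.≤-antisym q d≤c
    where
    b≤a : b ≤ a
    b≤a = ℕₚ.+-cancelʳ-≤ c b a (ℕₚ.≤-trans (ℕₚ.+-monoʳ-≤ b q) (ℕₚ.≤-reflexive e))
    d≤c : d ≤ c
    d≤c = ℕₚ.+-cancelˡ-≤ a d c (ℕₚ.≤-trans (ℕₚ.+-monoˡ-≤ d p) (ℕₚ.≤-reflexive e))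

  size-∸2 : ∀ {A} {v : ℕ} → v ∈ concat A → ∃ λ R → size A ≡ 2 ℕ.+ R
  size-∸2 {d ∷ A} v∈ with length (concat (d ∷ A)) | ∈-length v∈
  ... | suc n | _ = n ℕ.+ length A , cong suc (ℕₚ.+-suc n (length A))

  -- The number of interleavings, (R₁ + R₂)! / (R₁! R₂!), replaces the two factorials by a single
  -- one.
  K-shuffle : ∀ R₁ R₂ a b → K R₁ a * (K R₂ b * shuffles R₁ R₂) ≡ 2ℚ ^ (R₁ ℕ.+ R₂) * (ι ((R₁ ℕ.+ R₂) !) * (G a * G b))
  K-shuffle R₁ R₂ a b = begin
    K R₁ a * (K R₂ b * shuffles R₁ R₂)
      ≡⟨ ring (2ℚ ^ R₁) (2ℚ ^ R₂) (ι (R₁ !)) (ι (R₂ !)) (G a) (G b) (shuffles R₁ R₂) ⟩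
    2ℚ ^ R₁ * 2ℚ ^ R₂ * (shuffles R₁ R₂ * (ι (R₁ !) * ι (R₂ !)) * (G a * G b))
      ≡⟨ cong₂ (λ p q → p * (q * (G a * G b))) (sym (^-+ 2ℚ R₁ R₂)) (shuffles-! R₁ R₂) ⟩
    2ℚ ^ (R₁ ℕ.+ R₂) * (ι ((R₁ ℕ.+ R₂) !) * (G a * G b)) ∎
    where
    open ≡-Reasoning
    ring : ∀ p q f g a b s → p * (f * a) * (q * (g * b) * s) ≡ p * q * (s * (f * g) * (a * b))
    ring = solve-∀ ℚ-ring

  module _ {r} (rec : ∀ {s} → s ≤ r → FactCount s) where

    -- The hypothesis on sizes leaves no slack in Riemann-Hurwitz, so both components carry minimal
    -- factorizations, counted by the induction hypothesis and shuffled arbitrarily. Each cycle of D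
    -- is offered to either component, in parallel with the recursion of `∑⊎`.
    count-Separated : ∀ D {π V x y A B} → Triple π V x y A B D →
      length V ℕ.+ (length A ℕ.+ length B ℕ.+ length D) ≡ 4 ℕ.+ r →
      Count (Separated r π V x y A B)
            (2ℚ ^ r * (ι (r !) * ∑⊎ (map length D) (λ S T → G (map length A ++ S) * G (map length B ++ T))))
    count-Separated [] {π} {V} {x} {y} {A} {B} t e with size-∸2 {A} (Triple.x∈A t) | size-∸2 {B} (Triple.y∈B t)
    ... | R₁ , e₁ | R₂ , e₂ = count-≡ value
      (classify (filterᵇ inA) (list count₁) id _ (subst Unique (sym (map-id _)) (unique count₁)) total₁ λ {t₁} m₁ →
        classify (filterᵇ (not ∘ inA)) (list count₂) id _ (subst Unique (sym (map-id _)) (unique count₂)) total₂ λ {t₂} m₂ →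
          count-≡ (cong₂ shuffles (len (proj₁ (sound count₁ m₁))) (len (proj₁ (sound count₂ m₂))))
            (count-⇔ (from m₁ m₂) (λ ((_ , p) , q) → p , q)
              (count-shuffles inA (inA-true-All (sound count₁ m₁)) (inA-false-All (sound count₂ m₂)))))
      where
      open TwoComponents (concat A) (concat B) (Triple.disjointAB t) (Triple.x∈A t) (Triple.y∈B t)
      r≡ : R₁ ℕ.+ R₂ ≡ r
      r≡ = ℕₚ.+-cancelˡ-≡ 4 _ _ (trans (lem R₁ R₂) (trans (cong₂ ℕ._+_ (sym e₁) (sym e₂)) (trans (sym (Triple-size t)) e)))
        where
        lem : ∀ a b → 4 ℕ.+ (a ℕ.+ b) ≡ (2 ℕ.+ a) ℕ.+ (2 ℕ.+ b)
        lem = ℕ-Solver.solve-∀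
      count₁ : Count (Fact R₁ π (concat A)) (K R₁ (map length A))
      count₁ = rec (ℕₚ.≤-trans (ℕₚ.m≤m+n R₁ R₂) (ℕₚ.≤-reflexive r≡)) (Triple.CyclesA t) e₁
      count₂ : Count (Fact R₂ π (concat B)) (K R₂ (map length B))
      count₂ = rec (ℕₚ.≤-trans (ℕₚ.m≤n+m R₂ R₁) (ℕₚ.≤-reflexive r≡)) (Triple.CyclesB t) e₂
      facts : ∀ {ts} → Separated r π V x y A B ts →
              Fact R₁ π (concat A) (filterᵇ inA ts) × Fact R₂ π (concat B) (filterᵇ (not ∘ inA) ts)
      facts {ts} h with (let (p , comps) = Separated⇒Components t h in split-Fact p comps)
      -- R₁ and R₂ are the minimal lengths for the two components. The actual lengths are at least
      -- these and have the same sum, so they coincide.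
      ... | e , f₁ , f₂ with squeeze (ℕₚ.+-cancelˡ-≤ 2 _ _ (subst (_≤ 2 ℕ.+ length (filterᵇ inA ts)) e₁ (riemannHurwitz _ {ts = filterᵇ inA ts} (Triple.CyclesA t) f₁)))
                                     (ℕₚ.+-cancelˡ-≤ 2 _ _ (subst (_≤ 2 ℕ.+ length (filterᵇ (not ∘ inA) ts)) e₂ (riemannHurwitz _ {ts = filterᵇ (not ∘ inA) ts} (Triple.CyclesB t) f₂)))
                                     (trans e (sym r≡))
      ...   | q₁ , q₂ = subst (λ k → Fact k π (concat A) (filterᵇ inA ts)) (sym q₁) f₁
                      , subst (λ k → Fact k π (concat B) (filterᵇ (not ∘ inA) ts)) (sym q₂) f₂
      total₁ : ∀ {ts} → Separated r π V x y A B ts → filterᵇ inA ts ∈ map id (list count₁)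
      total₁ {ts} h = subst (filterᵇ inA ts ∈_) (sym (map-id _)) (complete count₁ (proj₁ (facts h)))
      total₂ : ∀ {t₁ ts} → Separated r π V x y A B ts × filterᵇ inA ts ≡ t₁ → filterᵇ (not ∘ inA) ts ∈ map id (list count₂)
      total₂ {ts = ts} (h , _) = subst (filterᵇ (not ∘ inA) ts ∈_) (sym (map-id _)) (complete count₂ (proj₂ (facts h)))
      from : ∀ {t₁ t₂ ts} → t₁ ∈ list count₁ → t₂ ∈ list count₂ → Shuffle inA t₁ t₂ ts →
             (Separated r π V x y A B ts × filterᵇ inA ts ≡ t₁) × filterᵇ (not ∘ inA) ts ≡ t₂
      from {ts = ts} m₁ m₂ (refl , refl) = (separated , refl) , refl
        where
        separated : Separated r π V x y A B ts
        separated = let (p , comps) = join-Fact (sound count₁ m₁) (sound count₂ m₂)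
                    in Components⇒Separated t (subst (λ k → Pre k π (concat A ++ concat B) ts) r≡ p) comps
      value : ∑ (list count₁) (λ _ → ∑ (list count₂) (λ _ → shuffles R₁ R₂))
              ≡ 2ℚ ^ r * (ι (r !) * (G (map length A ++ []) * G (map length B ++ [])))
      value = begin
        ∑ (list count₁) (λ _ → ∑ (list count₂) (λ _ → shuffles R₁ R₂))
          ≡⟨ trans (∑-const (list count₁) _) (cong (ι (length (list count₁)) *_) (∑-const (list count₂) _)) ⟩
        ι (length (list count₁)) * (ι (length (list count₂)) * shuffles R₁ R₂)
          ≡⟨ cong₂ (λ p q → p * (q * shuffles R₁ R₂)) (Count.size count₁) (Count.size count₂) ⟩
        K R₁ (map length A) * (K R₂ (map length B) * shuffles R₁ R₂)
          ≡⟨ K-shuffle R₁ R₂ (map length A) (map length B) ⟩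
        2ℚ ^ (R₁ ℕ.+ R₂) * (ι ((R₁ ℕ.+ R₂) !) * (G (map length A) * G (map length B)))
          ≡⟨ cong (λ k → 2ℚ ^ k * (ι (k !) * (G (map length A) * G (map length B)))) r≡ ⟩
        2ℚ ^ r * (ι (r !) * (G (map length A) * G (map length B)))
          ≡⟨ cong₂ (λ p q → 2ℚ ^ r * (ι (r !) * (G p * G q))) (++-identityʳ (map length A)) (++-identityʳ (map length B)) ⟨
        2ℚ ^ r * (ι (r !) * (G (map length A ++ []) * G (map length B ++ []))) ∎
        where open ≡-Reasoning
    count-Separated (d ∷ D) {π} {V} {x} {y} {A} {B} t e = count-≡ value (count-⇔
      [ Separated-ˡ⁻ A , Separated-ʳ⁻ B ]′ (Separated-∷ (Triple-cycle t) (Triple-⊆ t))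
      (count-⊎ (count-Separated D (Triple-ˡ t) (trans (cong (length V ℕ.+_) (shape-ˡ A B d D)) e))
               (count-Separated D (Triple-ʳ t) (trans (cong (length V ℕ.+_) (shape-ʳ A B d D)) e))
               (Separated-disjoint A B (Triple-cycle t))))
      where
      open ≡-Reasoning
      as : List ℕ
      as = map length D
      snoc : ∀ A S → map length (A ++ d ∷ []) ++ S ≡ map length A ++ (length d ∷ S)
      snoc A S = trans (cong (_++ S) (map-++ length A (d ∷ []))) (++-assoc (map length A) (length d ∷ []) S)
      ring : ∀ p f a b → p * (f * a) + p * (f * b) ≡ p * (f * (a + b))
      ring = solve-∀ ℚ-ring
      value : 2ℚ ^ r * (ι (r !) * ∑⊎ as (λ S T → G (map length (A ++ d ∷ []) ++ S) * G (map length B ++ T)))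
              + 2ℚ ^ r * (ι (r !) * ∑⊎ as (λ S T → G (map length A ++ S) * G (map length (B ++ d ∷ []) ++ T)))
              ≡ 2ℚ ^ r * (ι (r !) * ∑⊎ (length d ∷ as) (λ S T → G (map length A ++ S) * G (map length B ++ T)))
      value = trans (cong₂ (λ p q → 2ℚ ^ r * (ι (r !) * p) + 2ℚ ^ r * (ι (r !) * q))
          (∑⊎-cong as (λ S T → cong (λ U → G U * G (map length B ++ T)) (snoc A S)))
          (∑⊎-cong as (λ S T → cong (λ U → G (map length A ++ S) * G U) (snoc B T))))
        (ring (2ℚ ^ r) (ι (r !)) _ _)

    -- After a cut the other factors must separate x from y, with one of the two arcs on each side;
    -- only the remaining cycles are free to be distributed.
    count-cut : ∀ {π V x u y v D} → Cycles π ((x ∷ u ++ y ∷ v) ∷ D) → V ↭ x ∷ (u ++ y ∷ v) ++ concat D →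
      length V ℕ.+ suc (length D) ≡ 3 ℕ.+ r →
      Count (λ ts → Fact (suc r) π V ((x , y) ∷ ts)) (2ℚ ^ r * (ι (r !) * cut (suc (length u)) (suc (length v)) (map length D)))
    count-cut {π} {V} {x} {u} {y} {v} {D} cyc p e = count-⇔ to from
      (count-Separated D t (trans (ℕₚ.+-suc (length V) (suc (length D))) (cong suc e)))
      where
      t : Triple (π ⟨ x , y ⟩) V x y ((x ∷ u) ∷ []) ((y ∷ v) ∷ []) D
      t = cut-Triple {u = u} cyc p
      x∈ : x ∈ V
      x∈ = ∈-resp-↭ (↭-sym p) (here refl)
      y∈ : y ∈ V
      y∈ = ∈-resp-↭ (↭-sym p) (there (∈-++⁺ˡ (∈-++⁺ʳ u (here refl))))
      x≢y : x ≢ y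
      x≢y refl = Unique-∉ (proj₂ cyc) (∈-++⁺ˡ (∈-++⁺ʳ u (here refl)))
      to : ∀ {ts} → Separated r (π ⟨ x , y ⟩) V x y ((x ∷ u) ∷ []) ((y ∷ v) ∷ []) ts → Fact (suc r) π V ((x , y) ∷ ts)
      to {ts} ((q , sep) , _) = Pre-∷ (x∈ , y∈ , x≢y) q , Sep-∷ {ts = ts} sep
      from : ∀ {ts} → Fact (suc r) π V ((x , y) ∷ ts) → Separated r (π ⟨ x , y ⟩) V x y ((x ∷ u) ∷ []) ((y ∷ v) ∷ []) ts
      from {ts} (q , conn) with Pre-∷⁻ q | Conn-∷⁻ {x = x} {ts = ts} y∈ conn
      ... | _ , q′ | inj₂ sep = (q′ , sep)
        , All.tabulate (Invariant-Cycle q′ (rep-Invariant ts) (λ z∈ → ∈-resp-↭ (↭-sym (Triple.perm t)) (∈-++⁺ˡ (∈-++⁺ˡ z∈))) (All.head (Triple.cyclesA t))) ∷ []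
        , All.tabulate (Invariant-Cycle q′ (rep-Invariant ts)
            (λ z∈ → ∈-resp-↭ (↭-sym (Triple.perm t)) (∈-++⁺ʳ (concat ((x ∷ u) ∷ [])) (∈-++⁺ˡ (∈-++⁺ˡ z∈)))) (All.head (Triple.cyclesB t))) ∷ []
      -- If the other r factors were still transitive, Riemann-Hurwitz would bound the size by 2 +
      -- r, but after the cut it is 4 + r.
      ... | _ , q′ | inj₁ conn′ = ⊥-elim (ℕₚ.1+n≰n (ℕₚ.≤-trans (ℕₚ.n≤1+n (3 ℕ.+ r))
        (subst (_≤ 2 ℕ.+ r) big (riemannHurwitz r (cut-Cycles {u = u} cyc) (Fact-resp-↭ perm′ {ts = ts} (q′ , conn′))))))
        where
        perm′ : V ↭ concat ((x ∷ u) ∷ (y ∷ v) ∷ D)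
        perm′ = ↭-trans p (↭-reflexive (++-assoc (x ∷ u) (y ∷ v) (concat D)))
        big : Recursion.size ((x ∷ u) ∷ (y ∷ v) ∷ D) ≡ 4 ℕ.+ r
        big = trans (cong (ℕ._+ suc (suc (length D))) (sym (↭-length perm′))) (trans (ℕₚ.+-suc (length V) (suc (length D))) (cong suc e))

    -- The joined cycle contains both x and y, so the other factors cannot separate them and are
    -- again transitive and minimal.
    count-join : ∀ {π V x c y e D D′} → Cycles π ((x ∷ c) ∷ D) → V ↭ x ∷ c ++ concat D → View D y e D′ →
      length V ℕ.+ suc (length D) ≡ 3 ℕ.+ r →
      Count (λ ts → Fact (suc r) π V ((x , y) ∷ ts)) (K r ((suc (length c) ℕ.+ suc (length e)) ∷ map length D′))
    count-join {π} {V} {x} {c} {y} {e} {D} {D′} cyc p w l = count-⇔ to from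
      (count-≡ (cong (λ k → K r (suc k ∷ map length D′)) (length-++ c)) (rec ℕₚ.≤-refl cyc′ small))
      where
      cyc′ : Cycles (π ⟨ x , y ⟩) ((x ∷ c ++ y ∷ e) ∷ D′)
      cyc′ = join-Cycles (View-Cycles₂ w cyc)
      perm′ : V ↭ concat ((x ∷ c ++ y ∷ e) ∷ D′)
      perm′ = join-↭ p w
      small : Recursion.size ((x ∷ c ++ y ∷ e) ∷ D′) ≡ 2 ℕ.+ r
      small = ℕₚ.suc-injective (trans (sym (ℕₚ.+-suc (length (concat ((x ∷ c ++ y ∷ e) ∷ D′))) (suc (length D′)))) (trans
        (cong₂ ℕ._+_ (sym (↭-length perm′)) (cong suc (sym (trans (sym (length-map length D)) (trans (Pick-length (View-Pick w)) (cong suc (length-map length D′))))))) l))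
      y∈D : y ∈ concat D
      y∈D = ∈-resp-↭ (↭-sym (View-↭ w)) (here refl)
      x∈ : x ∈ V
      x∈ = ∈-resp-↭ (↭-sym p) (here refl)
      y∈ : y ∈ V
      y∈ = ∈-resp-↭ (↭-sym p) (there (∈-++⁺ʳ c y∈D))
      x≢y : x ≢ y
      x≢y refl = Unique-∉ (proj₂ cyc) (∈-++⁺ʳ c y∈D)
      to : ∀ {ts} → Fact r (π ⟨ x , y ⟩) (concat ((x ∷ c ++ y ∷ e) ∷ D′)) ts → Fact (suc r) π V ((x , y) ∷ ts)
      to {ts} f = let (q , conn) = Fact-resp-↭ (↭-sym perm′) {ts = ts} f in Pre-∷ (x∈ , y∈ , x≢y) q , Conn-∷ {τ = x , y} {ts = ts} conn
      from : ∀ {ts} → Fact (suc r) π V ((x , y) ∷ ts) → Fact r (π ⟨ x , y ⟩) (concat ((x ∷ c ++ y ∷ e) ∷ D′)) ts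
      from {ts} (q , conn) with Pre-∷⁻ q | Conn-∷⁻ {x = x} {ts = ts} y∈ conn
      ... | _ , q′ | inj₁ conn′ = Fact-resp-↭ perm′ {ts = ts} (q′ , conn′)
      ... | _ , q′ | inj₂ sep   = ⊥-elim (join-¬Sep {π = π} {c = c} {ts = ts} cyc′ perm′ q′ sep)

  -- The value 0 for the empty list is a dummy: the lists classified by these functions have r + 1
  -- entries.
  first second : List (ℕ × ℕ) → ℕ
  first []             = 0
  first ((x , _) ∷ _)  = x
  second []            = 0
  second ((_ , y) ∷ _) = y

  count-head : ∀ {r π V x y q} → Count (λ ts → Fact (suc r) π V ((x , y) ∷ ts)) q →
               Count (λ ts → (Fact (suc r) π V ts × first ts ≡ x) × second ts ≡ y) q
  count-head {r} {π} {V} {x} {y} h = count-⇔ (λ { (ts , f , refl) → (f , refl) , refl }) from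
    (count-image ((x , y) ∷_) (λ { refl → refl }) h)
    where
    from : ∀ {ts} → (Fact (suc r) π V ts × first ts ≡ x) × second ts ≡ y → ∃ λ us → Fact (suc r) π V ((x , y) ∷ us) × ts ≡ (x , y) ∷ us
    from {[]}     (((pre () _ _ , _) , _) , _)
    from {_ ∷ us} ((f , refl) , refl) = us , f , refl

  ∑-cutsFrom : ∀ u z w (f : ℕ → ℕ → ℚ) →
    ∑ (cutsFrom u (z ∷ w)) (λ (u′ , _ , v′) → f (length u′) (length v′)) ≡ ∑⋆ (λ i j → f (length u ℕ.+ i) j) (length w)
  ∑-cutsFrom u z []       f = trans (+-identityʳ _) (cong (λ k → f k 0) (sym (ℕₚ.+-identityʳ (length u))))
  ∑-cutsFrom u z (z′ ∷ w) f = cong₂ _+_ (cong (λ k → f k (suc (length w))) (sym (ℕₚ.+-identityʳ (length u))))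
    (trans (∑-cutsFrom (u ++ z ∷ []) z′ w f) (∑⋆-cong (length w) (λ i j → cong (λ k → f k j)
      (trans (cong (ℕ._+ i) (trans (length-++ u) (ℕₚ.+-comm (length u) 1))) (sym (ℕₚ.+-suc (length u) i))))))

  ∑-cuts : ∀ w (f : ℕ → ℕ → ℚ) → ∑ (cutsFrom [] w) (λ (u , _ , v) → f (suc (length u)) (suc (length v))) ≡ ∑⁺ f (suc (length w))
  ∑-cuts []      f = refl
  ∑-cuts (z ∷ w) f = ∑-cutsFrom [] z w (λ i j → f (suc i) (suc j))

  length-cutsFrom : ∀ u w → length (cutsFrom u w) ≡ length w
  length-cutsFrom u []      = refl
  length-cutsFrom u (y ∷ v) = cong suc (length-cutsFrom (u ++ y ∷ []) v)

  -- A cycle of length m is viewed from each of its m points with the same lengths, whence the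
  -- weight `ι m`.
  ∑-views : ∀ C (Q : ℕ → List ℕ → ℚ) → ∑ (views C) (λ (_ , c , D) → Q (suc (length c)) (map length D)) ≡ ∑∈ (map length C) (λ m as → ι m * Q m as)
  ∑-views []      Q = refl
  ∑-views (d ∷ C) Q = begin
    ∑ (map (λ (u , x , v) → x , v ++ u , C) (cutsFrom [] d) ++ map (λ (x , c , D) → x , c , d ∷ D) (views C)) q
      ≡⟨ ∑-++ (map (λ (u , x , v) → x , v ++ u , C) (cutsFrom [] d)) _ q ⟩
    _ ≡⟨ cong₂ _+_ (trans (∑-map _ (cutsFrom [] d) q) (trans (∑-cong-∈ (cutsFrom [] d) const)
                      (trans (∑-const (cutsFrom [] d) _) (cong (λ k → ι k * Q (length d) (map length C)) (length-cutsFrom [] d)))))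
                   (trans (∑-map _ (views C) q) (∑-views C (λ m as → Q m (length d ∷ as)))) ⟩
    ι (length d) * Q (length d) (map length C) + ∑∈ (map length C) (λ m as → ι m * Q m (length d ∷ as)) ∎
    where
    open ≡-Reasoning
    q : ℕ × List ℕ × List (List ℕ) → ℚ
    q (_ , c , D) = Q (suc (length c)) (map length D)
    const : ∀ {w} → w ∈ cutsFrom [] d → q (let (u , x , v) = w in x , v ++ u , C) ≡ Q (length d) (map length C)
    const {u , x , v} m = cong (λ k → Q k (map length C)) (sym (trans (cong length (cutsFrom-sound [] d m)) (View-length u {x} v)))

  sum-lengths : ∀ C → sum (map length C) ≡ length (concat {A = ℕ} C)
  sum-lengths []      = refl
  sum-lengths (d ∷ C) = trans (cong (length d ℕ.+_) (sum-lengths C)) (sym (length-++ d))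

  positive-lengths : ∀ {π C} → All (IsCycle π) C → Positive⁺ (map length C)
  positive-lengths []                  = []
  positive-lengths {C = (_ ∷ _) ∷ _} (_ ∷ h) = s≤s z≤n ∷ positive-lengths h

  -- Factorizations are classified by the point x of the first factor and then by its point y. The
  -- resulting recursion has the shape of the left side of `cut-join`, whose right side supplies the
  -- factor that leads from r! to (r + 1)!.
  factCount : ∀ r → FactCount r
  factCount = <-rec FactCount step
    where
    step : ∀ r → (∀ {s} → s < r → FactCount s) → FactCount r
    step zero rec {π} {(x ∷ []) ∷ []} ((e ∷ []) , _) _ = count-≡ value (count-⇔ to from (count-singleton []))
      where
      to : ∀ {ts} → ts ≡ [] → Fact 0 π (x ∷ []) ts
      to refl = pre refl [] (λ { (here refl) → sym e }) , λ { (here refl) (here refl) → refl }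
      from : ∀ {ts} → Fact 0 π (x ∷ []) ts → ts ≡ []
      from {[]}    _                = refl
      from {_ ∷ _} (pre () _ _ , _)
      value : 1ℚ ≡ K 0 (1 ∷ [])
      value = sym (trans (cong₂ (λ o i → 1ℚ * (o * ((o * (o * 1ℚ * i) * 1ℚ) * (o * 1ℚ * (i * i * i))))) ι-1 inv-1) refl)
    -- The other shapes are impossible: size 2 with nonempty cycles means one cycle with one point.
    step zero rec {π} {[]} _ ()
    step zero rec {π} {[] ∷ _} (() ∷ _ , _) _
    step zero rec {π} {(x ∷ y ∷ c) ∷ C} _ e with trans (sym (ℕₚ.+-suc (length (c ++ concat C)) (length C))) (ℕₚ.suc-injective (ℕₚ.suc-injective e))
    ... | ()
    step zero rec {π} {(x ∷ []) ∷ [] ∷ C} (_ ∷ () ∷ _ , _) _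
    step zero rec {π} {(x ∷ []) ∷ (y ∷ c) ∷ C} _ e with trans (sym (ℕₚ.+-suc (length (c ++ concat C)) (suc (length C)))) (ℕₚ.suc-injective (ℕₚ.suc-injective e))
    ... | ()
    step (suc r) rec {π} {C} cyc e = count-≡ total-value
      (classify first (views C) proj₁ (λ (_ , c , D) → h (suc (length c)) (map length D))
        (subst Unique (sym (views-key C)) (proj₂ cyc)) total₁ λ m → level₂ (views-sound C m))
      where
      V a : List ℕ
      V = concat C
      a = map length C
      rec′ : ∀ {s} → s ≤ r → FactCount s
      rec′ s≤r = rec (s≤s s≤r)
      h : ℕ → List ℕ → ℚ
      h m as = 2ℚ ^ r * (ι (r !) * (∑⁺ (λ b b′ → cut b b′ as) m + ∑∈ as (λ d as′ → ι d * G ((m ℕ.+ d) ∷ as′))))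
      total₁ : ∀ {ts} → Fact (suc r) π V ts → first ts ∈ map proj₁ (views C)
      total₁ {[]}    (pre () _ _ , _)
      total₁ {_ ∷ _} (p , _) = subst (_ ∈_) (sym (views-key C)) (proj₁ (All.head (valid p)))
      level₂ : ∀ {x c D} → View C x c D → Count (λ ts → Fact (suc r) π V ts × first ts ≡ x) (h (suc (length c)) (map length D))
      level₂ {x} {c} {D} w = count-≡ value
        (classify second (map inj₁ (cutsFrom [] c) ++ map inj₂ (views D)) key q
          (subst Unique (sym keys) (proj₁ (proj₂ (Unique-++⁻ (x ∷ []) (proj₂ cyc′))))) total₂ each)
        where
        cyc′ : Cycles π ((x ∷ c) ∷ D)
        cyc′ = View-Cycles w cyc
        l : length V ℕ.+ suc (length D) ≡ 3 ℕ.+ r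
        l = trans (cong (length V ℕ.+_) (sym (trans (sym (length-map length C)) (trans (Pick-length (View-Pick w)) (cong suc (length-map length D)))))) e
        -- The point y is either a later point of the cycle of x, giving a cut, or a point of
        -- another cycle, giving a join.
        I : Set
        I = (List ℕ × ℕ × List ℕ) ⊎ (ℕ × List ℕ × List (List ℕ))
        key : I → ℕ
        key (inj₁ (_ , y , _)) = y
        key (inj₂ (y , _))     = y
        q : I → ℚ
        q (inj₁ (u , _ , v))  = 2ℚ ^ r * (ι (r !) * cut (suc (length u)) (suc (length v)) (map length D))
        q (inj₂ (_ , d , D′)) = K r ((suc (length c) ℕ.+ suc (length d)) ∷ map length D′)
        keys : map key (map inj₁ (cutsFrom [] c) ++ map inj₂ (views D)) ≡ c ++ concat D
        keys = trans (map-++ key (map inj₁ (cutsFrom [] c)) _)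
          (cong₂ _++_ (trans (sym (map-∘ (cutsFrom [] c))) (cutsFrom-key [] c)) (trans (sym (map-∘ (views D))) (views-key D)))
        total₂ : ∀ {ts} → Fact (suc r) π V ts × first ts ≡ x → second ts ∈ map key (map inj₁ (cutsFrom [] c) ++ map inj₂ (views D))
        total₂ {[]}    ((pre () _ _ , _) , _)
        total₂ {_ ∷ _} ((p , _) , refl) with All.head (valid p)
        ... | _ , y∈ , x≢y with ∈-resp-↭ (View-↭ w) y∈
        ...   | here y≡x  = contradiction (sym y≡x) x≢y
        ...   | there y∈′ = subst (_ ∈_) (sym keys) y∈′
        each : ∀ {i} → i ∈ map inj₁ (cutsFrom [] c) ++ map inj₂ (views D) →
               Count (λ ts → (Fact (suc r) π V ts × first ts ≡ x) × second ts ≡ key i) (q i)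
        each {i} i∈ with ∈-++⁻ (map inj₁ (cutsFrom [] c)) i∈
        ... | inj₁ m with ∈-map⁻ inj₁ m
        ...   | (u , y , v) , m′ , refl with cutsFrom-sound [] c m′
        ...     | refl = count-head (count-cut rec′ {u = u} cyc′ (View-↭ w) l)
        each {i} i∈ | inj₂ m with ∈-map⁻ inj₂ m
        ... | (y , d , D′) , m′ , refl = count-head (count-join rec′ cyc′ (View-↭ w) (views-sound D m′) l)
        value : ∑ (map inj₁ (cutsFrom [] c) ++ map inj₂ (views D)) q ≡ h (suc (length c)) (map length D)
        value = begin
          ∑ (map inj₁ (cutsFrom [] c) ++ map inj₂ (views D)) q
            ≡⟨ trans (∑-++ (map inj₁ (cutsFrom [] c)) _ q) (cong₂ _+_ (∑-map inj₁ (cutsFrom [] c) q) (∑-map inj₂ (views D) q)) ⟩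
          ∑ (cutsFrom [] c) (q ∘ inj₁) + ∑ (views D) (q ∘ inj₂)
            ≡⟨ cong₂ _+_ (trans (sym (trans (cong (2ℚ ^ r *_) (∑-*ˡ (cutsFrom [] c) (ι (r !)) _)) (∑-*ˡ (cutsFrom [] c) (2ℚ ^ r) _)))
                                (cong (λ z → 2ℚ ^ r * (ι (r !) * z)) (∑-cuts c (λ b b′ → cut b b′ (map length D)))))
                         (trans (∑-views D (λ m as → K r ((suc (length c) ℕ.+ m) ∷ as)))
                           (trans (∑∈-cong (map length D) (λ m as → ring (ι m) (2ℚ ^ r) (ι (r !)) (G ((suc (length c) ℕ.+ m) ∷ as))))
                             (sym (trans (cong (2ℚ ^ r *_) (∑∈-*ˡ (map length D) (ι (r !)) _)) (∑∈-*ˡ (map length D) (2ℚ ^ r) _))))) ⟩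
          2ℚ ^ r * (ι (r !) * ∑⁺ (λ b b′ → cut b b′ (map length D)) (suc (length c)))
            + 2ℚ ^ r * (ι (r !) * ∑∈ (map length D) (λ d as′ → ι d * G ((suc (length c) ℕ.+ d) ∷ as′)))
            ≡⟨ ring′ (2ℚ ^ r) (ι (r !)) _ _ ⟩
          h (suc (length c)) (map length D) ∎
          where
          open ≡-Reasoning
          ring : ∀ m p f g → m * (p * (f * g)) ≡ p * (f * (m * g))
          ring = solve-∀ ℚ-ring
          ring′ : ∀ p f x y → p * (f * x) + p * (f * y) ≡ p * (f * (x + y))
          ring′ = solve-∀ ℚ-ring
      n≥1 : 1 ≤ sum a
      n≥1 = ℕₚ.≤-trans (go (length V) refl) (ℕₚ.≤-reflexive (sym (sum-lengths C)))
        where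
        go : ∀ n → length V ≡ n → 1 ≤ length V
        go (suc n) n≡ = subst (1 ≤_) (sym n≡) (s≤s z≤n)
        go zero    n≡ = contradiction (trans (sym e) (trans (cong (ℕ._+ length C) n≡) (ℕₚ.n≤0⇒n≡0 (ℕₚ.≤-trans (length-cycles (proj₁ cyc)) (ℕₚ.≤-reflexive n≡))))) λ ()
      total-value : ∑ (views C) (λ (_ , c , D) → h (suc (length c)) (map length D)) ≡ K (suc r) a
      total-value = begin
        ∑ (views C) (λ (_ , c , D) → h (suc (length c)) (map length D))
          ≡⟨ ∑-views C h ⟩
        ∑∈ a (λ m as → ι m * h m as)
          ≡⟨ ∑∈-cong a (λ m as → ring (ι m) (2ℚ ^ r) (ι (r !)) _) ⟩
        ∑∈ a (λ m as → 2ℚ ^ r * ι (r !) * (ι m * (∑⁺ (λ b b′ → cut b b′ as) m + ∑∈ as (λ d as′ → ι d * G ((m ℕ.+ d) ∷ as′)))))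
          ≡⟨ ∑∈-*ˡ a (2ℚ ^ r * ι (r !)) _ ⟨
        2ℚ ^ r * ι (r !) * ∑∈ a (λ m as → ι m * (∑⁺ (λ b b′ → cut b b′ as) m + ∑∈ as (λ d as′ → ι d * G ((m ℕ.+ d) ∷ as′))))
          ≡⟨ cong (2ℚ ^ r * ι (r !) *_) (cut-join (positive-lengths (proj₁ cyc)) n≥1) ⟩
        2ℚ ^ r * ι (r !) * (2ℚ * ((ι (sum a) + ι (length a) - 2ℚ) * G a))
          ≡⟨ cong (λ z → 2ℚ ^ r * ι (r !) * (2ℚ * (z * G a))) excess ⟩
        2ℚ ^ r * ι (r !) * (2ℚ * (ι (suc r) * G a))
          ≡⟨ ring′ (2ℚ ^ r) (ι (r !)) (ι (suc r)) (G a) ⟩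
        2ℚ * 2ℚ ^ r * (ι (suc r) * ι (r !) * G a)
          ≡⟨ cong (λ z → 2ℚ * 2ℚ ^ r * (z * G a)) (ι-* (suc r) (r !)) ⟨
        K (suc r) a ∎
        where
        open ≡-Reasoning
        ring : ∀ m p f x → m * (p * (f * x)) ≡ p * f * (m * x)
        ring = solve-∀ ℚ-ring
        ring′ : ∀ p f s g → p * f * (2ℚ * (s * g)) ≡ 2ℚ * p * (s * f * g)
        ring′ = solve-∀ ℚ-ring
        ring″ : ∀ s → 1ℚ + (1ℚ + s) - 2ℚ ≡ s
        ring″ = solve-∀ ℚ-ring
        excess : ι (sum a) + ι (length a) - 2ℚ ≡ ι (suc r)
        excess = begin
          ι (sum a) + ι (length a) - 2ℚ    ≡⟨ cong (_- 2ℚ) (ι-+ (sum a) (length a)) ⟨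
          ι (sum a ℕ.+ length a) - 2ℚ      ≡⟨ cong (λ k → ι k - 2ℚ) (trans (cong₂ ℕ._+_ (sum-lengths C) (length-map length C)) e) ⟩
          ι (3 ℕ.+ r) - 2ℚ                 ≡⟨ cong (_- 2ℚ) (trans (ι-suc (2 ℕ.+ r)) (cong (1ℚ +_) (ι-suc (suc r)))) ⟩
          1ℚ + (1ℚ + ι (suc r)) - 2ℚ       ≡⟨ ring″ (ι (suc r)) ⟩
          ι (suc r) ∎

-- From oriented factorizations to the numbers `H`: the Goulden-Jackson formula

module GouldenJackson where
  open import Function.Bundles using (Equivalence)
  open import Defs using (swap; prodT; canonFrom; canonPerm; IsTransposition; Counted; IsHurwitzNumber)
  open Rationals
  open Sums using (∑; ∑-const)
  open Hurwitz using (Positive⁺)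
  open CutJoin using (G)
  open Counting
  open Factorizations
  open Recursion
  open Enumeration

  ≤ᵇ-true : ∀ {m n} → m ≤ n → (m ≤ᵇ n) ≡ true
  ≤ᵇ-true {m} {n} h with m ≤ᵇ n | ℕₚ.≤⇒≤ᵇ h
  ... | true | _ = refl

  ≤ᵇ-false : ∀ {m n} → n < m → (m ≤ᵇ n) ≡ false
  ≤ᵇ-false {m} {n} h with m ≤ᵇ n in e
  ... | false = refl
  ... | true  = contradiction (ℕₚ.≤ᵇ⇒≤ m n (subst T (sym e) _)) (ℕₚ.<⇒≱ h)

  range : ℕ → ℕ → List ℕ
  range s zero    = []
  range s (suc k) = s ∷ range (suc s) k

  ∈-range⁺ : ∀ s k {v} → s ≤ v → v < s ℕ.+ k → v ∈ range s k
  ∈-range⁺ s zero    {v} p q = contradiction (subst (v <_) (ℕₚ.+-identityʳ s) q) (ℕₚ.≤⇒≯ p)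
  ∈-range⁺ s (suc k) {v} p q with s ℕ.≟ v
  ... | yes refl = here refl
  ... | no s≢v   = there (∈-range⁺ (suc s) k (ℕₚ.≤∧≢⇒< p s≢v) (subst (v <_) (ℕₚ.+-suc s k) q))

  ∈-range⁻ : ∀ s k {v} → v ∈ range s k → s ≤ v × v < s ℕ.+ k
  ∈-range⁻ s (suc k) (here refl) = ℕₚ.≤-refl , ℕₚ.m<m+n s (s≤s z≤n)
  ∈-range⁻ s (suc k) {v} (there p) with ∈-range⁻ (suc s) k p
  ... | a , b = ℕₚ.≤-trans (ℕₚ.n≤1+n s) a , subst (v <_) (sym (ℕₚ.+-suc s k)) b

  Unique-range : ∀ s k → Unique (range s k)
  Unique-range s zero    = []
  Unique-range s (suc k) = All.tabulate (λ v∈ e → ℕₚ.<-irrefl e (proj₁ (∈-range⁻ (suc s) k v∈))) ∷ Unique-range (suc s) k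

  range-++ : ∀ s k m → range s (k ℕ.+ m) ≡ range s k ++ range (s ℕ.+ k) m
  range-++ s zero    m = cong (λ z → range z m) (sym (ℕₚ.+-identityʳ s))
  range-++ s (suc k) m = cong (s ∷_) (trans (range-++ (suc s) k m) (cong (λ z → range (suc s) k ++ range z m) (sym (ℕₚ.+-suc s k))))

  length-range : ∀ s k → length (range s k) ≡ k
  length-range s zero    = refl
  length-range s (suc k) = cong suc (length-range (suc s) k)

  blocks : List ℕ → ℕ → List (List ℕ)
  blocks []      s = []
  blocks (a ∷ α) s = range s a ∷ blocks α (s ℕ.+ a)

  concat-blocks : ∀ α s → concat (blocks α s) ≡ range s (sum α)
  concat-blocks []      s = refl
  concat-blocks (a ∷ α) s = trans (cong (range s a ++_) (concat-blocks α (s ℕ.+ a))) (sym (range-++ s a (sum α)))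

  length-blocks : ∀ α s → map length (blocks α s) ≡ α
  length-blocks []      s = refl
  length-blocks (a ∷ α) s = cong₂ _∷_ (length-range s a) (length-blocks α (s ℕ.+ a))

  canon-next : ∀ {a α s x} → suc (suc x) ≤ s ℕ.+ a → canonFrom (a ∷ α) s x ≡ suc x
  canon-next {a} {α} {s} {x} h rewrite ≤ᵇ-true {suc x} {s ℕ.+ a} (ℕₚ.≤-trans (ℕₚ.n≤1+n _) h) | ≤ᵇ-true h = refl

  canon-last : ∀ {a α s x} → suc x ≡ s ℕ.+ a → canonFrom (a ∷ α) s x ≡ s
  canon-last {a} {α} {s} {x} h rewrite ≤ᵇ-true (ℕₚ.≤-reflexive h) | ≤ᵇ-false {suc (suc x)} {s ℕ.+ a} (s≤s (ℕₚ.≤-reflexive (sym h))) = refl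

  canon-later : ∀ {a α s x} → s ℕ.+ a ≤ x → canonFrom (a ∷ α) s x ≡ canonFrom α (s ℕ.+ a) x
  canon-later {a} {α} {s} {x} h rewrite ≤ᵇ-false {suc x} {s ℕ.+ a} (s≤s h) = refl

  Chain-cong : ∀ {π ρ : ℕ → ℕ} {x z} p → (∀ {v} → v ∈ x ∷ p → ρ v ≡ π v) → Chain π x p z → Chain ρ x p z
  Chain-cong []      h e       = trans (h (here refl)) e
  Chain-cong (c ∷ p) h (e , k) = trans (h (here refl)) e , Chain-cong p (h ∘ there) k

  canon-IsCycle : ∀ {α s} → Positive⁺ α → All (IsCycle (canonFrom α s)) (blocks α s)
  canon-IsCycle []                       = []
  canon-IsCycle {suc k ∷ α} {s} (_ ∷ h) = chain s k refl ∷ later (blocks α (s ℕ.+ suc k)) ≥-blocks (canon-IsCycle h)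
    where
    chain : ∀ x k′ → x ℕ.+ suc k′ ≡ s ℕ.+ suc k → Chain (canonFrom (suc k ∷ α) s) x (range (suc x) k′) s
    chain x zero     e = canon-last {suc k} {α} (trans (ℕₚ.+-comm 1 x) e)
    chain x (suc k′) e = canon-next {suc k} {α} {s} (ℕₚ.≤-trans (ℕₚ.m≤m+n (suc (suc x)) k′)
                           (ℕₚ.≤-reflexive (trans (sym (trans (ℕₚ.+-suc x (suc k′)) (cong suc (ℕₚ.+-suc x k′)))) e)))
                       , chain (suc x) k′ (trans (sym (ℕₚ.+-suc x (suc k′))) e)
    ≥-blocks : ∀ {v} → v ∈ concat (blocks α (s ℕ.+ suc k)) → s ℕ.+ suc k ≤ v
    ≥-blocks {v} v∈ = proj₁ (∈-range⁻ (s ℕ.+ suc k) (sum α) (subst (v ∈_) (concat-blocks α _) v∈))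
    later : ∀ C → (∀ {v} → v ∈ concat C → s ℕ.+ suc k ≤ v) → All (IsCycle (canonFrom α (s ℕ.+ suc k))) C →
            All (IsCycle (canonFrom (suc k ∷ α) s)) C
    later []            _ []       = []
    later ((e ∷ d) ∷ C) b (c ∷ cs) =
      Chain-cong d (λ v∈ → canon-later {suc k} {α} {s} (b (∈-++⁺ˡ v∈))) c ∷ later C (λ v∈ → b (∈-++⁺ʳ (e ∷ d) v∈)) cs

  canon-Cycles : ∀ {α} → Positive⁺ α → Cycles (canonPerm α) (blocks α 0)
  canon-Cycles {α} h = canon-IsCycle h , subst Unique (sym (concat-blocks α 0)) (Unique-range 0 (sum α))

  normalise : ℕ × ℕ → ℕ × ℕ
  normalise (i , j) = if i <ᵇ j then (i , j) else (j , i)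

  normalise-cases : ∀ i j → (normalise (i , j) ≡ (i , j) × i < j) ⊎ (normalise (i , j) ≡ (j , i) × j ≤ i)
  normalise-cases i j with i <ᵇ j in e
  ... | true  = inj₁ (refl , ℕₚ.<ᵇ⇒< i j (subst T (sym e) _))
  ... | false = inj₂ (refl , ℕₚ.≮⇒≥ (λ h → subst T e (ℕₚ.<⇒<ᵇ h)))

  normalise-id : ∀ {i j} → i < j → normalise (i , j) ≡ (i , j)
  normalise-id {i} {j} h with normalise-cases i j
  ... | inj₁ (e , _) = e
  ... | inj₂ (_ , g) = contradiction h (ℕₚ.≤⇒≯ g)

  normalise-flip : ∀ {i j} → i < j → normalise (j , i) ≡ (i , j)
  normalise-flip {i} {j} h with normalise-cases j i
  ... | inj₁ (_ , g) = contradiction h (ℕₚ.<⇒≯ g)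
  ... | inj₂ (e , _) = e

  prodT-normalise : ∀ ts x → prodT (map normalise ts) x ≡ prodT ts x
  prodT-normalise []             x = refl
  prodT-normalise ((i , j) ∷ ts) x = trans (swap-normalise (prodT (map normalise ts) x)) (cong (swap (i , j)) (prodT-normalise ts x))
    where
    swap-normalise : ∀ x → swap (normalise (i , j)) x ≡ swap (i , j) x
    swap-normalise x with normalise-cases i j
    ... | inj₁ (e , _) = cong (λ τ → swap τ x) e
    ... | inj₂ (e , _) = trans (cong (λ τ → swap τ x) e) (swap-reverse j i x)

  Invariant-normalise : ∀ {f} ts → Invariant f ts → Invariant f (map normalise ts)
  Invariant-normalise     []             []       = []
  Invariant-normalise {f} ((i , j) ∷ ts) (e ∷ es) = edge ∷ Invariant-normalise ts es
    where
    edge : f (proj₁ (normalise (i , j))) ≡ f (proj₂ (normalise (i , j)))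
    edge with normalise-cases i j
    ... | inj₁ (q , _) rewrite q = e
    ... | inj₂ (q , _) rewrite q = sym e

  Invariant-normalise⁻ : ∀ {f} ts → Invariant f (map normalise ts) → Invariant f ts
  Invariant-normalise⁻     []             []       = []
  Invariant-normalise⁻ {f} ((i , j) ∷ ts) (e ∷ es) = edge e ∷ Invariant-normalise⁻ ts es
    where
    edge : f (proj₁ (normalise (i , j))) ≡ f (proj₂ (normalise (i , j))) → f i ≡ f j
    edge e with normalise-cases i j
    ... | inj₁ (q , _) rewrite q = e
    ... | inj₂ (q , _) rewrite q = sym e

  -- Each entry has exactly two preimages under `normalise`, distinct because i < j.
  count-orientations : ∀ {us} → All (λ τ → proj₁ τ < proj₂ τ) us → Count (λ ts → map normalise ts ≡ us) (2ℚ ^ length us)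
  count-orientations []  = count-⇔ (λ { refl → refl }) (λ { {[]} _ → refl ; {_ ∷ _} () }) (count-singleton [])
  count-orientations {(i , j) ∷ us} (i<j ∷ h) = count-≡ (ring (2ℚ ^ length us)) (count-⇔ to from (count-⊎
    (count-image ((i , j) ∷_) (λ { refl → refl }) (count-orientations h))
    (count-image ((j , i) ∷_) (λ { refl → refl }) (count-orientations h))
    λ { (_ , _ , refl) (_ , _ , refl) → ℕₚ.<-irrefl refl i<j }))
    where
    ring : ∀ x → x + x ≡ 2ℚ * x
    ring = solve-∀ ℚ-ring
    to : ∀ {ts} → (∃ λ v → map normalise v ≡ us × ts ≡ (i , j) ∷ v) ⊎ (∃ λ v → map normalise v ≡ us × ts ≡ (j , i) ∷ v) →
         map normalise ts ≡ (i , j) ∷ us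
    to (inj₁ (v , e , refl)) = cong₂ _∷_ (normalise-id i<j) e
    to (inj₂ (v , e , refl)) = cong₂ _∷_ (normalise-flip i<j) e
    from : ∀ {ts} → map normalise ts ≡ (i , j) ∷ us →
           (∃ λ v → map normalise v ≡ us × ts ≡ (i , j) ∷ v) ⊎ (∃ λ v → map normalise v ≡ us × ts ≡ (j , i) ∷ v)
    from {(k , l) ∷ ts} e with normalise-cases k l
    from {(k , l) ∷ ts} e | inj₁ (q , _) rewrite q with e
    ... | refl = inj₁ (ts , refl , refl)
    from {(k , l) ∷ ts} e | inj₂ (q , _) rewrite q with e
    ... | refl = inj₂ (ts , refl , refl)

  Reach : List (ℕ × ℕ) → ℕ → ℕ → Set
  Reach ts x y = ∃ λ w → All (λ τ → τ ∈ ts) w × prodT w x ≡ y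

  Reach-refl : ∀ {ts x} → Reach ts x x
  Reach-refl = [] , [] , refl

  Reach-trans : ∀ {ts x y z} → Reach ts x y → Reach ts y z → Reach ts x z
  Reach-trans {x = x} (w , h , refl) (w′ , h′ , refl) = w′ ++ w , Allₚ.++⁺ h′ h , prodT-++ w′
    where
    prodT-++ : ∀ w′ → prodT (w′ ++ w) x ≡ prodT w′ (prodT w x)
    prodT-++ []       = refl
    prodT-++ (τ ∷ w′) = cong (swap τ) (prodT-++ w′)

  -- Generators are involutions, so a word is undone by its reversal and no inverses are needed in
  -- words.
  Reach-sym : ∀ {ts x y} → Reach ts x y → Reach ts y x
  Reach-sym         ([] , [] , refl)            = Reach-refl
  Reach-sym {x = x} ((i , j) ∷ w , m ∷ h , refl) =
    Reach-trans ((i , j) ∷ [] , m ∷ [] , swap-involutive i j (prodT w x)) (Reach-sym (w , h , refl))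

  Reach-∷ : ∀ {τ ts x y} → Reach ts x y → Reach (τ ∷ ts) x y
  Reach-∷ (w , h , e) = w , All.map there h , e

  -- When a merge moves the representative of v, the new one is reached along v, rep v = rep i, i,
  -- j, rep j, crossing the new edge once.
  Reach-rep : ∀ ts v → Reach ts v (rep ts v)
  Reach-rep []             v = Reach-refl
  Reach-rep ((i , j) ∷ ts) v with rep ts v ℕ.≟ rep ts i
  ... | yes e = subst (Reach ((i , j) ∷ ts) v) (sym (trans (cong (merge (rep ts i) (rep ts j)) e) (merge-≡ (rep ts i) (rep ts j))))
    (Reach-trans (Reach-∷ (subst (Reach ts v) e (Reach-rep ts v)))
      (Reach-trans (Reach-∷ (Reach-sym (Reach-rep ts i)))
        (Reach-trans ((i , j) ∷ [] , here refl ∷ [] , swap-≡ˡ i j) (Reach-∷ (Reach-rep ts j)))))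
  ... | no ¬e = subst (Reach ((i , j) ∷ ts) v) (sym (merge-≢ (rep ts j) ¬e)) (Reach-∷ (Reach-rep ts v))

  module _ {n α} (sum≡ : sum α ≡ n) {r} (r≡ : r ≡ n ℕ.+ length α ∸ 2) where

    V : List ℕ
    V = concat (blocks α 0)

    ∈V⁺ : ∀ {v} → v < n → v ∈ V
    ∈V⁺ {v} h = subst (v ∈_) (sym (concat-blocks α 0)) (∈-range⁺ 0 (sum α) z≤n (subst (v <_) (sym sum≡) h))

    ∈V⁻ : ∀ {v} → v ∈ V → v < n
    ∈V⁻ {v} h = subst (v <_) sum≡ (proj₂ (∈-range⁻ 0 (sum α) (subst (v ∈_) (concat-blocks α 0) h)))

    Fact⇒Counted : ∀ {ts} → Fact r (canonPerm α) V ts → Counted n α (map normalise ts)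
    Fact⇒Counted {ts} (p , conn) =
      trans (length-map normalise ts) (trans (len p) r≡)
      , Allₚ.map⁺ (All.map transposition (valid p))
      , (λ x x<n → trans (prodT-normalise ts x) (prod p (∈V⁺ x<n)))
      , λ x y x<n y<n → Reach-trans (Reach-rep (map normalise ts) x)
          (subst (λ z → Reach (map normalise ts) z y) (sym (connected (∈V⁺ x<n) (∈V⁺ y<n))) (Reach-sym (Reach-rep (map normalise ts) y)))
      where
      transposition : ∀ {τ} → Valid V τ → IsTransposition n (normalise τ)
      transposition {i , j} (i∈ , j∈ , i≢j) with normalise-cases i j
      ... | inj₁ (e , i<j) rewrite e = i<j , ∈V⁻ j∈
      ... | inj₂ (e , j≤i) rewrite e = ℕₚ.≤∧≢⇒< j≤i (i≢j ∘ sym) , ∈V⁻ i∈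
      connected : Conn V (map normalise ts)
      connected {u} {v} u∈ v∈ = trans (sym (Invariant-rep edges u)) (trans (cong (rep (map normalise ts)) (conn u∈ v∈)) (Invariant-rep edges v))
        where
        edges : Invariant (rep (map normalise ts)) ts
        edges = Invariant-normalise⁻ ts (rep-Invariant (map normalise ts))

    -- A word in the generators preserves `rep ts`, so transitivity leaves a single representative
    -- on V.
    Counted⇒Fact : ∀ {ts} → Counted n α (map normalise ts) → Fact r (canonPerm α) V ts
    Counted⇒Fact {ts} (l , h , p , trans-gen) =
      pre (trans (sym (length-map normalise ts)) (trans l (sym r≡))) (All.map valid′ (Allₚ.map⁻ h))
          (λ {v} v∈ → trans (sym (prodT-normalise ts v)) (p v (∈V⁻ v∈)))
      , connected
      where
      valid′ : ∀ {τ} → IsTransposition n (normalise τ) → Valid V τ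
      valid′ {i , j} t with normalise-cases i j
      valid′ {i , j} t | inj₁ (e , _) rewrite e = let (i<j , j<n) = t in ∈V⁺ (ℕₚ.<-trans i<j j<n) , ∈V⁺ j<n , λ q → ℕₚ.<-irrefl q i<j
      valid′ {i , j} t | inj₂ (e , _) rewrite e = let (j<i , i<n) = t in ∈V⁺ i<n , ∈V⁺ (ℕₚ.<-trans j<i i<n) , λ q → ℕₚ.<-irrefl (sym q) j<i
      connected : Conn V ts
      connected {u} {v} u∈ v∈ with trans-gen u v (∈V⁻ u∈) (∈V⁻ v∈)
      ... | w , w⊆ , e = trans (sym (Invariant-prodT {rep ts} (All.map (All.lookup edges) w⊆) u)) (cong (rep ts) e)
        where
        edges : Invariant (rep ts) (map normalise ts)
        edges = Invariant-normalise ts (rep-Invariant ts)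

  2^-inverse : ∀ r → 2ℚ ^ r * ½ ^ r ≡ 1ℚ
  2^-inverse zero    = refl
  2^-inverse (suc r) = trans (ring (2ℚ ^ r) ½ (½ ^ r)) (trans (cong (_* (2ℚ ^ r * ½ ^ r)) {x = 2ℚ * ½} refl) (trans (*-identityˡ _) (2^-inverse r)))
    where
    ring : ∀ a h b → 2ℚ * a * (h * b) ≡ (2ℚ * h) * (a * b)
    ring = solve-∀ ℚ-ring

  -- Oriented factorizations are counted twice: as 2^r lifts of each tuple in L, and by `factCount`
  -- for the canonical permutation. The power of 2 then cancels.
  gouldenJackson : ∀ {n α h} → 1 ≤ n → Positive⁺ α → sum α ≡ n → IsHurwitzNumber n α h → ι h ≡ ι ((n ℕ.+ length α ∸ 2) !) * G α
  gouldenJackson {n} {α} {h} n≥1 pos sum≡ (L , uniqueL , L⇔ , lenL) = cancelˡ-inv (2ℚ ^ r) (½ ^ r) (2^-inverse r)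
    (trans (*-comm (2ℚ ^ r) (ι h)) (trans (cong (λ k → ι k * 2ℚ ^ r) (sym lenL)) (trans (sym (∑-const L (2ℚ ^ r))) (count-unique {P = Q} {Q = Q} by-orientation by-cycles))))
    where
    r : ℕ
    r = n ℕ.+ length α ∸ 2
    l≥1 : ∀ α → 1 ≤ sum α → 1 ≤ length α
    l≥1 (_ ∷ _) _ = s≤s z≤n
    size≡ : size (blocks α 0) ≡ 2 ℕ.+ r
    size≡ = trans (cong₂ ℕ._+_ (trans (cong length (concat-blocks α 0)) (trans (length-range 0 (sum α)) sum≡))
                               (trans (sym (length-map length (blocks α 0))) (cong length (length-blocks α 0))))
      -- Both n and l are at least 1, so the truncated subtraction of 2 is exact.
      (sym (ℕₚ.m+[n∸m]≡n (ℕₚ.+-mono-≤ n≥1 (l≥1 α (ℕₚ.≤-trans n≥1 (ℕₚ.≤-reflexive (sym sum≡)))))))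
    Q : List (ℕ × ℕ) → Set
    Q = Fact r (canonPerm α) (concat (blocks α 0))
    by-cycles : Count Q (2ℚ ^ r * (ι (r !) * G α))
    by-cycles = count-≡ (cong (K r) (length-blocks α 0)) (factCount r (canon-Cycles pos) size≡)
    by-orientation : Count Q (∑ L (λ _ → 2ℚ ^ r))
    by-orientation = classify {P = Q} (map normalise) L id _ (subst Unique (sym (map-id L)) uniqueL)
      (λ {ts} f → subst (map normalise ts ∈_) (sym (map-id L)) (Equivalence.from (L⇔ (map normalise ts)) (Fact⇒Counted {α = α} sum≡ refl f)))
      λ {us} us∈ → let counted = Equivalence.to (L⇔ us) us∈ in
        count-≡ (cong (2ℚ ^_) (proj₁ counted))
          (count-⇔ (λ { {ts} refl → Counted⇒Fact {α = α} sum≡ refl counted , refl }) proj₂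
            (count-orientations (All.map proj₁ (proj₁ (proj₂ counted)))))

-- Coefficients of the series and the differential equation

module Assembly where
  open import Defs
  open Rationals
  open Sums
  open Hurwitz using (Positive⁺; M; abel-MM)
  open Convolution using (inv!; !≥1; ι!-inv!; ∑⊎-replicate)
  open CutJoin using (Φ; Φ-Split; G)
  open Factorizations using (≡ᵇ-refl; ≢⇒≡ᵇ-false)
  open GouldenJackson using (≤ᵇ-true; gouldenJackson)

  -- An inductive form of `isPartition` with an upper bound for the parts; the bound shows that the
  -- value of a run does not recur in the tail.
  data Desc : ℕ → List ℕ → Set where
    []   : ∀ {b} → Desc b []
    cons : ∀ {b x xs} → 1 ≤ x → x ≤ b → Desc x xs → Desc b (x ∷ xs)

  ∧-true : ∀ {a b} → (a ∧ b) ≡ true → a ≡ true × b ≡ true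
  ∧-true {true} e = refl , e

  ≤ᵇ⇒≤′ : ∀ m n → (m ≤ᵇ n) ≡ true → m ≤ n
  ≤ᵇ⇒≤′ m n e = ℕₚ.≤ᵇ⇒≤ m n (subst T (sym e) _)

  isPartition⇒Desc : ∀ ν → isPartition ν ≡ true → ∃ λ b → Desc b ν
  isPartition⇒Desc []       _ = 0 , []
  isPartition⇒Desc (x ∷ ν) e = x , go x ν (proj₁ (∧-true e)) (proj₂ (∧-true {nonincr (x ∷ ν)} e)) ℕₚ.≤-refl
    where
    go : ∀ {b} x ν → nonincr (x ∷ ν) ≡ true → allPos (x ∷ ν) ≡ true → x ≤ b → Desc b (x ∷ ν)
    go x []      _ p h = cons (≤ᵇ⇒≤′ 1 x (proj₁ (∧-true p))) h []
    go x (y ∷ ν) d p h = cons (≤ᵇ⇒≤′ 1 x (proj₁ (∧-true p))) h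
      (go y ν (proj₂ (∧-true {y ≤ᵇ x} d)) (proj₂ (∧-true {1 ≤ᵇ x} p)) (≤ᵇ⇒≤′ y x (proj₁ (∧-true d))))

  Desc⇒isPartition : ∀ {b ν} → Desc b ν → isPartition ν ≡ true
  Desc⇒isPartition d = cong₂ _∧_ (dec d) (pos d)
    where
    pos : ∀ {b ν} → Desc b ν → allPos ν ≡ true
    pos []           = refl
    pos (cons p _ d) = cong₂ _∧_ (≤ᵇ-true p) (pos d)
    dec : ∀ {b ν} → Desc b ν → nonincr ν ≡ true
    dec []                          = refl
    dec (cons _ _ [])               = refl
    dec (cons _ _ d@(cons _ h _)) = cong₂ _∧_ (≤ᵇ-true h) (dec d)

  Desc-mono : ∀ {b b′ ν} → b ≤ b′ → Desc b ν → Desc b′ ν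
  Desc-mono h []           = []
  Desc-mono h (cons p q d) = cons p (ℕₚ.≤-trans q h) d

  Desc-Positive : ∀ {b ν} → Desc b ν → Positive⁺ ν
  Desc-Positive []           = []
  Desc-Positive (cons p _ d) = p ∷ Desc-Positive d

  Desc-≤ : ∀ {b ν} → Desc b ν → All (_≤ b) ν
  Desc-≤ []           = []
  Desc-≤ (cons _ q d) = q ∷ All.map (λ h → ℕₚ.≤-trans h q) (Desc-≤ d)

  Desc-replicate : ∀ {b v a} j → 1 ≤ v → v ≤ b → Desc v a → Desc b (replicate j v ++ a)
  Desc-replicate zero    p q d = Desc-mono q d
  Desc-replicate (suc j) p q d = cons p q (Desc-replicate j p ℕₚ.≤-refl d)

  expand : List (ℕ × ℕ) → List ℕ
  expand []             = []
  expand ((v , d) ∷ rs) = replicate d v ++ expand rs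

  -- A value `suc v` whose tail is bounded by v is positive and larger than all later values, so
  -- each value has one run.
  data Runs : ℕ → List (ℕ × ℕ) → Set where
    []   : ∀ {b} → Runs b []
    cons : ∀ {b v d rs} → suc v ≤ b → Runs v rs → Runs b ((suc v , d) ∷ rs)

  runs-Runs : ∀ {b ν} → Desc b ν → Runs b (runs ν) × expand (runs ν) ≡ ν
  runs-Runs []                              = [] , refl
  runs-Runs (cons {x = suc x} {xs} p q d) with runs xs | runs-Runs d
  ... | [] | _ , e = cons q [] , cong (suc x ∷_) e
  ... | (suc v , k) ∷ rs | cons h r , e with x ≡ᵇ v in eq
  ...   | true with ℕₚ.≡ᵇ⇒≡ x v (subst T (sym eq) _)
  ...     | refl = cons q r , cong (suc x ∷_) e
  runs-Runs (cons {x = suc x} {xs} p q d) | (suc v , k) ∷ rs | cons h r , e | false =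
    cons q (cons (ℕₚ.≤∧≢⇒< (ℕ.s≤s⁻¹ h) (λ v≡x → subst T eq (ℕₚ.≡⇒≡ᵇ x v (sym v≡x)))) r) , cong (suc x ∷_) e

  factor : List ℕ → ℕ → ℕ
  factor α i = i ℕ.^ mult i α ℕ.* mult i α !

  zee-suc : ∀ n α → zee (suc n) α ≡ zee n α ℕ.* factor α (suc n)
  zee-suc n α = trans (cong (λ is → product (map (factor α) (map suc is))) (sym (upTo-∷ʳ n)))
    (trans (cong product (trans (cong (map (factor α)) (map-++ suc (upTo n) (n ∷ []))) (map-++ (factor α) (map suc (upTo n)) (suc n ∷ []))))
      (trans (product-++ (map (factor α) (map suc (upTo n))) (factor α (suc n) ∷ [])) (cong (zee n α ℕ.*_) (ℕₚ.*-identityʳ _))))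

  zee≥1 : ∀ n α → 1 ≤ zee n α
  zee≥1 zero    α = s≤s z≤n
  zee≥1 (suc n) α = subst (1 ≤_) (sym (zee-suc n α)) (ℕₚ.*-mono-≤ (zee≥1 n α) (ℕₚ.*-mono-≤ (ℕₚ.m^n>0 (suc n) (mult (suc n) α)) (!≥1 (mult (suc n) α))))

  mult-∉ : ∀ {i a} → All (_≢ i) a → mult i a ≡ 0
  mult-∉ {i} h = cong length (filter-none (λ x → x ℕ.≟ i) h)

  mult-replicate : ∀ j v a → mult v (replicate j v ++ a) ≡ j ℕ.+ mult v a
  mult-replicate zero    v a = refl
  mult-replicate (suc j) v a = trans (cong length (filter-accept (λ x → x ℕ.≟ v) {x = v} {xs = replicate j v ++ a} refl)) (cong suc (mult-replicate j v a))

  mult-replicate-≢ : ∀ j {v i} a → v ≢ i → mult i (replicate j v ++ a) ≡ mult i a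
  mult-replicate-≢ zero    a h = refl
  mult-replicate-≢ (suc j) {v} {i} a h = trans (cong length (filter-reject (λ x → x ℕ.≟ i) {x = v} {xs = replicate j v ++ a} h)) (mult-replicate-≢ j a h)

  module _ {v a} (v∉a : mult v a ≡ 0) (j : ℕ) where

    factor-≢ : ∀ {i} → v ≢ i → factor (replicate j v ++ a) i ≡ factor a i
    factor-≢ {i} h = cong (λ m → i ℕ.^ m ℕ.* m !) (mult-replicate-≢ j a h)

    zee-replicate-< : ∀ n → n < v → zee n (replicate j v ++ a) ≡ zee n a
    zee-replicate-< zero    h = refl
    zee-replicate-< (suc n) h = trans (zee-suc n (replicate j v ++ a)) (trans (cong₂ ℕ._*_ (zee-replicate-< n (ℕₚ.<-trans (ℕₚ.n<1+n n) h))
      (factor-≢ (λ e → ℕₚ.<-irrefl (sym e) h))) (sym (zee-suc n a)))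

    -- Only the index v sees the added copies. Since v does not occur in a, its factor changes from
    -- 1 to v^j j!.
    zee-replicate-≥ : ∀ n → 1 ≤ v → v ≤ n → zee n (replicate j v ++ a) ≡ v ℕ.^ j ℕ.* j ! ℕ.* zee n a
    zee-replicate-≥ zero    p q = contradiction (ℕₚ.≤-trans p q) λ ()
    zee-replicate-≥ (suc n) p q with v ℕ.≟ suc n
    ... | no v≢ = begin
      zee (suc n) X                                      ≡⟨ zee-suc n X ⟩
      zee n X ℕ.* factor X (suc n)                       ≡⟨ cong₂ ℕ._*_ (zee-replicate-≥ n p (ℕ.s≤s⁻¹ (ℕₚ.≤∧≢⇒< q v≢))) (factor-≢ v≢) ⟩
      v ℕ.^ j ℕ.* j ! ℕ.* zee n a ℕ.* factor a (suc n)   ≡⟨ ℕₚ.*-assoc (v ℕ.^ j ℕ.* j !) (zee n a) _ ⟩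
      v ℕ.^ j ℕ.* j ! ℕ.* (zee n a ℕ.* factor a (suc n)) ≡⟨ cong (v ℕ.^ j ℕ.* j ! ℕ.*_) (zee-suc n a) ⟨
      v ℕ.^ j ℕ.* j ! ℕ.* zee (suc n) a ∎
      where
      open ≡-Reasoning
      X : List ℕ
      X = replicate j v ++ a
    ... | yes refl = begin
      zee v X                                ≡⟨ zee-suc n X ⟩
      zee n X ℕ.* factor X v                 ≡⟨ cong₂ ℕ._*_ (zee-replicate-< n ℕₚ.≤-refl)
                                                  (cong (λ m → v ℕ.^ m ℕ.* m !) (trans (mult-replicate j v a) (trans (cong (j ℕ.+_) v∉a) (ℕₚ.+-identityʳ j)))) ⟩
      zee n a ℕ.* (v ℕ.^ j ℕ.* j !)          ≡⟨ ℕₚ.*-comm (zee n a) _ ⟩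
      v ℕ.^ j ℕ.* j ! ℕ.* zee n a            ≡⟨ cong (v ℕ.^ j ℕ.* j ! ℕ.*_) (trans (sym (ℕₚ.*-identityʳ (zee n a)))
                                                  (trans (cong (λ m → zee n a ℕ.* (v ℕ.^ m ℕ.* m !)) (sym v∉a)) (sym (zee-suc n a)))) ⟩
      v ℕ.^ j ℕ.* j ! ℕ.* zee v a ∎
      where
      open ≡-Reasoning
      X : List ℕ
      X = replicate j v ++ a

  -- Indices above all parts have multiplicity 0 and contribute 1. Thus each factor of a product may
  -- use its own degree as the range.
  zee-extend : ∀ {m a} n → All (_≤ m) a → m ≤ n → zee n a ≡ zee m a
  zee-extend {m} {a} zero    h q = cong (λ k → zee k a) (sym (ℕₚ.n≤0⇒n≡0 q))
  zee-extend {m} {a} (suc n) h q with m ℕ.≟ suc n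
  ... | yes refl = refl
  ... | no m≢ = trans (zee-suc n a) (trans (cong (λ k → zee n a ℕ.* (suc n ℕ.^ k ℕ.* k !))
      (mult-∉ (All.map (λ x≤m e → ℕₚ.<-irrefl e (ℕₚ.≤-<-trans x≤m (ℕₚ.≤∧≢⇒< q m≢))) h)))
    (trans (ℕₚ.*-identityʳ (zee n a)) (zee-extend n h (ℕ.s≤s⁻¹ (ℕₚ.≤∧≢⇒< q m≢)))))

  parts-≤-sum : ∀ a → All (_≤ sum a) a
  parts-≤-sum []      = []
  parts-≤-sum (x ∷ a) = ℕₚ.m≤m+n x (sum a) ∷ All.map (λ h → ℕₚ.≤-trans h (ℕₚ.m≤n+m (sum a) x)) (parts-≤-sum a)

  -- This is 1 / z_a, the proportion of permutations that have cycle type a.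
  invz : List ℕ → ℚ
  invz a = inv (zee (sum a) a)

  invz-replicate : ∀ {v a} j → Desc v a → invz (replicate j (suc v) ++ a) ≡ inv (suc v ℕ.^ j) * inv! j * invz a
  invz-replicate {v} {a} j d = trans (cong inv (eq j)) (trans (inv-* (ℕₚ.*-mono-≤ (ℕₚ.m^n>0 (suc v) j) (!≥1 j)) (zee≥1 (sum a) a))
    (cong (_* invz a) (inv-* (ℕₚ.m^n>0 (suc v) j) (!≥1 j))))
    where
    v∉ : mult (suc v) a ≡ 0
    v∉ = mult-∉ (All.map (λ x≤v e → ℕₚ.<-irrefl e (s≤s x≤v)) (Desc-≤ d))
    eq : ∀ j → zee (sum (replicate j (suc v) ++ a)) (replicate j (suc v) ++ a) ≡ suc v ℕ.^ j ℕ.* j ! ℕ.* zee (sum a) a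
    eq zero      = sym (ℕₚ.+-identityʳ _)
    eq j@(suc i) = trans (zee-replicate-≥ v∉ j (sum (replicate j (suc v) ++ a)) (s≤s z≤n) (ℕₚ.m≤m+n (suc v) _))
      (cong (suc v ℕ.^ j ℕ.* j ! ℕ.*_) (zee-extend (sum (replicate j (suc v) ++ a)) (parts-≤-sum a)
        (subst (sum a ≤_) (sym (sum-++ (replicate j (suc v)) a)) (ℕₚ.m≤n+m (sum a) _))))

  ∑-applyUpTo : ∀ h d (F : ℕ → ℚ) → ∑ (applyUpTo h (suc d)) F ≡ ∑⋆ (λ i _ → F (h i)) d
  ∑-applyUpTo h zero    F = +-identityʳ _
  ∑-applyUpTo h (suc d) F = cong (F (h 0) +_) (∑-applyUpTo (h ∘ suc) d F)

  ∑-upTo : ∀ d (g : ℕ → ℕ → ℚ) → ∑ (upTo (suc d)) (λ j → g j (d ∸ j)) ≡ ∑⋆ g d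
  ∑-upTo d g = trans (∑-applyUpTo id d (λ j → g j (d ∸ j)))
    (∑⋆-cong-+ d (λ i j e → cong (g i) (trans (cong (_∸ i) (sym e)) (ℕₚ.m+n∸m≡n i j))))

  record IsSplit (b : ℕ) (rs : List (ℕ × ℕ)) (p : List ℕ × List ℕ) : Set where
    constructor isSplit
    field
      left    : Desc b (proj₁ p)
      right   : Desc b (proj₂ p)
      sums    : sum (proj₁ p) ℕ.+ sum (proj₂ p) ≡ sum (expand rs)
      lengths : length (proj₁ p) ℕ.+ length (proj₂ p) ≡ length (expand rs)
  open IsSplit

  sum-replicate : ∀ j v → sum (replicate j v) ≡ j ℕ.* v
  sum-replicate zero    v = refl
  sum-replicate (suc j) v = cong (v ℕ.+_) (sum-replicate j v)

  splitsR-IsSplit : ∀ {b rs p} → Runs b rs → p ∈ splitsR rs → IsSplit b rs p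
  splitsR-IsSplit [] (here refl) = isSplit [] [] refl refl
  splitsR-IsSplit {b} {rs = (suc v , d) ∷ rs} (cons h r) m
    with find (∈-concatMap⁻ _ {xs = upTo (suc d)} m)
  ... | j , j∈ , m′ with ∈-map⁻ _ m′
  ...   | (a , c) , m″ , refl = isSplit
    (Desc-replicate j (s≤s z≤n) h (Desc-mono (ℕₚ.n≤1+n v) (left s)))
    (Desc-replicate (d ∸ j) (s≤s z≤n) h (Desc-mono (ℕₚ.n≤1+n v) (right s)))
    (begin
      sum (replicate j (suc v) ++ a) ℕ.+ sum (replicate (d ∸ j) (suc v) ++ c)
        ≡⟨ cong₂ ℕ._+_ (trans (sum-++ (replicate j (suc v)) a) (cong (ℕ._+ sum a) (sum-replicate j (suc v))))
                       (trans (sum-++ (replicate (d ∸ j) (suc v)) c) (cong (ℕ._+ sum c) (sum-replicate (d ∸ j) (suc v)))) ⟩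
      (j ℕ.* suc v ℕ.+ sum a) ℕ.+ ((d ∸ j) ℕ.* suc v ℕ.+ sum c)
        ≡⟨ lem j (d ∸ j) (suc v) (sum a) (sum c) ⟩
      (j ℕ.+ (d ∸ j)) ℕ.* suc v ℕ.+ (sum a ℕ.+ sum c)
        ≡⟨ cong₂ (λ k s → k ℕ.* suc v ℕ.+ s) j+ (sums s) ⟩
      d ℕ.* suc v ℕ.+ sum (expand rs)
        ≡⟨ trans (sum-++ (replicate d (suc v)) (expand rs)) (cong (ℕ._+ sum (expand rs)) (sum-replicate d (suc v))) ⟨
      sum (replicate d (suc v) ++ expand rs) ∎)
    (begin
      length (replicate j (suc v) ++ a) ℕ.+ length (replicate (d ∸ j) (suc v) ++ c)
        ≡⟨ cong₂ ℕ._+_ (trans (length-++ (replicate j (suc v))) (cong (ℕ._+ length a) (length-replicate j)))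
                       (trans (length-++ (replicate (d ∸ j) (suc v))) (cong (ℕ._+ length c) (length-replicate (d ∸ j)))) ⟩
      (j ℕ.+ length a) ℕ.+ ((d ∸ j) ℕ.+ length c)
        ≡⟨ lem′ j (d ∸ j) (length a) (length c) ⟩
      (j ℕ.+ (d ∸ j)) ℕ.+ (length a ℕ.+ length c)
        ≡⟨ cong₂ ℕ._+_ j+ (lengths s) ⟩
      d ℕ.+ length (expand rs)
        ≡⟨ trans (length-++ (replicate d (suc v))) (cong (ℕ._+ length (expand rs)) (length-replicate d)) ⟨
      length (replicate d (suc v) ++ expand rs) ∎)
    where
    open ≡-Reasoning
    s : IsSplit v rs (a , c)
    s = splitsR-IsSplit r m″
    j+ : j ℕ.+ (d ∸ j) ≡ d
    j+ = ℕₚ.m+[n∸m]≡n (ℕ.s≤s⁻¹ (∈-upTo⁻ j∈))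
    lem : ∀ j k v a c → (j ℕ.* v ℕ.+ a) ℕ.+ (k ℕ.* v ℕ.+ c) ≡ (j ℕ.+ k) ℕ.* v ℕ.+ (a ℕ.+ c)
    lem = ℕ-Solver.solve-∀
    lem′ : ∀ j k a c → (j ℕ.+ a) ℕ.+ (k ℕ.+ c) ≡ (j ℕ.+ k) ℕ.+ (a ℕ.+ c)
    lem′ = ℕ-Solver.solve-∀

  zinv : List (ℕ × ℕ) → ℚ
  zinv []             = 1ℚ
  zinv ((v , d) ∷ rs) = inv (v ℕ.^ d) * inv! d * zinv rs

  invz-expand : ∀ {b rs} → Runs b rs → Desc b (expand rs) × invz (expand rs) ≡ zinv rs
  invz-expand [] = [] , inv-1
  invz-expand {rs = (suc v , d) ∷ rs} (cons h r) with invz-expand r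
  ... | desc , e = Desc-replicate d (s≤s z≤n) h (Desc-mono (ℕₚ.n≤1+n v) desc)
                 , trans (invz-replicate d desc) (cong (inv (suc v ℕ.^ d) * inv! d *_) e)

  -- A run of d equal parts split into i + j has weight 1/(i! j!) on the left, which is 1/d! times
  -- the number of ways to choose i of the d positions. The powers of v multiply to v^d, so run by
  -- run the weights turn multiset splits into position splits.
  ∑-splitsR : ∀ {b} rs → Runs b rs → (Ψ : List ℕ → List ℕ → ℚ) →
    ∑ (splitsR rs) (λ p → Ψ (proj₁ p) (proj₂ p) * (invz (proj₁ p) * invz (proj₂ p))) ≡ zinv rs * ∑⊎ (expand rs) Ψ
  ∑-splitsR [] [] Ψ = trans (+-identityʳ _) (trans (cong (λ i → Ψ [] [] * (i * i)) inv-1) (ring (Ψ [] [])))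
    where
    ring : ∀ x → x * (1ℚ * 1ℚ) ≡ 1ℚ * x
    ring = solve-∀ ℚ-ring
  ∑-splitsR ((suc v , d) ∷ rs) (cons h r) Ψ = begin
    ∑ (splitsR ((suc v , d) ∷ rs)) F
      ≡⟨ trans (∑-concatMap (λ j → map (attach j) (splitsR rs)) (upTo (suc d)) F) (∑-cong (upTo (suc d)) (λ j → ∑-map (attach j) (splitsR rs) F)) ⟩
    ∑ (upTo (suc d)) (λ j → ∑ (splitsR rs) (λ p → F (attach j p)))
      ≡⟨ ∑-cong-∈ (upTo (suc d)) (λ {j} j∈ → inner j (ℕₚ.m+[n∸m]≡n (ℕ.s≤s⁻¹ (∈-upTo⁻ j∈)))) ⟩
    ∑ (upTo (suc d)) (λ j → inv (suc v ℕ.^ d) * zinv rs * (inv! j * inv! (d ∸ j) * Θ j (d ∸ j)))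
      ≡⟨ ∑-*ˡ (upTo (suc d)) (inv (suc v ℕ.^ d) * zinv rs) _ ⟨
    inv (suc v ℕ.^ d) * zinv rs * ∑ (upTo (suc d)) (λ j → inv! j * inv! (d ∸ j) * Θ j (d ∸ j))
      ≡⟨ cong (inv (suc v ℕ.^ d) * zinv rs *_) (∑-upTo d (λ i j → inv! i * inv! j * Θ i j)) ⟩
    inv (suc v ℕ.^ d) * zinv rs * X
      ≡⟨ cong (inv (suc v ℕ.^ d) * zinv rs *_) (trans (sym (*-identityˡ X)) (cong (_* X) (sym (trans (*-comm (inv! d) _) (ι!-inv! d))))) ⟩
    inv (suc v ℕ.^ d) * zinv rs * (inv! d * ι (d !) * X)
      ≡⟨ ring (inv (suc v ℕ.^ d)) (zinv rs) (inv! d) (ι (d !)) X ⟩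
    zinv ((suc v , d) ∷ rs) * (ι (d !) * X)
      ≡⟨ cong (zinv ((suc v , d) ∷ rs) *_) (∑⊎-replicate d (suc v) (expand rs) Ψ) ⟨
    zinv ((suc v , d) ∷ rs) * ∑⊎ (expand ((suc v , d) ∷ rs)) Ψ ∎
    where
    open ≡-Reasoning
    rep : ℕ → List ℕ → List ℕ
    rep j a = replicate j (suc v) ++ a
    attach : ℕ → List ℕ × List ℕ → List ℕ × List ℕ
    attach j p = rep j (proj₁ p) , rep (d ∸ j) (proj₂ p)
    F : List ℕ × List ℕ → ℚ
    F p = Ψ (proj₁ p) (proj₂ p) * (invz (proj₁ p) * invz (proj₂ p))
    Θ : ℕ → ℕ → ℚ
    Θ i j = ∑⊎ (expand rs) (λ S T → Ψ (rep i S) (rep j T))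
    X : ℚ
    X = ∑⋆ (λ i j → inv! i * inv! j * Θ i j) d
    ring : ∀ p z i f x → p * z * (i * f * x) ≡ p * i * z * (f * x)
    ring = solve-∀ ℚ-ring
    ring′ : ∀ x p q i j s t → x * (p * i * s * (q * j * t)) ≡ p * q * (i * j) * (x * (s * t))
    ring′ = solve-∀ ℚ-ring
    ring″ : ∀ p i j z x → p * (i * j) * (z * x) ≡ p * z * (i * j * x)
    ring″ = solve-∀ ℚ-ring
    pow : ∀ j k → j ℕ.+ k ≡ d → inv (suc v ℕ.^ j) * inv (suc v ℕ.^ k) ≡ inv (suc v ℕ.^ d)
    pow j k e = trans (sym (inv-* (ℕₚ.m^n>0 (suc v) j) (ℕₚ.m^n>0 (suc v) k)))
                  (cong inv (trans (sym (ℕₚ.^-distribˡ-+-* (suc v) j k)) (cong (suc v ℕ.^_) e)))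
    inner : ∀ j → j ℕ.+ (d ∸ j) ≡ d → ∑ (splitsR rs) (λ p → F (attach j p))
            ≡ inv (suc v ℕ.^ d) * zinv rs * (inv! j * inv! (d ∸ j) * Θ j (d ∸ j))
    inner j e = begin
      ∑ (splitsR rs) (λ p → F (attach j p))
        ≡⟨ ∑-cong-∈ (splitsR rs) (λ {p} m → let s = splitsR-IsSplit r m in
             trans (cong₂ (λ x y → Ψ (rep j (proj₁ p)) (rep k (proj₂ p)) * (x * y)) (invz-replicate j (left s)) (invz-replicate k (right s)))
              (trans (ring′ (Ψ (rep j (proj₁ p)) (rep k (proj₂ p))) (inv (suc v ℕ.^ j)) (inv (suc v ℕ.^ k)) (inv! j) (inv! k) (invz (proj₁ p)) (invz (proj₂ p)))
                (cong (λ x → x * (inv! j * inv! k) * (Ψ (rep j (proj₁ p)) (rep k (proj₂ p)) * (invz (proj₁ p) * invz (proj₂ p)))) (pow j k e)))) ⟩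
      ∑ (splitsR rs) (λ p → inv (suc v ℕ.^ d) * (inv! j * inv! k) * (Ψ (rep j (proj₁ p)) (rep k (proj₂ p)) * (invz (proj₁ p) * invz (proj₂ p))))
        ≡⟨ ∑-*ˡ (splitsR rs) (inv (suc v ℕ.^ d) * (inv! j * inv! k)) _ ⟨
      inv (suc v ℕ.^ d) * (inv! j * inv! k) * ∑ (splitsR rs) (λ p → Ψ (rep j (proj₁ p)) (rep k (proj₂ p)) * (invz (proj₁ p) * invz (proj₂ p)))
        ≡⟨ cong (inv (suc v ℕ.^ d) * (inv! j * inv! k) *_) (∑-splitsR rs r (λ S T → Ψ (rep j S) (rep k T))) ⟩
      inv (suc v ℕ.^ d) * (inv! j * inv! k) * (zinv rs * Θ j k)
        ≡⟨ ring″ (inv (suc v ℕ.^ d)) (inv! j) (inv! k) (zinv rs) (Θ j k) ⟩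
      inv (suc v ℕ.^ d) * zinv rs * (inv! j * inv! k * Θ j k) ∎
      where
      k : ℕ
      k = d ∸ j

  ∑-applyUpTo-0 : ∀ h n (g : ℕ → ℚ) → (∀ i → g (h i) ≡ 0ℚ) → ∑ (applyUpTo h n) g ≡ 0ℚ
  ∑-applyUpTo-0 h zero    g z = refl
  ∑-applyUpTo-0 h (suc n) g z = cong₂ _+_ (z 0) (∑-applyUpTo-0 (h ∘ suc) n g (z ∘ suc))

  ∑-applyUpTo-δ : ∀ h {n k} (g : ℕ → ℚ) → k < n → (∀ i → i ≢ k → g (h i) ≡ 0ℚ) → ∑ (applyUpTo h n) g ≡ g (h k)
  ∑-applyUpTo-δ h {suc n} {zero}  g k<n z =
    trans (cong (g (h 0) +_) (∑-applyUpTo-0 (h ∘ suc) n g (λ i → z (suc i) (λ ())))) (+-identityʳ _)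
  ∑-applyUpTo-δ h {suc n} {suc k} g (s≤s k<n) z =
    trans (cong₂ _+_ (z 0 (λ ())) (∑-applyUpTo-δ (h ∘ suc) g k<n (λ i i≢k → z (suc i) (i≢k ∘ ℕₚ.suc-injective)))) (+-identityˡ _)

  module _ (H : List ℕ → ℕ) (hurwitz : ∀ n α → 1 ≤ n → α ⊢ n → IsHurwitzNumber n α (H α)) where

    Ĥ Y : Series
    Ĥ = Hhat H
    Y = zD (zD Ĥ)

    Ĥ-≢n : ∀ {n} k ν → sum ν ≢ n → Ĥ n k ν ≡ 0ℚ
    Ĥ-≢n k ν h with isPartition ν
    ... | false = refl
    ... | true rewrite ≢⇒≡ᵇ-false h = refl

    Ĥ-≢k : ∀ n {k} ν → k ≢ length ν → Ĥ n k ν ≡ 0ℚ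
    Ĥ-≢k n ν h with isPartition ν | sum ν ≡ᵇ n
    ... | false | _     = refl
    ... | true  | false = refl
    ... | true  | true rewrite ≢⇒≡ᵇ-false h = refl

    -- Both factorials of the definition cancel: n! against the class size, and (n + l - 2)! against
    -- the one in `gouldenJackson`.
    Ĥ-value : ∀ {b ν} → Desc b ν → 1 ≤ sum ν → Ĥ (sum ν) (length ν) ν ≡ G ν * invz ν
    Ĥ-value {ν = ν} d n≥1 = begin
      Ĥ n (length ν) ν
        ≡⟨ unfold ⟩
      frac (H ν) 1 * frac 1 (n !) * classSize n ν * frac 1 (r !)
        ≡⟨ cong₂ _*_ (cong₂ _*_ (cong₂ _*_ (trans (ι-def (H ν)) (gouldenJackson n≥1 (Desc-Positive d) refl (hurwitz n ν n≥1 (Desc⇒isPartition d , refl)))) (inv-def (n !)))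
             (frac-ι-inv (n !) (zee≥1 n ν))) (inv-def (r !)) ⟩
      ι (r !) * G ν * inv! n * (ι (n !) * invz ν) * inv! r
        ≡⟨ ring (ι (r !)) (inv! r) (ι (n !)) (inv! n) (G ν) (invz ν) ⟩
      (ι (r !) * inv! r) * (ι (n !) * inv! n) * (G ν * invz ν)
        ≡⟨ cong₂ (λ x y → x * y * (G ν * invz ν)) (ι!-inv! r) (ι!-inv! n) ⟩
      1ℚ * 1ℚ * (G ν * invz ν)
        ≡⟨ *-identityˡ (G ν * invz ν) ⟩
      G ν * invz ν ∎
      where
      open ≡-Reasoning
      n r : ℕ
      n = sum ν
      r = n ℕ.+ length ν ∸ 2
      ring : ∀ f i g j x z → f * x * j * (g * z) * i ≡ (f * i) * (g * j) * (x * z)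
      ring = solve-∀ ℚ-ring
      unfold : Ĥ n (length ν) ν ≡ frac (H ν) 1 * frac 1 (n !) * classSize n ν * frac 1 (r !)
      unfold rewrite Desc⇒isPartition d | ≡ᵇ-refl n | ≡ᵇ-refl (length ν) | ≤ᵇ-true n≥1 = refl

    Y-Ĥ : ∀ n k ν → Y n k ν ≡ ι n * (ι n * Ĥ n k ν)
    Y-Ĥ n k ν = cong₂ (λ a b → a * (b * Ĥ n k ν)) (ι-def n) (ι-def n)

    Y-0 : ∀ n k ν → Ĥ n k ν ≡ 0ℚ → Y n k ν ≡ 0ℚ
    Y-0 n k ν e = trans (Y-Ĥ n k ν) (trans (cong (λ x → ι n * (ι n * x)) e) (ring (ι n)))
      where
      ring : ∀ x → x * (x * 0ℚ) ≡ 0ℚ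
      ring = solve-∀ ℚ-ring

    -- Applying z∂/∂z twice multiplies by n², raising n^(l-3) to n^(l-1). The value `M []` = 0 was
    -- chosen so that the constant term fits as well.
    Y-value : ∀ {b ν} → Desc b ν → Y (sum ν) (length ν) ν ≡ Φ ν * M ν * invz ν
    Y-value [] = trans (Y-Ĥ 0 0 []) (trans (cong (λ a → a * (a * Ĥ 0 0 [])) ι-0)
      (trans (ring (Ĥ 0 0 [])) (sym (trans (cong (λ i → 1ℚ * (1ℚ * i) * invz []) inv-0) (ring′ (invz []))))))
      where
      ring : ∀ x → 0ℚ * (0ℚ * x) ≡ 0ℚ
      ring = solve-∀ ℚ-ring
      ring′ : ∀ x → 1ℚ * (1ℚ * 0ℚ) * x ≡ 0ℚ
      ring′ = solve-∀ ℚ-ring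
    Y-value {ν = ν@(x ∷ xs)} d@(cons p _ _) = begin
      Y n (length ν) ν
        ≡⟨ trans (Y-Ĥ n (length ν) ν) (cong (λ y → ι n * (ι n * y)) (Ĥ-value d n≥1)) ⟩
      ι n * (ι n * (Φ ν * (ι n ^ length ν * (inv n * inv n * inv n)) * invz ν))
        ≡⟨ ring (ι n) (inv n) (Φ ν) (ι n ^ length ν) (invz ν) ⟩
      (ι n * inv n) * (ι n * inv n) * (Φ ν * M ν * invz ν)
        ≡⟨ trans (cong (λ y → y * y * (Φ ν * M ν * invz ν)) (ι-inv⁺ n≥1)) (*-identityˡ (Φ ν * M ν * invz ν)) ⟩
      Φ ν * M ν * invz ν ∎
      where
      open ≡-Reasoning
      n : ℕ
      n = sum ν
      n≥1 : 1 ≤ n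
      n≥1 = ℕₚ.≤-trans p (ℕₚ.m≤m+n x (sum xs))
      ring : ∀ n i f q z → n * (n * (f * (q * (i * i * i)) * z)) ≡ (n * i) * (n * i) * (f * (q * i) * z)
      ring = solve-∀ ℚ-ring

    term : ℕ → ℕ → ℕ → ℕ → List ℕ × List ℕ → ℚ
    term n k n₁ k₁ p = Y n₁ k₁ (proj₁ p) * Y (n ∸ n₁) (k ∸ k₁) (proj₂ p)

    -- A split of ν determines the degrees of both factors, so the sum over splits is moved outside,
    -- where at most one pair of degrees survives.
    product≡ : ∀ n k ν → (Y · Y) n k ν ≡ ∑ (splits ν) (λ p → ∑ (upTo (suc n)) (λ n₁ → ∑ (upTo (suc k)) (λ k₁ → term n k n₁ k₁ p)))
    product≡ n k ν = trans (∑-cong (upTo (suc n)) (λ n₁ → ∑-swap (upTo (suc k)) (splits ν) (λ k₁ p → term n k n₁ k₁ p)))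
      (∑-swap (upTo (suc n)) (splits ν) (λ n₁ p → ∑ (upTo (suc k)) (λ k₁ → term n k n₁ k₁ p)))

    *-0ˡ : ∀ {x} y → x ≡ 0ℚ → x * y ≡ 0ℚ
    *-0ˡ y e = trans (cong (_* y) e) (*-zeroˡ y)

    *-0ʳ : ∀ x {y} → y ≡ 0ℚ → x * y ≡ 0ℚ
    *-0ʳ x e = trans (cong (x *_) e) (*-zeroʳ x)

    term-≢n : ∀ n k {n₁} k₁ p → n₁ ≢ sum (proj₁ p) → term n k n₁ k₁ p ≡ 0ℚ
    term-≢n n k {n₁} k₁ (a , c) h = *-0ˡ (Y (n ∸ n₁) (k ∸ k₁) c) (Y-0 n₁ k₁ a (Ĥ-≢n k₁ a (h ∘ sym)))

    term-≢k : ∀ n k n₁ {k₁} p → k₁ ≢ length (proj₁ p) → term n k n₁ k₁ p ≡ 0ℚ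
    term-≢k n k n₁ {k₁} (a , c) h = *-0ˡ (Y (n ∸ n₁) (k ∸ k₁) c) (Y-0 n₁ k₁ a (Ĥ-≢k n₁ a h))

    module _ {b ν} (d : Desc b ν) where

      rs : List (ℕ × ℕ)
      rs = runs ν

      split : ∀ {p} → p ∈ splits ν → IsSplit b rs p
      split = splitsR-IsSplit (proj₁ (runs-Runs d))

      expand≡ : expand rs ≡ ν
      expand≡ = proj₂ (runs-Runs d)

      product-value : (Y · Y) (sum ν) (length ν) ν ≡ invz ν * (Φ ν * ∑⊎ ν (λ S T → M S * M T))
      product-value = begin
        (Y · Y) (sum ν) (length ν) ν
          ≡⟨ product≡ (sum ν) (length ν) ν ⟩
        ∑ (splits ν) (λ p → ∑ (upTo (suc (sum ν))) (λ n₁ → ∑ (upTo (suc (length ν))) (λ k₁ → term (sum ν) (length ν) n₁ k₁ p)))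
          ≡⟨ ∑-cong-∈ (splits ν) single ⟩
        ∑ (splitsR rs) (λ p → Ψ (proj₁ p) (proj₂ p) * (invz (proj₁ p) * invz (proj₂ p)))
          ≡⟨ ∑-splitsR rs (proj₁ (runs-Runs d)) Ψ ⟩
        zinv rs * ∑⊎ (expand rs) Ψ
          ≡⟨ cong₂ _*_ (trans (sym (proj₂ (invz-expand (proj₁ (runs-Runs d))))) (cong invz expand≡)) (cong (λ U → ∑⊎ U Ψ) expand≡) ⟩
        invz ν * ∑⊎ ν Ψ
          ≡⟨ cong (invz ν *_) (trans (∑⊎-cong-Split ν (λ {S} {T} sp → trans (ring (Φ S) (M S) (Φ T) (M T)) (cong (_* (M S * M T)) (sym (Φ-Split sp)))))
               (sym (∑⊎-*ˡ ν (Φ ν) (λ S T → M S * M T)))) ⟩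
        invz ν * (Φ ν * ∑⊎ ν (λ S T → M S * M T)) ∎
        where
        open ≡-Reasoning
        Ψ : List ℕ → List ℕ → ℚ
        Ψ S T = (Φ S * M S) * (Φ T * M T)
        ring : ∀ a b c d → a * b * (c * d) ≡ a * c * (b * d)
        ring = solve-∀ ℚ-ring
        ring′ : ∀ a b x y → a * x * (b * y) ≡ a * b * (x * y)
        ring′ = solve-∀ ℚ-ring
        single : ∀ {p} → p ∈ splits ν →
          ∑ (upTo (suc (sum ν))) (λ n₁ → ∑ (upTo (suc (length ν))) (λ k₁ → term (sum ν) (length ν) n₁ k₁ p))
          ≡ Ψ (proj₁ p) (proj₂ p) * (invz (proj₁ p) * invz (proj₂ p))
        single {p@(a , c)} m = begin
          ∑ (upTo (suc n)) (λ n₁ → ∑ (upTo (suc k)) (λ k₁ → term n k n₁ k₁ p))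
            ≡⟨ ∑-applyUpTo-δ id {suc n} {sum a} _ (s≤s (ℕₚ.≤-trans (ℕₚ.m≤m+n (sum a) (sum c)) (ℕₚ.≤-reflexive s-sum)))
                 (λ n₁ h → ∑-applyUpTo-0 id (suc k) _ (λ k₁ → term-≢n n k k₁ p h)) ⟩
          ∑ (upTo (suc k)) (λ k₁ → term n k (sum a) k₁ p)
            ≡⟨ ∑-applyUpTo-δ id {suc k} {length a} _ (s≤s (ℕₚ.≤-trans (ℕₚ.m≤m+n (length a) (length c)) (ℕₚ.≤-reflexive s-len)))
                 (λ k₁ h → term-≢k n k (sum a) p h) ⟩
          Y (sum a) (length a) a * Y (n ∸ sum a) (k ∸ length a) c
            ≡⟨ cong₂ (λ x y → Y (sum a) (length a) a * Y x y c)
                 (trans (cong (_∸ sum a) (sym s-sum)) (ℕₚ.m+n∸m≡n (sum a) (sum c)))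
                 (trans (cong (_∸ length a) (sym s-len)) (ℕₚ.m+n∸m≡n (length a) (length c))) ⟩
          Y (sum a) (length a) a * Y (sum c) (length c) c
            ≡⟨ cong₂ _*_ (Y-value (left s)) (Y-value (right s)) ⟩
          Φ a * M a * invz a * (Φ c * M c * invz c)
            ≡⟨ ring′ (Φ a * M a) (Φ c * M c) (invz a) (invz c) ⟩
          Ψ a c * (invz a * invz c) ∎
          where
          n k : ℕ
          n = sum ν
          k = length ν
          s : IsSplit b rs p
          s = split m
          s-sum : sum a ℕ.+ sum c ≡ n
          s-sum = trans (sums s) (cong sum expand≡)
          s-len : length a ℕ.+ length c ≡ k
          s-len = trans (lengths s) (cong length expand≡)

      -- `Y` lives where the indices are the sum and the length of the partition, and both
      -- quantities are additive over splits.
      product-0 : ∀ {n k} → sum ν ≢ n ⊎ k ≢ length ν → (Y · Y) n k ν ≡ 0ℚ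
      product-0 {n} {k} bad = trans (product≡ n k ν) (trans (∑-cong-∈ (splits ν) zeros) (∑-0 (splits ν)))
        where
        zeros : ∀ {p} → p ∈ splits ν → ∑ (upTo (suc n)) (λ n₁ → ∑ (upTo (suc k)) (λ k₁ → term n k n₁ k₁ p)) ≡ 0ℚ
        zeros {p@(a , c)} m = trans (∑-cong-∈ (upTo (suc n)) (λ {n₁} n₁∈ → trans (∑-cong-∈ (upTo (suc k)) (λ {k₁} k₁∈ →
            vanish bad (ℕ.s≤s⁻¹ (∈-upTo⁻ n₁∈)) (ℕ.s≤s⁻¹ (∈-upTo⁻ k₁∈)))) (∑-0 (upTo (suc k))))) (∑-0 (upTo (suc n)))
          where
          s : IsSplit b rs p
          s = split m
          vanish : sum ν ≢ n ⊎ k ≢ length ν → ∀ {n₁ k₁} → n₁ ≤ n → k₁ ≤ k → term n k n₁ k₁ p ≡ 0ℚ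
          vanish (inj₁ n≢) {n₁} {k₁} n₁≤ _ with n₁ ℕ.≟ sum a
          ... | no h = term-≢n n k k₁ p h
          ... | yes refl = *-0ʳ (Y n₁ k₁ a) (Y-0 (n ∸ n₁) (k ∸ k₁) c (Ĥ-≢n (k ∸ k₁) c
            (λ e → n≢ (trans (sym (trans (sums s) (cong sum expand≡))) (trans (cong (n₁ ℕ.+_) e) (ℕₚ.m+[n∸m]≡n n₁≤))))))
          vanish (inj₂ k≢) {n₁} {k₁} _ k₁≤ with k₁ ℕ.≟ length a
          ... | no h = term-≢k n k n₁ p h
          ... | yes refl = *-0ʳ (Y n₁ k₁ a) (Y-0 (n ∸ n₁) (k ∸ k₁) c (Ĥ-≢k (n ∸ n₁) c
            (λ e → k≢ (trans (sym (ℕₚ.m+[n∸m]≡n k₁≤)) (trans (cong (k₁ ℕ.+_) e) (trans (lengths s) (cong length expand≡)))))))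

      equation-0 : ∀ n k → Ĥ n k ν ≡ 0ℚ → (Y · Y) n k ν ≡ 0ℚ → zD Ĥ n k ν ≡ zD (uD Ĥ) n k ν - ½ * (Y · Y) n k ν
      equation-0 n k e e′ = trans (cong (frac n 1 *_) e) (trans (ring (frac n 1) (frac k 1))
        (sym (cong₂ (λ x y → frac n 1 * (frac k 1 * x) - ½ * y) e e′)))
        where
        ring : ∀ x y → x * 0ℚ ≡ x * (y * 0ℚ) - ½ * 0ℚ
        ring x y = trans (ring₁ x y ½) refl
          where
          ring₁ : ∀ x y h → x * 0ℚ ≡ x * (y * 0ℚ) - h * 0ℚ
          ring₁ = solve-∀ ℚ-ring

      -- Moving n Ĥ across leaves n (l - 1) Ĥ, which is Φ (l - 1) n^(l-2) / z. By `abel-MM` divided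
      -- by n this is half the coefficient of the square.
      equation : 1 ≤ sum ν → zD Ĥ (sum ν) (length ν) ν ≡ zD (uD Ĥ) (sum ν) (length ν) ν - ½ * (Y · Y) (sum ν) (length ν) ν
      equation n≥1 = begin
        frac n 1 * Ĥ n l ν
          ≡⟨ ring₁ (frac n 1) (frac l 1) (Ĥ n l ν) ⟩
        frac n 1 * (frac l 1 * Ĥ n l ν) - frac n 1 * ((frac l 1 - 1ℚ) * Ĥ n l ν)
          ≡⟨ cong (λ y → frac n 1 * (frac l 1 * Ĥ n l ν) - y) half ⟩
        zD (uD Ĥ) n l ν - ½ * (Y · Y) n l ν ∎
        where
        open ≡-Reasoning
        n l : ℕ
        n = sum ν
        l = length ν
        X : ℚ
        X = ∑⊎ ν (λ S T → M S * M T)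
        ring₁ : ∀ n l h → n * h ≡ n * (l * h) - n * ((l - 1ℚ) * h)
        ring₁ = solve-∀ ℚ-ring
        ring₂ : ∀ n i l f q z → n * ((l - 1ℚ) * (f * (q * (i * i * i)) * z)) ≡ n * i * (f * z * (i * ((l - 1ℚ) * (q * i))))
        ring₂ = solve-∀ ℚ-ring
        ring₃ : ∀ h f z i m → f * z * (i * m) * (2ℚ * h) ≡ h * (z * (f * (i * (2ℚ * m))))
        ring₃ = solve-∀ ℚ-ring
        ring₄ : ∀ i n x → i * (n * x) ≡ n * i * x
        ring₄ = solve-∀ ℚ-ring
        half : frac n 1 * ((frac l 1 - 1ℚ) * Ĥ n l ν) ≡ ½ * (Y · Y) n l ν
        half = begin
          frac n 1 * ((frac l 1 - 1ℚ) * Ĥ n l ν)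
            ≡⟨ trans (cong₂ (λ x y → x * ((y - 1ℚ) * Ĥ n l ν)) (ι-def n) (ι-def l)) (cong (λ y → ι n * ((ι l - 1ℚ) * y)) (Ĥ-value d n≥1)) ⟩
          ι n * ((ι l - 1ℚ) * (Φ ν * (ι n ^ l * (inv n * inv n * inv n)) * invz ν))
            ≡⟨ ring₂ (ι n) (inv n) (ι l) (Φ ν) (ι n ^ l) (invz ν) ⟩
          ι n * inv n * (Φ ν * invz ν * (inv n * ((ι l - 1ℚ) * M ν)))
            ≡⟨ trans (cong (_* (Φ ν * invz ν * (inv n * ((ι l - 1ℚ) * M ν)))) (ι-inv⁺ n≥1))
                 (trans (*-identityˡ (Φ ν * invz ν * (inv n * ((ι l - 1ℚ) * M ν)))) (sym (*-identityʳ (Φ ν * invz ν * (inv n * ((ι l - 1ℚ) * M ν)))))) ⟩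
          Φ ν * invz ν * (inv n * ((ι l - 1ℚ) * M ν)) * (2ℚ * ½)
            ≡⟨ ring₃ ½ (Φ ν) (invz ν) (inv n) ((ι l - 1ℚ) * M ν) ⟩
          ½ * (invz ν * (Φ ν * (inv n * (2ℚ * ((ι l - 1ℚ) * M ν)))))
            ≡⟨ cong (λ y → ½ * (invz ν * (Φ ν * (inv n * y)))) (abel-MM (Desc-Positive d)) ⟨
          ½ * (invz ν * (Φ ν * (inv n * (ι n * X))))
            ≡⟨ cong (λ y → ½ * (invz ν * (Φ ν * y))) (trans (ring₄ (inv n) (ι n) X) (trans (cong (_* X) (ι-inv⁺ n≥1)) (*-identityˡ X))) ⟩
          ½ * (invz ν * (Φ ν * X))
            ≡⟨ cong (½ *_) product-value ⟨
          ½ * (Y · Y) n l ν ∎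

  differential-equation : (H : List ℕ → ℕ) →
    (∀ n α → 1 ≤ n → α ⊢ n → IsHurwitzNumber n α (H α)) →
    ∀ n k ν → isPartition ν ≡ true →
    zD (Hhat H) n k ν ≡ zD (uD (Hhat H)) n k ν - ½ * (zD (zD (Hhat H)) · zD (zD (Hhat H))) n k ν
  differential-equation H hurwitz n k ν partition with isPartition⇒Desc ν partition | sum ν ℕ.≟ n | k ℕ.≟ length ν
  ... | _ , d | no n≢    | _        = equation-0 H hurwitz d n k (Ĥ-≢n H hurwitz k ν n≢) (product-0 H hurwitz d {n} {k} (inj₁ n≢))
  ... | _ , d | yes refl | no k≢    = equation-0 H hurwitz d n k (Ĥ-≢k H hurwitz n ν k≢) (product-0 H hurwitz d {n} {k} (inj₂ k≢))
  -- The constant term: Ĥ starts at n = 1, and the coefficient of the square vanishes because `M []`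
  -- is 0.
  ... | _ , [] | yes refl | yes refl = equation-0 H hurwitz {b = 0} [] 0 0 refl
    (trans (product-value H hurwitz {b = 0} []) (trans (cong (λ i → invz [] * (1ℚ * (1ℚ * i * (1ℚ * i)))) inv-0) (*-zeroʳ (invz []))))
  ... | _ , d@(cons {x = x} {xs} p _ _) | yes refl | yes refl = equation H hurwitz d (ℕₚ.≤-trans p (ℕₚ.m≤m+n x (sum xs)))

open import Defs
open import Data.Nat using (ℕ; _≤_)
open import Data.Bool using (true)
open import Data.List using (List)
open import Data.Rational using (_*_; _-_; ½)
open import Relation.Binary.PropositionalEquality using (_≡_)

theorem6 : (H : List ℕ → ℕ) →
    (∀ n α → 1 ≤ n → α ⊢ n → IsHurwitzNumber n α (H α)) →
    ∀ n k ν → isPartition ν ≡ true →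
    zD (Hhat H) n k ν
    ≡ zD (uD (Hhat H)) n k ν
    - ½ * ((zD (zD (Hhat H))) · (zD (zD (Hhat H)))) n k ν
theorem6 = Assembly.differential-equation
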